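{- Let $\alpha,\beta\ge 2$, let $t\ge 2$ be even, and let $\kappa=\kappa(\alpha,\beta)$ be the complete bipartite graph on $\alpha$ white and $\beta$ black vertices. Then $$K_\epsilon(C^\star(\Lambda_t(\kappa)))\cong\big(K_\epsilon(C^\star(\Lambda(\kappa)))\big)^{t/2}$$ for $\epsilon=0,1$, where $\Lambda_t(\kappa)$ is the $2$-rank graph of the pointed $2t$-gon system of $\kappa$ and $\Lambda(\kappa)$ is the $2$-rank graph of the pointed tile system of $\kappa$.
   Context: Pointed tile system of $\kappa=\kappa(\alpha,\beta)$. Let $U=\{u_i^1,u_i^2,\bar u_i^1,\bar u_i^2: 1\le i\le\alpha\}$ and $V=\{v_j^1,v_j^2,\bar v_j^1,\bar v_j^2:1\le j\le\beta\}$ be sets of $4\alpha$ and $4\beta$ distinct elements, with fixed-point-free involutions $x\mapsto\bar x$ exchanging $u_i^r\leftrightarrow\bar u_i^r$ and $v_j^r\leftrightarrow\bar v_j^r$. The set of pointed tiles $\mathcal S(\kappa)\subseteq U\times V\times U\times V$ consists of the $4\alpha\beta$ tuples $[u_i^1,v_j^1,u_i^2,v_j^2]$, $[\bar u_i^1,\bar v_j^2,\bar u_i^2,\bar v_j^1]$, $[u_i^2,v_j^2,u_i^1,v_j^1]$, $[\bar u_i^2,\bar v_j^1,\bar u_i^1,\bar v_j^2]$. For $A=[x_1,y_1,x_2,y_2]$, $B=[x_3,y_3,x_4,y_4]$ in $\mathcal S(\kappa)$: $M_1(A,B)=1$ if $y_1=\bar y_4$ and $x_1\ne\bar x_3$,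 and $0$ otherwise; $M_2(A,B)=1$ if $x_2=\bar x_3$ and $y_1\neq\bar y_3$, and $0$ otherwise. Pointed $2t$-gon system of $\kappa$ ($t$ even). Now let $U=\{u_i^r,\bar u_i^r:1\le i\le\alpha,1\le r\le t\}$ and $V=\{v_j^r,\bar v_j^r:1\le j\le\beta,1\le r\le t\}$ ($2t\alpha$ and $2t\beta$ distinct elements, with the involutions $u_i^r\leftrightarrow\bar u_i^r$, $v_j^r\leftrightarrow\bar v_j^r$). The set $\mathcal S_t(\kappa)$ of pointed $2t$-gons consists of the $2t\alpha\beta$ sequences, for $1\le i\le\alpha$, $1\le j\le\beta$, $1\le r\le t$ (superscripts mod $t$): $[u_i^r,v_j^r,u_i^{r+1},v_j^{r+1},\dots,u_i^{r-1},v_j^{r-1}]$ and $[\bar u_i^r,\bar v_j^{r-1},\bar u_i^{r-1},\bar v_j^{r-2},\dots,\bar u_i^{r+1},\bar v_j^r]$. Let $A=[x_1,y_1,\dots,x_t,y_t]\in\mathcal S_t(\kappa)$. A pointed $2t$-gon $B\in\mathcal S_t(\kappa)$ is $V$-adjacent to $A$ if $B=[\bar x_1',\bar y_t,\bar x_t',\bar y_{t-1},\dots,\bar x_2',\bar y_1]$ for some $x_i'\in U$ with $x_i'\neq x_i$ for all $i$. It is $U$-adjacent to $A$ if $B=[\bar x_{(t/2)+1},\bar y'_{t/2},\bar x_{t/2},\dots,\bar y_1',\bar x_1,\bar y_t',\bar x_t,\dots,\bar x_{(t/2)+2},\bar y'_{(t/2)+1}]$ for some $y_i'\in V$ with $y_i'\ne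 y_i$ for all $i$. The matrices $M_U,M_V$ are the $\mathcal S_t(\kappa)\times\mathcal S_t(\kappa)$ matrices with $(A,B)$ entry $1$ if $B$ is $U$-adjacent (resp. $V$-adjacent) to $A$, and $0$ otherwise. Higher-rank graphs. A $k$-rank graph is a countable small category $\Lambda$ (objects identified with identity morphisms; $r(\lambda)$ is the codomain and $s(\lambda)$ the domain of $\lambda$) with a functor $d:\Lambda\to\mathbb N^k$ ($0\in\mathbb N$) such that whenever $d(\lambda)=\mathbf m+\mathbf n$ there are unique $\mu,\nu$ with $\lambda=\nu\mu$, $d(\mu)=\mathbf m$, $d(\nu)=\mathbf n$. Write $\Lambda^{\mathbf n}=d^{ -1}(\mathbf n)$ (so $\Lambda^{\mathbf 0}$ is the set of vertices) and $\Lambda^{\mathbf n}(v)=\{\lambda\in\Lambda^{\mathbf n}: r(\lambda)=v\}$. $\Lambda$ is row-finite if all $\Lambda^{\mathbf n}(v)$ are finite, and has no sources if all are non-empty. For a finite set $S$ and commuting $\{0,1\}$-valued $S\times S$ matrices $N_1,N_2$ with $N_1N_2$ also $\{0,1\}$-valued, $\Lambda(S;N_1,N_2)$ is the $2$-rank graph whose morphisms of degree $(m,n)$ are the maps $\varphi:\{0,\dots,m\}\times\{0,\dots,n\}\to S$ with $N_1(\varphi(p,q),\varphi(p+1,q))=1$ and $N_2(\varphi(p,q),\varphi(p,q+1))=1$ whenever defined; $r(\varphi)=\varphi(0,0)$, $s(\varphi)=\varphi(m,n)$; and if $s(\varphi_1)=r(\varphi_2)$, where $\varphi_i$ has degree $(m_i,n_i)$,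 the composite $\varphi_1\varphi_2$ is the unique morphism $\chi$ of degree $(m_1+m_2,n_1+n_2)$ with $\chi(p,q)=\varphi_1(p,q)$ and $\chi(m_1+p,n_1+q)=\varphi_2(p,q)$. Put $\Lambda(\kappa)=\Lambda(\mathcal S(\kappa);M_1,M_2)$ and $\Lambda_t(\kappa)=\Lambda(\mathcal S_t(\kappa);M_U,M_V)$. For a row-finite $k$-rank graph $\Lambda$ with no sources, $C^\star(\Lambda)$ is the universal $C^\star$-algebra generated by partial isometries $\{s_\lambda:\lambda\in\Lambda\}$ such that: (a) $(s_v)^2=s_v=s_v^*$ for $v\in\Lambda^{\mathbf 0}$ and $s_us_v=0$ for $u\ne v$ in $\Lambda^{\mathbf 0}$; (b) $s_{\mu\lambda}=s_\mu s_\lambda$ whenever $r(\lambda)=s(\mu)$; (c) $s_\lambda^*s_\lambda=s_{s(\lambda)}$; (d) $s_v=\sum_{\lambda\in\Lambda^{\mathbf n}(v)}s_\lambda s_\lambda^*$ for all $v\in\Lambda^{\mathbf 0}$, $\mathbf n\in\mathbb N^k$. -}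

module Defs where

open import Algebra.Bundles using (CommutativeRing; CommutativeMonoid; AbelianGroup; RawGroup; RingWithoutOne)
open import Algebra.Morphism.Structures using (module GroupMorphisms; module MonoidMorphisms)
open import Algebra.Structures using (IsRingWithoutOne)
open import Data.Fin.Base using (Fin; zero; suc; toℕ; fromℕ<; splitAt; _↑ˡ_; _↑ʳ_)
import Data.Fin.Permutation as Permutation
open import Data.Fin.Permutation using (Permutation; _⟨$⟩ʳ_)
open import Data.Fin.Properties using (toℕ-injective; splitAt-↑ˡ; splitAt-↑ʳ; +↔⊎)
open import Data.List.Base using (List; []; _∷_; map; foldr; lookup; allFin; cartesianProduct; cartesianProductWith)
open import Data.List.Relation.Unary.All as All using (All; []; _∷_)
open import Data.List.Relation.Unary.AllPairs using (AllPairs; []; _∷_)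
open import Data.List.Relation.Unary.Any as Any using (Any; here; there)
open import Data.Vec.Base using (Vec; []; _∷_; zipWith; replicate)
open import Relation.Binary.Structures using (IsEquivalence)
open import Data.Nat.Base as ℕ using (ℕ; zero; suc)
open import Data.Nat.Properties using (_<?_)
open import Data.Product.Base using (Σ; ∃; ∃-syntax; _×_; _,_; proj₁; proj₂)
open import Data.Sum.Algebra using (⊎-comm; ⊎-assoc)
open import Data.Sum.Base as Sum using (_⊎_; inj₁; inj₂; [_,_]′)
open import Data.Sum.Function.Propositional using (_⊎-↔_)
open import Function.Base using (_∘_; flip; const)
open import Function.Properties.Inverse using (↔-sym; ↔-trans; ↔-refl)
open import Level using (Level; 0ℓ; _⊔_) renaming (suc to lsuc)
open import Relation.Binary.Core using (Rel)
open import Relation.Binary.Definitions using (_Respects₂_; Irreflexive; Transitive)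
open import Relation.Binary.PropositionalEquality as ≡ using (_≡_; _≢_)
open import Relation.Nullary.Decidable.Core using (Dec; yes; no)
open import Relation.Nullary.Negation using (¬_; contradiction)
import Algebra.Definitions.RawMonoid
import Algebra.Properties.AbelianGroup as AbelianGroupProperties
import Algebra.Properties.CommutativeMonoid.Sum as CMSum
import Algebra.Properties.Group as GroupProperties
import Algebra.Properties.Ring as RingProperties
import Algebra.Solver.CommutativeMonoid as CMSolver
import Algebra.Solver.Ring.NaturalCoefficients.Default as NatSolver
import Relation.Binary.Reasoning.Setoid as SetoidReasoning

-- The real numbers are taken as an arbitrary Cauchy-complete Archimedean
-- ordered field; such a structure is unique up to isomorphism. The order
-- axioms are the constructive ones, and classically they are the usual ones.

record RealField : Set₁ where
  infix 4 _<_ _≤_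
  field
    commutativeRing : CommutativeRing 0ℓ 0ℓ

  open CommutativeRing commutativeRing public
  open Algebra.Definitions.RawMonoid +-rawMonoid using () renaming (_×_ to _·_)

  field
    _<_ : Rel Carrier 0ℓ

  _≤_ : Rel Carrier 0ℓ
  x ≤ y = ¬ (y < x)

  ι : ℕ → Carrier
  ι n = n · 1#

  Within : Carrier → Rel Carrier 0ℓ
  Within ε x y = (x - y) < ε × (y - x) < ε

  field
    <-resp-≈    : _<_ Respects₂ _≈_
    <-irrefl    : Irreflexive _≈_ _<_
    <-trans     : Transitive _<_
    <-cotrans   : ∀ {x y} → x < y → ∀ z → x < z ⊎ z < y
    <-tight     : ∀ {x y} → x ≤ y → y ≤ x → x ≈ y
    0<1         : 0# < 1#
    +-monoˡ-<   : ∀ {x y} z → x < y → (x + z) < (y + z)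
    *-positive  : ∀ {x y} → 0# < x → 0# < y → 0# < (x * y)
    recip       : ∀ {x} → 0# < x → ∃[ y ] 0# < y × (x * y) ≈ 1#
    archimedean : ∀ x → ∃[ n ] x < ι n
    complete    : (f : ℕ → Carrier) →
      (∀ ε → 0# < ε → ∃[ N ] ∀ m n → N ℕ.≤ m → N ℕ.≤ n → Within ε (f m) (f n)) →
      ∃[ x ] ∀ ε → 0# < ε → ∃[ N ] ∀ n → N ℕ.≤ n → Within ε (f n) x

-- *-rings, not assumed to have a unit.

record StarRing (c ℓ : Level) : Set (lsuc (c ⊔ ℓ)) where
  infix 9 _⋆
  field
    ringWithoutOne : RingWithoutOne c ℓ

  open RingWithoutOne ringWithoutOne public

  +-commutativeMonoid : CommutativeMonoid c ℓ
  +-commutativeMonoid = record { isCommutativeMonoid = +-isCommutativeMonoid }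

  field
    _⋆           : Carrier → Carrier
    ⋆-cong       : ∀ {x y} → x ≈ y → x ⋆ ≈ y ⋆
    ⋆-involutive : ∀ x → x ⋆ ⋆ ≈ x
    ⋆-+          : ∀ x y → (x + y) ⋆ ≈ x ⋆ + y ⋆
    ⋆-*          : ∀ x y → (x * y) ⋆ ≈ y ⋆ * x ⋆

module Complex (ℝ : RealField) where
  module R = RealField ℝ

  record ℂ : Set where
    constructor _+i_
    field
      re : R.Carrier
      im : R.Carrier

  open ℂ public

  infix  4 _≈ᶜ_
  infixl 6 _+ᶜ_
  infixl 7 _*ᶜ_

  _≈ᶜ_ : Rel ℂ 0ℓ
  z ≈ᶜ w = re z R.≈ re w × im z R.≈ im w

  _+ᶜ_ _*ᶜ_ : ℂ → ℂ → ℂ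
  (a +i b) +ᶜ (c +i d) = (a R.+ c) +i (b R.+ d)
  (a +i b) *ᶜ (c +i d) = (a R.* c R.- b R.* d) +i (a R.* d R.+ b R.* c)

  -ᶜ_ conj : ℂ → ℂ
  -ᶜ (a +i b) = (R.- a) +i (R.- b)
  conj (a +i b) = a +i (R.- b)

  0ᶜ 1ᶜ : ℂ
  0ᶜ = R.0# +i R.0#
  1ᶜ = R.1# +i R.0#

  ∣_∣² : ℂ → R.Carrier
  ∣ a +i b ∣² = a R.* a R.+ b R.* b

  private
    open NatSolver R.commutativeSemiring using (solve; _:+_; _:*_; _:=_)
    open RingProperties R.ring using (-1*x≈-x; -‿involutive; -‿distribˡ-*; -‿distribʳ-*)

    m : R.Carrier
    m = R.- R.1#

    neg : ∀ {x} → R.- x R.≈ m R.* x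
    neg = R.sym (-1*x≈-x _)

    _▹_◃_ : ∀ {w x y z} → w R.≈ x → x R.≈ y → z R.≈ y → w R.≈ z
    p ▹ q ◃ r = R.trans p (R.trans q (R.sym r))

    −-cong : ∀ {x x′ y y′} → x R.≈ x′ → m R.* y R.≈ y′ → (x R.- y) R.≈ (x′ R.+ y′)
    −-cong p q = R.+-cong p (R.trans neg q)

  ℂ-isRingWithoutOne : IsRingWithoutOne _≈ᶜ_ _+ᶜ_ _*ᶜ_ -ᶜ_ 0ᶜ
  ℂ-isRingWithoutOne = record
    { +-isAbelianGroup = record
      { isGroup = record
        { isMonoid = record
          { isSemigroup = record
            { isMagma = record
              { isEquivalence = record
                { refl  = R.refl , R.refl
                ; sym   = λ (p , q) → R.sym p , R.sym q
                ; trans = λ (p , q) (p′ , q′) → R.trans p p′ , R.trans q q′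
                }
              ; ∙-cong = λ (p , q) (p′ , q′) → R.+-cong p p′ , R.+-cong q q′
              }
            ; assoc = λ _ _ _ → R.+-assoc _ _ _ , R.+-assoc _ _ _
            }
          ; identity = (λ _ → R.+-identityˡ _ , R.+-identityˡ _)
                     , (λ _ → R.+-identityʳ _ , R.+-identityʳ _)
          }
        ; inverse = (λ _ → R.-‿inverseˡ _ , R.-‿inverseˡ _)
                  , (λ _ → R.-‿inverseʳ _ , R.-‿inverseʳ _)
        ; ⁻¹-cong = λ (p , q) → R.-‿cong p , R.-‿cong q
        }
      ; comm = λ _ _ → R.+-comm _ _ , R.+-comm _ _
      }
    ; *-cong  = λ (p , q) (p′ , q′) →
        R.+-cong (R.*-cong p p′) (R.-‿cong (R.*-cong q q′))
      , R.+-cong (R.*-cong p q′) (R.*-cong q p′)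
    ; *-assoc = λ (a +i b) (c +i d) (e +i f) →
        (−-cong (R.*-congʳ (−-cong R.refl R.refl)) R.refl
          ▹ solve 7 (λ m a b c d e f →
              (a :* c :+ m :* (b :* d)) :* e :+ m :* ((a :* d :+ b :* c) :* f)
              := a :* (c :* e :+ m :* (d :* f)) :+ m :* (b :* (c :* f :+ d :* e)))
              R.refl m a b c d e f
          ◃ −-cong (R.*-congˡ (−-cong R.refl R.refl)) R.refl)
      , (R.+-congʳ (R.*-congʳ (−-cong R.refl R.refl))
          ▹ solve 7 (λ m a b c d e f →
              (a :* c :+ m :* (b :* d)) :* f :+ (a :* d :+ b :* c) :* e
              := a :* (c :* f :+ d :* e) :+ b :* (c :* e :+ m :* (d :* f)))
              R.refl m a b c d e f
          ◃ R.+-congˡ (R.*-congˡ (−-cong R.refl R.refl)))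
    ; distrib =
        (λ (a +i b) (c +i d) (e +i f) →
            (−-cong R.refl R.refl
              ▹ solve 7 (λ m a b c d e f →
                  a :* (c :+ e) :+ m :* (b :* (d :+ f))
                  := (a :* c :+ m :* (b :* d)) :+ (a :* e :+ m :* (b :* f)))
                  R.refl m a b c d e f
              ◃ R.+-cong (−-cong R.refl R.refl) (−-cong R.refl R.refl))
          , solve 6 (λ a b c d e f →
              a :* (d :+ f) :+ b :* (c :+ e)
              := (a :* d :+ b :* c) :+ (a :* f :+ b :* e))
              R.refl a b c d e f)
      , (λ (a +i b) (c +i d) (e +i f) →
            (−-cong R.refl R.refl
              ▹ solve 7 (λ m a b c d e f →
                  (c :+ e) :* a :+ m :* ((d :+ f) :* b)
                  := (c :* a :+ m :* (d :* b)) :+ (e :* a :+ m :* (f :* b)))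
                  R.refl m a b c d e f
              ◃ R.+-cong (−-cong R.refl R.refl) (−-cong R.refl R.refl))
          , solve 6 (λ a b c d e f →
              (c :+ e) :* b :+ (d :+ f) :* a
              := (c :* b :+ d :* a) :+ (e :* b :+ f :* a))
              R.refl a b c d e f)
    }

  ℂ-starRing : StarRing 0ℓ 0ℓ
  ℂ-starRing = record
    { ringWithoutOne = record { isRingWithoutOne = ℂ-isRingWithoutOne }
    ; _⋆           = conj
    ; ⋆-cong       = λ (p , q) → p , R.-‿cong q
    ; ⋆-involutive = λ (a +i b) → R.refl , -‿involutive b
    ; ⋆-+          = λ (a +i b) (c +i d) → R.refl ,
        (neg ▹ R.distribˡ m b d ◃ R.+-cong neg neg)
    ; ⋆-*          = λ (a +i b) (c +i d) →
        R.+-cong (R.*-comm a c) (R.-‿cong (begin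
          b R.* d                 ≈⟨ R.*-comm b d ⟩
          d R.* b                 ≈⟨ -‿involutive (d R.* b) ⟨
          R.- (R.- (d R.* b))     ≈⟨ R.-‿cong (-‿distribʳ-* d b) ⟩
          R.- (d R.* (R.- b))     ≈⟨ -‿distribˡ-* d (R.- b) ⟩
          (R.- d) R.* (R.- b)     ∎))
      , (neg
          ▹ solve 5 (λ m a b c d → m :* (a :* d :+ b :* c) := c :* (m :* b) :+ (m :* d) :* a)
              R.refl m a b c d
          ◃ R.+-cong (R.*-congˡ neg) (R.*-congʳ neg))
    }
    where open SetoidReasoning R.setoid

-- The group of formal differences x - y (pairs (x , y)) of a commutative
-- monoid.

module _ {c ℓ : Level} (M : CommutativeMonoid c ℓ) where
  private
    module M = CommutativeMonoid M
    open CMSolver M using (solve; _⊕_; _⊜_; id)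

  grothendieck : AbelianGroup c (c ⊔ ℓ)
  grothendieck = record
    { Carrier = M.Carrier × M.Carrier
    ; _≈_     = λ (x , y) (x′ , y′) → ∃[ r ] ((x M.∙ y′) M.∙ r) M.≈ ((x′ M.∙ y) M.∙ r)
    ; _∙_     = λ (x , y) (x′ , y′) → x M.∙ x′ , y M.∙ y′
    ; ε       = M.ε , M.ε
    ; _⁻¹     = λ (x , y) → y , x
    ; isAbelianGroup = record
      { isGroup = record
        { isMonoid = record
          { isSemigroup = record
            { isMagma = record
              { isEquivalence = record
                { refl  = M.ε , M.refl
                ; sym   = λ (r , p) → r , M.sym p
                ; trans = λ {(a , b)} {(c , d)} {(e , f)} (r , p) (s , q) →
                    (c M.∙ d) M.∙ (r M.∙ s) ,
                    M.trans (solve 6 (λ a f c d r s →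
                        (a ⊕ f) ⊕ ((c ⊕ d) ⊕ (r ⊕ s)) ⊜ ((a ⊕ d) ⊕ r) ⊕ ((c ⊕ f) ⊕ s))
                        M.refl a f c d r s)
                   (M.trans (M.∙-cong p q)
                      (solve 6 (λ c b e d r s →
                        ((c ⊕ b) ⊕ r) ⊕ ((e ⊕ d) ⊕ s) ⊜ (e ⊕ b) ⊕ ((c ⊕ d) ⊕ (r ⊕ s)))
                        M.refl c b e d r s))
                }
              ; ∙-cong = λ {(a , b)} {(c , d)} {(e , f)} {(g , h)} (r , p) (s , q) →
                  r M.∙ s ,
                  M.trans (solve 6 (λ a e d h r s →
                      ((a ⊕ e) ⊕ (d ⊕ h)) ⊕ (r ⊕ s) ⊜ ((a ⊕ d) ⊕ r) ⊕ ((e ⊕ h) ⊕ s))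
                      M.refl a e d h r s)
                 (M.trans (M.∙-cong p q)
                    (solve 6 (λ c b g f r s →
                      ((c ⊕ b) ⊕ r) ⊕ ((g ⊕ f) ⊕ s) ⊜ ((c ⊕ g) ⊕ (b ⊕ f)) ⊕ (r ⊕ s))
                      M.refl c b g f r s))
              }
            ; assoc = λ (a , b) (c , d) (e , f) → M.ε ,
                solve 6 (λ a b c d e f →
                  (((a ⊕ c) ⊕ e) ⊕ (b ⊕ (d ⊕ f))) ⊕ id
                  ⊜ ((a ⊕ (c ⊕ e)) ⊕ ((b ⊕ d) ⊕ f)) ⊕ id) M.refl a b c d e f
            }
          ; identity =
              (λ (a , b) → M.ε , solve 2 (λ a b →
                ((id ⊕ a) ⊕ b) ⊕ id ⊜ (a ⊕ (id ⊕ b)) ⊕ id) M.refl a b)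
            , (λ (a , b) → M.ε , solve 2 (λ a b →
                ((a ⊕ id) ⊕ b) ⊕ id ⊜ (a ⊕ (b ⊕ id)) ⊕ id) M.refl a b)
          }
        ; inverse =
            (λ (a , b) → M.ε , solve 2 (λ a b →
              ((b ⊕ a) ⊕ id) ⊕ id ⊜ (id ⊕ (a ⊕ b)) ⊕ id) M.refl a b)
          , (λ (a , b) → M.ε , solve 2 (λ a b →
              ((a ⊕ b) ⊕ id) ⊕ id ⊜ (id ⊕ (b ⊕ a)) ⊕ id) M.refl a b)
        ; ⁻¹-cong = λ {(a , b)} {(c , d)} (r , p) → r ,
            M.trans (M.∙-congʳ (M.comm b c)) (M.trans (M.sym p) (M.∙-congʳ (M.comm a d)))
        }
      ; comm = λ (a , b) (c , d) → M.ε , solve 4 (λ a b c d →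
          ((a ⊕ c) ⊕ (d ⊕ b)) ⊕ id ⊜ ((c ⊕ a) ⊕ (b ⊕ d)) ⊕ id) M.refl a b c d
      }
    }

module _ {c₁ ℓ₁ c₂ ℓ₂ : Level} (G : AbelianGroup c₁ ℓ₁) (H : AbelianGroup c₂ ℓ₂) where
  private
    module G = AbelianGroup G
    module H = AbelianGroup H
  open GroupMorphisms G.rawGroup H.rawGroup

  kernel : (f : G.Carrier → H.Carrier) → IsGroupHomomorphism f → AbelianGroup (c₁ ⊔ ℓ₂) ℓ₁
  kernel f isHom = record
    { Carrier = Σ G.Carrier λ x → f x H.≈ H.ε
    ; _≈_     = λ (x , _) (y , _) → x G.≈ y
    ; _∙_     = λ (x , p) (y , q) → x G.∙ y ,
        H.trans (homo x y) (H.trans (H.∙-cong p q) (H.identityˡ H.ε))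
    ; ε       = G.ε , ε-homo
    ; _⁻¹     = λ (x , p) → x G.⁻¹ ,
        H.trans (⁻¹-homo x) (H.trans (H.⁻¹-cong p) ε⁻¹≈ε)
    ; isAbelianGroup = record
      { isGroup = record
        { isMonoid = record
          { isSemigroup = record
            { isMagma = record
              { isEquivalence = record { refl = G.refl ; sym = G.sym ; trans = G.trans }
              ; ∙-cong        = G.∙-cong
              }
            ; assoc = λ _ _ _ → G.assoc _ _ _
            }
          ; identity = (λ _ → G.identityˡ _) , (λ _ → G.identityʳ _)
          }
        ; inverse = (λ _ → G.inverseˡ _) , (λ _ → G.inverseʳ _)
        ; ⁻¹-cong = G.⁻¹-cong
        }
      ; comm = λ _ _ → G.comm _ _
      }
    }
    where
    open IsGroupHomomorphism isHom
    open AbelianGroupProperties H using (ε⁻¹≈ε)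

module Matrices {c ℓ : Level} (R : StarRing c ℓ) where
  open StarRing R
  open CMSum +-commutativeMonoid using (sum; sum-cong-≋; sum-replicate-zero; ∑-distrib-+; ∑-comm; sum-permute) public
  open SetoidReasoning setoid

  private
    variable
      k l m n m′ n′ : ℕ

  Mat : ℕ → ℕ → Set c
  Mat m n = Fin m → Fin n → Carrier

  infix  4 _≋_
  infixl 6 _⊞_ _⊕_
  infixl 7 _⊡_
  infix  9 _†

  _≋_ : Mat m n → Mat m n → Set ℓ
  X ≋ Y = ∀ i j → X i j ≈ Y i j

  𝟘 : Mat m n
  𝟘 _ _ = 0#

  _⊞_ : Mat m n → Mat m n → Mat m n
  (X ⊞ Y) i j = X i j + Y i j

  _⊡_ : Mat k m → Mat m n → Mat k n
  (X ⊡ Y) i j = sum (λ l → X i l * Y l j)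

  _† : Mat m n → Mat n m
  (X †) i j = X j i ⋆

  block : Mat m n → Mat m′ n′ → Fin m ⊎ Fin m′ → Fin n ⊎ Fin n′ → Carrier
  block X Y (inj₁ i) (inj₁ j) = X i j
  block X Y (inj₁ _) (inj₂ _) = 0#
  block X Y (inj₂ _) (inj₁ _) = 0#
  block X Y (inj₂ i) (inj₂ j) = Y i j

  _⊕_ : Mat m n → Mat m′ n′ → Mat (m ℕ.+ m′) (n ℕ.+ n′)
  _⊕_ {m = m} {n = n} X Y i j = block X Y (splitAt m i) (splitAt n j)

  0⋆≈0 : 0# ⋆ ≈ 0#
  0⋆≈0 = begin
    0# ⋆                  ≈⟨ ⋆-cong (zeroʳ (0# ⋆)) ⟨
    (0# ⋆ * 0#) ⋆         ≈⟨ ⋆-* _ _ ⟩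
    0# ⋆ * 0# ⋆ ⋆         ≈⟨ *-congˡ (⋆-involutive 0#) ⟩
    0# ⋆ * 0#             ≈⟨ zeroʳ _ ⟩
    0#                    ∎

  sum-zero : {f : Fin n → Carrier} → (∀ i → f i ≈ 0#) → sum f ≈ 0#
  sum-zero {n} f≈0 = trans (sum-cong-≋ f≈0) (sum-replicate-zero n)

  sum-⋆ : (f : Fin n → Carrier) → sum f ⋆ ≈ sum (λ i → f i ⋆)
  sum-⋆ {zero}  f = 0⋆≈0
  sum-⋆ {suc n} f = trans (⋆-+ _ _) (+-congˡ (sum-⋆ (f ∘ suc)))

  *-sum : ∀ x (f : Fin n → Carrier) → x * sum f ≈ sum (λ i → x * f i)
  *-sum {zero}  x f = zeroʳ x
  *-sum {suc n} x f = trans (distribˡ _ _ _) (+-congˡ (*-sum x (f ∘ suc)))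

  sum-* : ∀ x (f : Fin n → Carrier) → sum f * x ≈ sum (λ i → f i * x)
  sum-* {zero}  x f = zeroˡ x
  sum-* {suc n} x f = trans (distribʳ _ _ _) (+-congˡ (sum-* x (f ∘ suc)))

  sum-split : ∀ m (f : Fin (m ℕ.+ n) → Carrier) →
              sum f ≈ sum (λ i → f (i ↑ˡ n)) + sum (λ i → f (m ↑ʳ i))
  sum-split zero    f = sym (+-identityˡ _)
  sum-split (suc m) f = trans (+-congˡ (sum-split m (f ∘ suc))) (sym (+-assoc _ _ _))

  ≋-refl : {X : Mat m n} → X ≋ X
  ≋-refl _ _ = refl

  ≋-sym : {X Y : Mat m n} → X ≋ Y → Y ≋ X
  ≋-sym p i j = sym (p i j)

  ≋-trans : {X Y Z : Mat m n} → X ≋ Y → Y ≋ Z → X ≋ Z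
  ≋-trans p q i j = trans (p i j) (q i j)

  ⊡-cong : {X X′ : Mat k m} {Y Y′ : Mat m n} → X ≋ X′ → Y ≋ Y′ → X ⊡ Y ≋ X′ ⊡ Y′
  ⊡-cong {m = m} p q i j = sum-cong-≋ {m} (λ l → *-cong (p i l) (q l j))

  ⊡-assoc : (X : Mat k l) (Y : Mat l m) (Z : Mat m n) → (X ⊡ Y) ⊡ Z ≋ X ⊡ (Y ⊡ Z)
  ⊡-assoc {l = l} {m = m} X Y Z i j = begin
    sum {m} (λ b → sum (λ a → X i a * Y a b) * Z b j)
      ≈⟨ sum-cong-≋ {m} (λ b → sum-* (Z b j) (λ a → X i a * Y a b)) ⟩
    sum {m} (λ b → sum {l} (λ a → (X i a * Y a b) * Z b j))
      ≈⟨ ∑-comm {m} {l} (λ b a → (X i a * Y a b) * Z b j) ⟩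
    sum {l} (λ a → sum {m} (λ b → (X i a * Y a b) * Z b j))
      ≈⟨ sum-cong-≋ {l} (λ a → sum-cong-≋ {m} (λ b → *-assoc (X i a) (Y a b) (Z b j))) ⟩
    sum {l} (λ a → sum {m} (λ b → X i a * (Y a b * Z b j)))
      ≈⟨ sum-cong-≋ {l} (λ a → *-sum (X i a) (λ b → Y a b * Z b j)) ⟨
    sum {l} (λ a → X i a * sum {m} (λ b → Y a b * Z b j)) ∎

  ⊞-cong : {X X′ Y Y′ : Mat m n} → X ≋ X′ → Y ≋ Y′ → X ⊞ Y ≋ X′ ⊞ Y′
  ⊞-cong p q i j = +-cong (p i j) (q i j)

  †-cong : {X Y : Mat m n} → X ≋ Y → X † ≋ Y †
  †-cong p i j = ⋆-cong (p j i)

  †-involutive : (X : Mat m n) → X † † ≋ X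
  †-involutive X i j = ⋆-involutive _

  ⊡-† : (X : Mat k m) (Y : Mat m n) → (X ⊡ Y) † ≋ Y † ⊡ X †
  ⊡-† {m = m} X Y i j = trans
    (sum-⋆ {m} (λ l → X j l * Y l i))
    (sum-cong-≋ {m} (λ l → ⋆-* (X j l) (Y l i)))

  ⊕-cong : {X X′ : Mat m n} {Y Y′ : Mat m′ n′} → X ≋ X′ → Y ≋ Y′ → X ⊕ Y ≋ X′ ⊕ Y′
  ⊕-cong {m = m} {n = n} p q i j with splitAt m i | splitAt n j
  ... | inj₁ i′ | inj₁ j′ = p i′ j′
  ... | inj₁ _  | inj₂ _  = refl
  ... | inj₂ _  | inj₁ _  = refl
  ... | inj₂ i′ | inj₂ j′ = q i′ j′

  ⊕-† : (X : Mat m n) (Y : Mat m′ n′) → (X ⊕ Y) † ≋ X † ⊕ Y †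
  ⊕-† {m = m} {n = n} X Y i j with splitAt n i | splitAt m j
  ... | inj₁ _ | inj₁ _ = refl
  ... | inj₁ _ | inj₂ _ = 0⋆≈0
  ... | inj₂ _ | inj₁ _ = 0⋆≈0
  ... | inj₂ _ | inj₂ _ = refl

  ⊕-⊞ : (X X′ : Mat m n) (Y Y′ : Mat m′ n′) → (X ⊕ Y) ⊞ (X′ ⊕ Y′) ≋ (X ⊞ X′) ⊕ (Y ⊞ Y′)
  ⊕-⊞ {m = m} {n = n} X X′ Y Y′ i j with splitAt m i | splitAt n j
  ... | inj₁ _ | inj₁ _ = refl
  ... | inj₁ _ | inj₂ _ = +-identityˡ 0#
  ... | inj₂ _ | inj₁ _ = +-identityˡ 0#
  ... | inj₂ _ | inj₂ _ = refl

  ⊕-⊡ : (X : Mat k m) (Y : Mat m n) (X′ : Mat l m′) (Y′ : Mat m′ n′) →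
        (X ⊕ X′) ⊡ (Y ⊕ Y′) ≋ (X ⊡ Y) ⊕ (X′ ⊡ Y′)
  ⊕-⊡ {k = k} {m = m} {n = n} {m′ = m′} X Y X′ Y′ i j = begin
    sum (λ a → (X ⊕ X′) i a * (Y ⊕ Y′) a j)
      ≈⟨ sum-split m _ ⟩
    sum (λ a → (X ⊕ X′) i (a ↑ˡ m′) * (Y ⊕ Y′) (a ↑ˡ m′) j)
      + sum (λ a → (X ⊕ X′) i (m ↑ʳ a) * (Y ⊕ Y′) (m ↑ʳ a) j)
      ≡⟨ ≡.cong₂ _+_
           (sum-cong-≡ λ a → ≡.cong (λ s → block X X′ (splitAt k i) s * block Y Y′ s (splitAt n j))
                              (splitAt-↑ˡ m a m′))
           (sum-cong-≡ λ a → ≡.cong (λ s → block X X′ (splitAt k i) s * block Y Y′ s (splitAt n j))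
                              (splitAt-↑ʳ m m′ a)) ⟩
    sum (λ a → block X X′ (splitAt k i) (inj₁ a) * block Y Y′ (inj₁ a) (splitAt n j))
      + sum (λ a → block X X′ (splitAt k i) (inj₂ a) * block Y Y′ (inj₂ a) (splitAt n j))
      ≈⟨ lemma (splitAt k i) (splitAt n j) ⟩
    ((X ⊡ Y) ⊕ (X′ ⊡ Y′)) i j ∎
    where
    open CMSum +-commutativeMonoid using () renaming (sum-cong-≗ to sum-cong-≡)

    lemma : ∀ s t →
      sum (λ a → block X X′ s (inj₁ a) * block Y Y′ (inj₁ a) t)
        + sum (λ a → block X X′ s (inj₂ a) * block Y Y′ (inj₂ a) t)
      ≈ block (X ⊡ Y) (X′ ⊡ Y′) s t
    lemma (inj₁ i) (inj₁ j) =
      trans (+-congˡ (sum-zero {m′} λ a → zeroˡ 0#)) (+-identityʳ _)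
    lemma (inj₁ i) (inj₂ j) =
      trans (+-cong (sum-zero {m} λ a → zeroʳ (X i a)) (sum-zero {m′} λ a → zeroˡ (Y′ a j)))
            (+-identityʳ 0#)
    lemma (inj₂ i) (inj₁ j) =
      trans (+-cong (sum-zero {m} λ a → zeroˡ (Y a j)) (sum-zero {m′} λ a → zeroʳ (X′ i a)))
            (+-identityʳ 0#)
    lemma (inj₂ i) (inj₂ j) =
      trans (+-congʳ (sum-zero {m} λ a → zeroˡ 0#)) (+-identityˡ _)

  -- The monoid of Murray-von Neumann classes of projections in M∞(R), with
  -- orthogonal sum as addition. A partial isometry between projections of
  -- different sizes is a rectangular matrix.

  record Projection : Set (c ⊔ ℓ) where
    field
      {size}     : ℕ
      matrix     : Mat size size
      selfAdjoint : matrix † ≋ matrix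
      idempotent : matrix ⊡ matrix ≋ matrix

  open Projection

  infix 4 _∼_

  record _∼_ (p q : Projection) : Set (c ⊔ ℓ) where
    constructor equivalence
    field
      v    : Mat (size q) (size p)
      v†v≋p : v † ⊡ v ≋ matrix p
      vv†≋q : v ⊡ v † ≋ matrix q

  _⊕ₚ_ : Projection → Projection → Projection
  p ⊕ₚ q = record
    { matrix     = matrix p ⊕ matrix q
    ; selfAdjoint = ≋-trans (⊕-† (matrix p) (matrix q)) (⊕-cong (selfAdjoint p) (selfAdjoint q))
    ; idempotent = ≋-trans (⊕-⊡ (matrix p) (matrix p) (matrix q) (matrix q))
                     (⊕-cong (idempotent p) (idempotent q))
    }

  0ₚ : Projection
  0ₚ = record { size = 0 ; matrix = λ () ; selfAdjoint = λ () ; idempotent = λ () }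

  ∼-refl : ∀ {p} → p ∼ p
  ∼-refl {p} = equivalence (matrix p)
    (≋-trans (⊡-cong (selfAdjoint p) ≋-refl) (idempotent p))
    (≋-trans (⊡-cong ≋-refl (selfAdjoint p)) (idempotent p))

  ∼-sym : ∀ {p q} → p ∼ q → q ∼ p
  ∼-sym (equivalence v a b) = equivalence (v †)
    (≋-trans (⊡-cong (†-involutive v) ≋-refl) b)
    (≋-trans (⊡-cong ≋-refl (†-involutive v)) a)

  ∼-trans : ∀ {p q r} → p ∼ q → q ∼ r → p ∼ r
  ∼-trans {p} {q} {r} (equivalence v a b) (equivalence w c d) = equivalence (w ⊡ v)
    (≋-trans (⊡-cong (⊡-† w v) ≋-refl)
      (source v w (matrix p) (matrix q) a b c (idempotent p)))
    (≋-trans (⊡-cong {X = w ⊡ v} ≋-refl (⊡-† w v))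
      (range v w (matrix q) (matrix r) b c d (idempotent r)))
    where
    source : ∀ {l m n} (v : Mat m l) (w : Mat n m) P Q → v † ⊡ v ≋ P → v ⊡ v † ≋ Q →
                 w † ⊡ w ≋ Q → P ⊡ P ≋ P → (v † ⊡ w †) ⊡ (w ⊡ v) ≋ P
    source v w P Q a b c pp =
      ≋-trans (⊡-assoc (v †) (w †) (w ⊡ v))
      (≋-trans (⊡-cong {X = v †} ≋-refl (≋-sym (⊡-assoc (w †) w v)))
      (≋-trans (⊡-cong {X = v †} ≋-refl (⊡-cong (≋-trans c (≋-sym b)) ≋-refl))
      (≋-trans (⊡-cong {X = v †} ≋-refl (⊡-assoc v (v †) v))
      (≋-trans (≋-sym (⊡-assoc (v †) v (v † ⊡ v)))
      (≋-trans (⊡-cong a a) pp)))))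

    range : ∀ {l m n} (v : Mat m l) (w : Mat n m) Q T → v ⊡ v † ≋ Q → w † ⊡ w ≋ Q →
                  w ⊡ w † ≋ T → T ⊡ T ≋ T → (w ⊡ v) ⊡ (v † ⊡ w †) ≋ T
    range v w Q T b c d tt =
      ≋-trans (⊡-assoc w v (v † ⊡ w †))
      (≋-trans (⊡-cong {X = w} ≋-refl (≋-sym (⊡-assoc v (v †) (w †))))
      (≋-trans (⊡-cong {X = w} ≋-refl (⊡-cong (≋-trans b (≋-sym c)) ≋-refl))
      (≋-trans (⊡-cong {X = w} ≋-refl (⊡-assoc (w †) w (w †)))
      (≋-trans (≋-sym (⊡-assoc w (w †) (w ⊡ w †)))
      (≋-trans (⊡-cong d d) tt)))))

  ⊕ₚ-cong : ∀ {p p′ q q′} → p ∼ p′ → q ∼ q′ → (p ⊕ₚ q) ∼ (p′ ⊕ₚ q′)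
  ⊕ₚ-cong (equivalence v a b) (equivalence w c d) = equivalence (v ⊕ w)
    (≋-trans (⊡-cong (⊕-† v w) ≋-refl) (≋-trans (⊕-⊡ (v †) v (w †) w) (⊕-cong a c)))
    (≋-trans (⊡-cong {X = v ⊕ w} ≋-refl (⊕-† v w))
      (≋-trans (⊕-⊡ v (v †) w (w †)) (⊕-cong b d)))

  -- Conjugate by a permutation matrix (not itself available, as R need not
  -- have a unit).
  ∼-permute : ∀ {p q} (π : Permutation (size q) (size p)) →
              (∀ i j → matrix p (π ⟨$⟩ʳ i) (π ⟨$⟩ʳ j) ≈ matrix q i j) → p ∼ q
  ∼-permute {p} {q} π e = equivalence (λ i j → matrix p (π ⟨$⟩ʳ i) j)
    (λ i j → trans (sym (sum-permute (λ a → matrix p a i ⋆ * matrix p a j) π))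
      (trans (sum-cong-≋ λ a → *-congʳ (selfAdjoint p i a)) (idempotent p i j)))
    (λ i j → trans (sum-cong-≋ λ a → *-congˡ (selfAdjoint p a (π ⟨$⟩ʳ j)))
      (trans (idempotent p _ _) (e i j)))

  private
    swap : ∀ m n → Permutation (n ℕ.+ m) (m ℕ.+ n)
    swap m n = ↔-trans (+↔⊎ {n} {m}) (↔-trans (⊎-comm (Fin n) (Fin m)) (↔-sym (+↔⊎ {m} {n})))

    rotate : ∀ l m n → Permutation (l ℕ.+ (m ℕ.+ n)) ((l ℕ.+ m) ℕ.+ n)
    rotate l m n = ↔-trans (+↔⊎ {l} {m ℕ.+ n}) (↔-trans (↔-refl ⊎-↔ +↔⊎ {m} {n})
      (↔-trans (↔-sym (⊎-assoc 0ℓ (Fin l) (Fin m) (Fin n)))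
      (↔-trans (↔-sym (+↔⊎ {l} {m}) ⊎-↔ ↔-refl) (↔-sym (+↔⊎ {l ℕ.+ m} {n})))))

  ⊕ₚ-comm : ∀ p q → (p ⊕ₚ q) ∼ (q ⊕ₚ p)
  ⊕ₚ-comm p q = ∼-permute (swap (size p) (size q)) λ i j → lemma i j
    where
    P = matrix p
    Q = matrix q
    lemma : ∀ i j → (P ⊕ Q) (swap (size p) (size q) ⟨$⟩ʳ i) (swap (size p) (size q) ⟨$⟩ʳ j)
                    ≈ (Q ⊕ P) i j
    lemma i j with splitAt (size q) i | splitAt (size q) j
    ... | inj₁ a | inj₁ b
      rewrite splitAt-↑ʳ (size p) (size q) a | splitAt-↑ʳ (size p) (size q) b = refl
    ... | inj₁ a | inj₂ b
      rewrite splitAt-↑ʳ (size p) (size q) a | splitAt-↑ˡ (size p) b (size q) = refl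
    ... | inj₂ a | inj₁ b
      rewrite splitAt-↑ˡ (size p) a (size q) | splitAt-↑ʳ (size p) (size q) b = refl
    ... | inj₂ a | inj₂ b
      rewrite splitAt-↑ˡ (size p) a (size q) | splitAt-↑ˡ (size p) b (size q) = refl

  ⊕ₚ-assoc : ∀ p q r → ((p ⊕ₚ q) ⊕ₚ r) ∼ (p ⊕ₚ (q ⊕ₚ r))
  ⊕ₚ-assoc p q r = ∼-permute (rotate x y z) lemma
    where
    x = size p
    y = size q
    z = size r
    P = matrix p
    Q = matrix q
    R′ = matrix r

    split : Fin (x ℕ.+ (y ℕ.+ z)) → (Fin x ⊎ Fin y) ⊎ Fin z
    split i with splitAt x i
    ... | inj₁ a = inj₁ (inj₁ a)
    ... | inj₂ b with splitAt y b
    ...   | inj₁ a = inj₁ (inj₂ a)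
    ...   | inj₂ a = inj₂ a

    block₃ : (Fin x ⊎ Fin y) ⊎ Fin z → (Fin x ⊎ Fin y) ⊎ Fin z → Carrier
    block₃ (inj₁ s) (inj₁ t) = block P Q s t
    block₃ (inj₁ s) (inj₂ t) = 0#
    block₃ (inj₂ s) (inj₁ t) = 0#
    block₃ (inj₂ s) (inj₂ t) = R′ s t

    lhs : (Fin x ⊎ Fin y) ⊎ Fin z → Fin ((x ℕ.+ y) ℕ.+ z)
    lhs (inj₁ (inj₁ a)) = (a ↑ˡ y) ↑ˡ z
    lhs (inj₁ (inj₂ a)) = (x ↑ʳ a) ↑ˡ z
    lhs (inj₂ a)        = (x ℕ.+ y) ↑ʳ a

    rotate≡ : ∀ i → rotate x y z ⟨$⟩ʳ i ≡ lhs (split i)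
    rotate≡ i with splitAt x i
    ... | inj₁ a = ≡.refl
    ... | inj₂ b with splitAt y b
    ...   | inj₁ a = ≡.refl
    ...   | inj₂ a = ≡.refl

    splitˡ : Fin ((x ℕ.+ y) ℕ.+ z) → (Fin x ⊎ Fin y) ⊎ Fin z
    splitˡ i = Sum.map₁ (splitAt x) (splitAt (x ℕ.+ y) i)

    splitˡ-lhs : ∀ s → splitˡ (lhs s) ≡ s
    splitˡ-lhs (inj₁ (inj₁ a)) rewrite splitAt-↑ˡ (x ℕ.+ y) (a ↑ˡ y) z | splitAt-↑ˡ x a y = ≡.refl
    splitˡ-lhs (inj₁ (inj₂ a)) rewrite splitAt-↑ˡ (x ℕ.+ y) (x ↑ʳ a) z | splitAt-↑ʳ x y a = ≡.refl
    splitˡ-lhs (inj₂ a)        rewrite splitAt-↑ʳ (x ℕ.+ y) z a = ≡.refl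

    left : ∀ i j → ((P ⊕ Q) ⊕ R′) i j ≡ block₃ (splitˡ i) (splitˡ j)
    left i j with splitAt (x ℕ.+ y) i | splitAt (x ℕ.+ y) j
    ... | inj₁ _ | inj₁ _ = ≡.refl
    ... | inj₁ _ | inj₂ _ = ≡.refl
    ... | inj₂ _ | inj₁ _ = ≡.refl
    ... | inj₂ _ | inj₂ _ = ≡.refl

    right : ∀ i j → block₃ (split i) (split j) ≡ (P ⊕ (Q ⊕ R′)) i j
    right i j with splitAt x i | splitAt x j
    right i j | inj₁ _ | inj₁ _ = ≡.refl
    right i j | inj₁ _ | inj₂ b with splitAt y b
    ... | inj₁ _ = ≡.refl
    ... | inj₂ _ = ≡.refl
    right i j | inj₂ a | inj₁ _ with splitAt y a
    ... | inj₁ _ = ≡.refl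
    ... | inj₂ _ = ≡.refl
    right i j | inj₂ a | inj₂ b with splitAt y a | splitAt y b
    ... | inj₁ _ | inj₁ _ = ≡.refl
    ... | inj₁ _ | inj₂ _ = ≡.refl
    ... | inj₂ _ | inj₁ _ = ≡.refl
    ... | inj₂ _ | inj₂ _ = ≡.refl

    lemma : ∀ i j → ((P ⊕ Q) ⊕ R′) (rotate x y z ⟨$⟩ʳ i) (rotate x y z ⟨$⟩ʳ j) ≈ (P ⊕ (Q ⊕ R′)) i j
    lemma i j = reflexive (≡.trans
      (≡.cong₂ ((P ⊕ Q) ⊕ R′) (rotate≡ i) (rotate≡ j))
      (≡.trans (left (lhs (split i)) (lhs (split j)))
      (≡.trans (≡.cong₂ block₃ (splitˡ-lhs (split i)) (splitˡ-lhs (split j))) (right i j))))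

  0ₚ-identityˡ : ∀ p → (0ₚ ⊕ₚ p) ∼ p
  0ₚ-identityˡ p = equivalence v v†v≋p vv†≋q
    where open _∼_ (∼-refl {p})

  projectionMonoid : CommutativeMonoid (c ⊔ ℓ) (c ⊔ ℓ)
  projectionMonoid = record
    { Carrier = Projection
    ; _≈_     = _∼_
    ; _∙_     = _⊕ₚ_
    ; ε       = 0ₚ
    ; isCommutativeMonoid = record
      { isMonoid = record
        { isSemigroup = record
          { isMagma = record
            { isEquivalence = record
              { refl  = λ {p} → ∼-refl {p}
              ; sym   = λ {p} {q} → ∼-sym {p} {q}
              ; trans = λ {p} {q} {r} → ∼-trans {p} {q} {r} }
            ; ∙-cong = λ {p} {p′} {q} {q′} → ⊕ₚ-cong {p} {p′} {q} {q′}
            }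
          ; assoc = ⊕ₚ-assoc
          }
        ; identity = 0ₚ-identityˡ , λ p →
            ∼-trans {p ⊕ₚ 0ₚ} {0ₚ ⊕ₚ p} {p} (⊕ₚ-comm p 0ₚ) (0ₚ-identityˡ p)
        }
      ; comm = ⊕ₚ-comm
      }
    }

module _ {c₁ ℓ₁ c₂ ℓ₂ : Level} (M : CommutativeMonoid c₁ ℓ₁) (N : CommutativeMonoid c₂ ℓ₂) where
  private
    module M = CommutativeMonoid M
    module N = CommutativeMonoid N
  open MonoidMorphisms M.rawMonoid N.rawMonoid
  open GroupMorphisms (AbelianGroup.rawGroup (grothendieck M)) (AbelianGroup.rawGroup (grothendieck N))

  grothendieckMap : (M.Carrier → N.Carrier) → M.Carrier × M.Carrier → N.Carrier × N.Carrier
  grothendieckMap f (x , y) = f x , f y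

  grothendieckMap-isHomomorphism : ∀ {f} → IsMonoidHomomorphism f →
                                   IsGroupHomomorphism (grothendieckMap f)
  grothendieckMap-isHomomorphism {f} isHom = record
    { isMonoidHomomorphism = record
      { isMagmaHomomorphism = record
        { isRelHomomorphism = record
          { cong = λ {(a , b)} {(c , d)} (r , p) → f r ,
              N.trans (N.sym (homo₃ a d r)) (N.trans (⟦⟧-cong p) (homo₃ c b r)) }
        ; homo = λ (a , b) (c , d) → embed (homo a c) (homo b d)
        }
      ; ε-homo = embed ε-homo ε-homo
      }
    ; ⁻¹-homo = λ _ → AbelianGroup.refl (grothendieck N)
    }
    where
    open IsMonoidHomomorphism isHom
    homo₃ : ∀ a b c → f ((a M.∙ b) M.∙ c) N.≈ ((f a N.∙ f b) N.∙ f c)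
    homo₃ a b c = N.trans (homo _ _) (N.∙-congʳ (homo _ _))

    embed : ∀ {a b c d} → a N.≈ c → b N.≈ d →
            AbelianGroup._≈_ (grothendieck N) (a , b) (c , d)
    embed p q = N.ε , N.∙-congʳ (N.∙-cong p (N.sym q))

record StarRingHom {c₁ ℓ₁ c₂ ℓ₂ : Level} (R : StarRing c₁ ℓ₁) (S : StarRing c₂ ℓ₂) :
                   Set (c₁ ⊔ ℓ₁ ⊔ c₂ ⊔ ℓ₂) where
  private
    module R = StarRing R
    module S = StarRing S
  field
    ⟦_⟧    : R.Carrier → S.Carrier
    ⟦⟧-cong : ∀ {x y} → x R.≈ y → ⟦ x ⟧ S.≈ ⟦ y ⟧
    +-homo : ∀ x y → ⟦ x R.+ y ⟧ S.≈ ⟦ x ⟧ S.+ ⟦ y ⟧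
    *-homo : ∀ x y → ⟦ x R.* y ⟧ S.≈ ⟦ x ⟧ S.* ⟦ y ⟧
    ⋆-homo : ∀ x → ⟦ x R.⋆ ⟧ S.≈ ⟦ x ⟧ S.⋆

  0-homo : ⟦ R.0# ⟧ S.≈ S.0#
  0-homo = identityˡ-unique ⟦ R.0# ⟧ ⟦ R.0# ⟧
    (S.trans (S.sym (+-homo R.0# R.0#)) (⟦⟧-cong (R.+-identityˡ R.0#)))
    where open GroupProperties S.+-group using (identityˡ-unique)

-- This is K₀(R) only if R is unital; see K₀ below.

K₀₀ : ∀ {c ℓ} → StarRing c ℓ → AbelianGroup (c ⊔ ℓ) (c ⊔ ℓ)
K₀₀ R = grothendieck (Matrices.projectionMonoid R)

module _ {c₁ ℓ₁ c₂ ℓ₂ : Level} {R : StarRing c₁ ℓ₁} {S : StarRing c₂ ℓ₂} (φ : StarRingHom R S) where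
  private
    module R = StarRing R
    module S = StarRing S
    module MR = Matrices R
    module MS = Matrices S
    module VR = CommutativeMonoid (MR.projectionMonoid)
    module VS = CommutativeMonoid (MS.projectionMonoid)
  open StarRingHom φ
  open MR.Projection
  open MonoidMorphisms VR.rawMonoid VS.rawMonoid
  open GroupMorphisms (AbelianGroup.rawGroup (K₀₀ R)) (AbelianGroup.rawGroup (K₀₀ S))

  mapMat : ∀ {m n} → MR.Mat m n → MS.Mat m n
  mapMat X i j = ⟦ X i j ⟧

  sum-homo : ∀ {n} (f : Fin n → R.Carrier) → ⟦ MR.sum f ⟧ S.≈ MS.sum (⟦_⟧ ∘ f)
  sum-homo {zero}  f = 0-homo
  sum-homo {suc n} f = S.trans (+-homo _ _) (S.+-congˡ (sum-homo (f ∘ suc)))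

  ⊡-homo : ∀ {k m n} (X : MR.Mat k m) (Y : MR.Mat m n) →
           mapMat (X MR.⊡ Y) MS.≋ mapMat X MS.⊡ mapMat Y
  ⊡-homo {m = m} X Y i j = S.trans (sum-homo (λ l → X i l R.* Y l j))
    (MS.sum-cong-≋ {m} (λ l → *-homo (X i l) (Y l j)))

  ⊕-homo : ∀ {m n m′ n′} (X : MR.Mat m n) (Y : MR.Mat m′ n′) →
           mapMat (X MR.⊕ Y) MS.≋ mapMat X MS.⊕ mapMat Y
  ⊕-homo {m} {n} X Y i j with splitAt m i | splitAt n j
  ... | inj₁ _ | inj₁ _ = S.refl
  ... | inj₁ _ | inj₂ _ = 0-homo
  ... | inj₂ _ | inj₁ _ = 0-homo
  ... | inj₂ _ | inj₂ _ = S.refl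

  mapProjection : MR.Projection → MS.Projection
  mapProjection p = record
    { matrix      = mapMat (matrix p)
    ; selfAdjoint = λ i j → S.trans (S.sym (⋆-homo _)) (⟦⟧-cong (selfAdjoint p i j))
    ; idempotent  = λ i j → S.trans (S.sym (⊡-homo (matrix p) (matrix p) i j))
                                    (⟦⟧-cong (idempotent p i j))
    }

  mapProjection-cong : ∀ {p q} → p MR.∼ q → mapProjection p MS.∼ mapProjection q
  mapProjection-cong (MR.equivalence v a b) = MS.equivalence (mapMat v)
    (MS.≋-trans (MS.⊡-cong {Y = mapMat v} (λ i j → S.sym (⋆-homo (v j i))) MS.≋-refl)
      (λ i j → S.trans (S.sym (⊡-homo (v MR.†) v i j)) (⟦⟧-cong (a i j))))
    (MS.≋-trans (MS.⊡-cong {X = mapMat v} MS.≋-refl (λ i j → S.sym (⋆-homo (v j i))))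
      (λ i j → S.trans (S.sym (⊡-homo v (v MR.†) i j)) (⟦⟧-cong (b i j))))

  mapProjection-isHomomorphism : IsMonoidHomomorphism mapProjection
  mapProjection-isHomomorphism = record
    { isMagmaHomomorphism = record
      { isRelHomomorphism = record { cong = mapProjection-cong }
      ; homo = λ p q →
          MS.∼-permute {mapProjection (p MR.⊕ₚ q)} {mapProjection p MS.⊕ₚ mapProjection q}
            Permutation.id (⊕-homo (matrix p) (matrix q))
      }
    ; ε-homo = MS.∼-permute {mapProjection MR.0ₚ} {MS.0ₚ} Permutation.id (λ ())
    }

  K₀₀-map : AbelianGroup.Carrier (K₀₀ R) → AbelianGroup.Carrier (K₀₀ S)
  K₀₀-map = grothendieckMap MR.projectionMonoid MS.projectionMonoid mapProjection

  K₀₀-map-isHomomorphism : IsGroupHomomorphism K₀₀-map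
  K₀₀-map-isHomomorphism = grothendieckMap-isHomomorphism
    MR.projectionMonoid MS.projectionMonoid mapProjection-isHomomorphism

module CStar (ℝ : RealField) where
  open Complex ℝ public

  record CStarAlgebra (c ℓ : Level) : Set (lsuc (c ⊔ ℓ)) where
    infixr 8 _·_
    field
      starRing : StarRing c ℓ

    open StarRing starRing public

    field
      _·_         : ℂ → Carrier → Carrier
      ·-cong      : ∀ {z w x y} → z ≈ᶜ w → x ≈ y → z · x ≈ w · y
      ·-distribˡ  : ∀ z x y → z · (x + y) ≈ z · x + z · y
      ·-distribʳ  : ∀ z w x → (z +ᶜ w) · x ≈ z · x + w · x
      ·-assoc     : ∀ z w x → (z *ᶜ w) · x ≈ z · w · x
      ·-identity  : ∀ x → 1ᶜ · x ≈ x
      ·-*-assocˡ  : ∀ z x y → (z · x) * y ≈ z · (x * y)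
      ·-*-assocʳ  : ∀ z x y → x * (z · y) ≈ z · (x * y)
      ·-⋆         : ∀ z x → (z · x) ⋆ ≈ conj z · x ⋆

      ‖_‖         : Carrier → R.Carrier
      ‖‖-cong     : ∀ {x y} → x ≈ y → ‖ x ‖ R.≈ ‖ y ‖
      ‖‖-nonNeg   : ∀ x → R.0# R.≤ ‖ x ‖
      ‖‖-definite : ∀ x → ‖ x ‖ R.≈ R.0# → x ≈ 0#
      ‖‖-triangle : ∀ x y → ‖ x + y ‖ R.≤ ‖ x ‖ R.+ ‖ y ‖
      -- The square of ‖z·x‖ = |z|‖x‖, which avoids square roots.
      ‖‖-scale    : ∀ z x → ‖ z · x ‖ R.* ‖ z · x ‖ R.≈ ∣ z ∣² R.* (‖ x ‖ R.* ‖ x ‖)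
      ‖‖-*        : ∀ x y → ‖ x * y ‖ R.≤ ‖ x ‖ R.* ‖ y ‖
      ‖‖-C⋆       : ∀ x → ‖ x ⋆ * x ‖ R.≈ ‖ x ‖ R.* ‖ x ‖
      complete    : (f : ℕ → Carrier) →
        (∀ ε → R.0# R.< ε →
          ∃[ N ] ∀ m n → N ℕ.≤ m → N ℕ.≤ n → ‖ f m + (- f n) ‖ R.< ε) →
        ∃[ x ] ∀ ε → R.0# R.< ε → ∃[ N ] ∀ n → N ℕ.≤ n → ‖ f n + (- x) ‖ R.< ε

  -- Boundedness is automatic (with K = 1) in classical mathematics, so that
  -- these are all the ⋆-homomorphisms.

  record StarHom {c₁ ℓ₁ c₂ ℓ₂ : Level} (A : CStarAlgebra c₁ ℓ₁) (B : CStarAlgebra c₂ ℓ₂) :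
                 Set (c₁ ⊔ ℓ₁ ⊔ c₂ ⊔ ℓ₂) where
    private
      module A = CStarAlgebra A
      module B = CStarAlgebra B
    field
      starRingHom : StarRingHom A.starRing B.starRing

    open StarRingHom starRingHom public

    field
      ·-homo  : ∀ z x → ⟦ z A.· x ⟧ B.≈ z B.· ⟦ x ⟧
      bounded : ∃[ K ] ∀ x → B.‖ ⟦ x ⟧ ‖ R.≤ K R.* A.‖ x ‖

  module KTheory {c ℓ : Level} (A : CStarAlgebra c ℓ) where
    open CStarAlgebra A
    private
      module C = StarRing ℂ-starRing

      *ᶜ-comm : ∀ z w → z *ᶜ w ≈ᶜ w *ᶜ z
      *ᶜ-comm (a +i b) (c +i d) =
          R.+-cong (R.*-comm a c) (R.-‿cong (R.*-comm b d))
        , R.trans (R.+-comm _ _) (R.+-cong (R.*-comm b c) (R.*-comm a d))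

      open CMSolver +-commutativeMonoid using (solve; _⊜_) renaming (_⊕_ to _:+_)

    -- The unitization: (a , z) stands for a + z1.
    unitization : StarRing c ℓ
    unitization = record
      { ringWithoutOne = record
        { Carrier = Carrier × ℂ
        ; _≈_     = λ (a , z) (b , w) → a ≈ b × z ≈ᶜ w
        ; _+_     = λ (a , z) (b , w) → a + b , z +ᶜ w
        ; _*_     = λ (a , z) (b , w) → a * b + (z · b + w · a) , z *ᶜ w
        ; -_      = λ (a , z) → - a , -ᶜ z
        ; 0#      = 0# , 0ᶜ
        ; isRingWithoutOne = record
          { +-isAbelianGroup = record
            { isGroup = record
              { isMonoid = record
                { isSemigroup = record
                  { isMagma = record
                    { isEquivalence = record
                      { refl  = refl , C.refl
                      ; sym   = λ (p , q) → sym p , C.sym q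
                      ; trans = λ (p , q) (p′ , q′) → trans p p′ , C.trans q q′
                      }
                    ; ∙-cong = λ (p , q) (p′ , q′) → +-cong p p′ , C.+-cong q q′
                    }
                  ; assoc = λ _ _ _ → +-assoc _ _ _ , C.+-assoc _ _ _
                  }
                ; identity = (λ _ → +-identityˡ _ , C.+-identityˡ _)
                           , (λ _ → +-identityʳ _ , C.+-identityʳ _)
                }
              ; inverse = (λ _ → -‿inverseˡ _ , C.-‿inverseˡ _)
                        , (λ _ → -‿inverseʳ _ , C.-‿inverseʳ _)
              ; ⁻¹-cong = λ (p , q) → -‿cong p , C.-‿cong q
              }
            ; comm = λ _ _ → +-comm _ _ , C.+-comm _ _
            }
          ; *-cong  = λ (p , q) (p′ , q′) →
              +-cong (*-cong p p′) (+-cong (·-cong q p′) (·-cong q′ p)) , C.*-cong q q′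
          ; *-assoc = λ (a , z) (b , w) (c , v) → assoc a z b w c v , C.*-assoc z w v
          ; distrib =
              (λ (a , z) (b , w) (c , v) →
                trans (+-cong (distribˡ a b c) (+-cong (·-distribˡ z b c) (·-distribʳ w v a)))
                  (solve 6 (λ p q r s t u →
                    (p :+ q) :+ ((r :+ s) :+ (t :+ u)) ⊜ (p :+ (r :+ t)) :+ (q :+ (s :+ u)))
                    refl (a * b) (a * c) (z · b) (z · c) (w · a) (v · a))
                , C.distribˡ z w v)
            , (λ (a , z) (b , w) (c , v) →
                trans (+-cong (distribʳ a b c) (+-cong (·-distribʳ w v a) (·-distribˡ z b c)))
                  (solve 6 (λ p q r s t u →
                    (p :+ q) :+ ((t :+ u) :+ (r :+ s)) ⊜ (p :+ (t :+ r)) :+ (q :+ (u :+ s)))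
                    refl (b * a) (c * a) (z · b) (z · c) (w · a) (v · a))
                , C.distribʳ z w v)
          }
        }
      ; _⋆           = λ (a , z) → a ⋆ , conj z
      ; ⋆-cong       = λ (p , q) → ⋆-cong p , C.⋆-cong q
      ; ⋆-involutive = λ (a , z) → ⋆-involutive a , C.⋆-involutive z
      ; ⋆-+          = λ (a , z) (b , w) → ⋆-+ a b , C.⋆-+ z w
      ; ⋆-*          = λ (a , z) (b , w) →
          trans (⋆-+ _ _) (+-cong (⋆-* a b)
            (trans (⋆-+ _ _) (trans (+-cong (·-⋆ z b) (·-⋆ w a)) (+-comm _ _))))
          , C.⋆-* z w
      }
      where
      open SetoidReasoning setoid

      assoc : ∀ a z b w c v →
        (a * b + (z · b + w · a)) * c + ((z *ᶜ w) · c + v · (a * b + (z · b + w · a)))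
        ≈ a * (b * c + (w · c + v · b)) + (z · (b * c + (w · c + v · b)) + (w *ᶜ v) · a)
      assoc a z b w c v = begin
        (a * b + (z · b + w · a)) * c + ((z *ᶜ w) · c + v · (a * b + (z · b + w · a)))
          ≈⟨ +-cong (trans (distribʳ _ _ _) (+-cong (*-assoc a b c)
               (trans (distribʳ _ _ _) (+-cong (·-*-assocˡ z b c) (·-*-assocˡ w a c)))))
             (+-cong (·-assoc z w c) (trans (·-distribˡ _ _ _) (+-congˡ (trans (·-distribˡ _ _ _)
               (+-cong (trans (sym (·-assoc v z b)) (·-cong (*ᶜ-comm v z) refl))
                       (trans (sym (·-assoc v w a)) (·-cong (*ᶜ-comm v w) refl))))))) ⟩
        (a * (b * c) + (z · (b * c) + w · (a * c)))
          + (z · w · c + (v · (a * b) + ((z *ᶜ v) · b + (w *ᶜ v) · a)))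
          ≈⟨ solve 7 (λ p q r s t u x →
               (p :+ (q :+ r)) :+ (s :+ (t :+ (u :+ x)))
               ⊜ (p :+ (r :+ t)) :+ ((q :+ (s :+ u)) :+ x)) refl
               (a * (b * c)) (z · (b * c)) (w · (a * c)) (z · w · c) (v · (a * b))
               ((z *ᶜ v) · b) ((w *ᶜ v) · a) ⟩
        (a * (b * c) + (w · (a * c) + v · (a * b)))
          + ((z · (b * c) + (z · w · c + (z *ᶜ v) · b)) + (w *ᶜ v) · a)
          ≈⟨ +-cong (trans (distribˡ _ _ _) (+-congˡ (trans (distribˡ _ _ _)
               (+-cong (·-*-assocʳ w a c) (·-*-assocʳ v a b)))))
             (+-congʳ (trans (·-distribˡ _ _ _) (+-congˡ (trans (·-distribˡ _ _ _)
               (+-congˡ (sym (·-assoc z v b))))))) ⟨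
        a * (b * c + (w · c + v · b)) + (z · (b * c + (w · c + v · b)) + (w *ᶜ v) · a) ∎

    scalarPart : StarRingHom unitization ℂ-starRing
    scalarPart = record
      { ⟦_⟧ = proj₂ ; ⟦⟧-cong = proj₂ ; +-homo = λ _ _ → C.refl
      ; *-homo = λ _ _ → C.refl ; ⋆-homo = λ _ → C.refl }

    -- The kernel of K₀₀(A⁺) → K₀₀(ℂ), so that A need not be unital.
    K₀ : AbelianGroup (c ⊔ ℓ) (c ⊔ ℓ)
    K₀ = kernel (K₀₀ unitization) (K₀₀ ℂ-starRing) (K₀₀-map scalarPart)
                (K₀₀-map-isHomomorphism scalarPart)

    open Matrices starRing

    -- K₁(A) is built from the unitary matrices 1 + x over the unitization
    -- with x ∈ M∞(A); the condition that 1 + x is unitary is spelled out in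
    -- terms of x.

    IsUnitary : ∀ {n} → Mat n n → Set ℓ
    IsUnitary x = (x ⊞ x † ⊞ x † ⊡ x) ≋ 𝟘 × (x ⊞ x † ⊞ x ⊡ x †) ≋ 𝟘

    record Unitary : Set (c ⊔ ℓ) where
      field
        {size}    : ℕ
        matrix    : Mat size size
        isUnitary : IsUnitary matrix

    -- Adjoining 1's on the diagonal of 1 + x is padding x with zeros
    -- (used only for n ≤ k).
    pad : ∀ {n} k → Mat n n → Mat k k
    pad {n} k x i j with toℕ i <? n | toℕ j <? n
    ... | yes i<n | yes j<n = x (fromℕ< i<n) (fromℕ< j<n)
    ... | _       | _       = 0#

    Interval : Set
    Interval = Σ R.Carrier λ s → R.0# R.≤ s × s R.≤ R.1#

    -- Norm-continuous paths of unitaries. The norm of matrices is equivalent to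
    -- the maximum of the norms of the entries.
    record Homotopic {n : ℕ} (x y : Mat n n) : Set (c ⊔ ℓ) where
      field
        path       : Interval → Mat n n
        isUnitary  : ∀ s → IsUnitary (path s)
        start      : ∀ s → proj₁ s R.≈ R.0# → path s ≋ x
        end        : ∀ s → proj₁ s R.≈ R.1# → path s ≋ y
        continuous : ∀ s ε → R.0# R.< ε → ∃[ δ ] R.0# R.< δ ×
          (∀ s′ → R.Within δ (proj₁ s) (proj₁ s′) →
            ∀ i j → ‖ path s i j + (- path s′ i j) ‖ R.< ε)

    StablyHomotopic : Rel Unitary (c ⊔ ℓ)
    StablyHomotopic u v = ∃[ k ] size u ℕ.≤ k × size v ℕ.≤ k ×
                                 Homotopic (pad k (matrix u)) (pad k (matrix v))
      where open Unitary

    -- The group operation is [u] + [v] = [u ⊕ v], which agrees with [u v]. Only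
    -- the operations and the equality of K₁ are recorded, since those are what
    -- an isomorphism refers to.
    K₁ : RawGroup (c ⊔ ℓ) (c ⊔ ℓ)
    K₁ = record
      { Carrier = Unitary
      ; _≈_     = StablyHomotopic
      ; _∙_     = λ u v → record
          { matrix    = matrix u ⊕ matrix v
          ; isUnitary = ⊕-unitary (isUnitary u) (isUnitary v)
          }
      ; ε       = record { size = 0 ; matrix = λ () ; isUnitary = (λ ()) , (λ ()) }
      ; _⁻¹     = λ u → record
          { matrix    = matrix u †
          ; isUnitary = †-unitary (isUnitary u)
          }
      }
      where
      open Unitary

      𝟘⊕𝟘 : ∀ m n → 𝟘 {m} {m} ⊕ 𝟘 {n} {n} ≋ 𝟘
      𝟘⊕𝟘 m n i j with splitAt m i | splitAt m j
      ... | inj₁ _ | inj₁ _ = refl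
      ... | inj₁ _ | inj₂ _ = refl
      ... | inj₂ _ | inj₁ _ = refl
      ... | inj₂ _ | inj₂ _ = refl

      ⊕-unitary : ∀ {m n} {x : Mat m m} {y : Mat n n} →
                  IsUnitary x → IsUnitary y → IsUnitary (x ⊕ y)
      ⊕-unitary {m} {n} {x} {y} (p , p′) (q , q′) =
          combine (x †) x (y †) y p q
                  (⊡-cong {Y = x ⊕ y} (⊕-† x y) ≋-refl)
        , combine x (x †) y (y †) p′ q′
                  (⊡-cong {X = x ⊕ y} ≋-refl (⊕-† x y))
        where
        combine : (a b : Mat m m) (a′ b′ : Mat n n) →
          (x ⊞ x † ⊞ a ⊡ b) ≋ 𝟘 → (y ⊞ y † ⊞ a′ ⊡ b′) ≋ 𝟘 →
          {e : Mat (m ℕ.+ n) (m ℕ.+ n)} → e ≋ (a ⊕ a′) ⊡ (b ⊕ b′) →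
          ((x ⊕ y) ⊞ (x ⊕ y) † ⊞ e) ≋ 𝟘
        combine a b a′ b′ p q h =
          ≋-trans (⊞-cong (⊞-cong {X = x ⊕ y} ≋-refl (⊕-† x y)) (≋-trans h (⊕-⊡ a b a′ b′)))
          (≋-trans (⊞-cong {Y = (a ⊡ b) ⊕ (a′ ⊡ b′)} (⊕-⊞ x (x †) y (y †)) ≋-refl)
          (≋-trans (⊕-⊞ (x ⊞ x †) (a ⊡ b) (y ⊞ y †) (a′ ⊡ b′))
          (≋-trans (⊕-cong p q) (𝟘⊕𝟘 m n))))

      †-unitary : ∀ {n} {x : Mat n n} → IsUnitary x → IsUnitary (x †)
      †-unitary {n} {x} (p , q) =
          (λ i j → trans (+-cong (trans (+-congˡ (⋆-involutive (x i j))) (+-comm _ _))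
                     (⊡-cong {Y = x †} (†-involutive x) ≋-refl i j)) (q i j))
        , (λ i j → trans (+-cong (trans (+-congˡ (⋆-involutive (x i j))) (+-comm _ _))
                     (⊡-cong {X = x †} ≋-refl (†-involutive x) i j)) (p i j))

  K : Fin 2 → ∀ {c ℓ} → CStarAlgebra c ℓ → RawGroup (c ⊔ ℓ) (c ⊔ ℓ)
  K zero       A = AbelianGroup.rawGroup (KTheory.K₀ A)
  K (suc zero) A = KTheory.K₁ A

infix  4 _≅ᴳ_
infixl 8 _^ᴳ_

_^ᴳ_ : ∀ {c ℓ} → RawGroup c ℓ → ℕ → RawGroup c ℓ
G ^ᴳ n = record
  { Carrier = Fin n → Carrier
  ; _≈_     = λ f g → ∀ i → f i ≈ g i
  ; _∙_     = λ f g i → f i ∙ g i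
  ; ε       = λ _ → ε
  ; _⁻¹     = λ f i → f i ⁻¹
  }
  where open RawGroup G

_≅ᴳ_ : ∀ {c₁ ℓ₁ c₂ ℓ₂} → RawGroup c₁ ℓ₁ → RawGroup c₂ ℓ₂ → Set (c₁ ⊔ ℓ₁ ⊔ c₂ ⊔ ℓ₂)
G ≅ᴳ H = Σ (RawGroup.Carrier G → RawGroup.Carrier H) IsGroupIsomorphism
  where open GroupMorphisms G H

infixl 6 _⊹_

_⊹_ : ∀ {k} → Vec ℕ k → Vec ℕ k → Vec ℕ k
_⊹_ = zipWith ℕ._+_

-- Mor is the set, up to _≈_, of all morphisms of the category, and compose μ ν
-- is μν.

record RankGraph (k : ℕ) : Set₁ where
  infix 4 _≈_
  field
    Obj           : Set
    Mor           : Set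
    _≈_           : Rel Mor 0ℓ
    isEquivalence : IsEquivalence _≈_
    r s           : Mor → Obj
    r-cong        : ∀ {μ ν} → μ ≈ ν → r μ ≡ r ν
    s-cong        : ∀ {μ ν} → μ ≈ ν → s μ ≡ s ν
    ident         : Obj → Mor
    r-ident       : ∀ v → r (ident v) ≡ v
    s-ident       : ∀ v → s (ident v) ≡ v
    compose       : ∀ μ ν → s μ ≡ r ν → Mor
    compose-cong  : ∀ {μ μ′ ν ν′} → μ ≈ μ′ → ν ≈ ν′ → ∀ e e′ → compose μ ν e ≈ compose μ′ ν′ e′
    r-compose     : ∀ μ ν e → r (compose μ ν e) ≡ r μ
    s-compose     : ∀ μ ν e → s (compose μ ν e) ≡ s ν
    identityˡ     : ∀ ν e → compose (ident (r ν)) ν e ≈ ν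
    identityʳ     : ∀ μ e → compose μ (ident (s μ)) e ≈ μ
    assoc         : ∀ λ₁ λ₂ λ₃ e₁ e₂ e₃ e₄ →
      compose (compose λ₁ λ₂ e₁) λ₃ e₂ ≈ compose λ₁ (compose λ₂ λ₃ e₃) e₄
    countable     : Σ (Mor → ℕ) λ code → (∀ {μ ν} → μ ≈ ν → code μ ≡ code ν)
                                       × (∀ {μ ν} → code μ ≡ code ν → μ ≈ ν)

    d             : Mor → Vec ℕ k
    d-cong        : ∀ {μ ν} → μ ≈ ν → d μ ≡ d ν
    d-ident       : ∀ v → d (ident v) ≡ replicate k 0
    d-compose     : ∀ μ ν e → d (compose μ ν e) ≡ d μ ⊹ d ν
    factorize     : ∀ φ m n → d φ ≡ m ⊹ n →
      ∃[ μ ] ∃[ ν ] Σ (s ν ≡ r μ) λ e → φ ≈ compose ν μ e × d μ ≡ m × d ν ≡ n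
    factorize-unique : ∀ {μ ν μ′ ν′} e e′ → compose ν μ e ≈ compose ν′ μ′ e′ →
      d μ ≡ d μ′ → d ν ≡ d ν′ → μ ≈ μ′ × ν ≈ ν′


module _ {k : ℕ} (Λ : RankGraph k) where
  open RankGraph Λ

  infix 4 _∈Λ[_,_]

  _∈Λ[_,_] : Mor → Vec ℕ k → Obj → Set
  μ ∈Λ[ n , v ] = d μ ≡ n × r μ ≡ v

  record Enumerates (n : Vec ℕ k) (v : Obj) (μs : List Mor) : Set where
    field
      sound    : All (_∈Λ[ n , v ]) μs
      distinct : AllPairs (λ μ ν → ¬ (μ ≈ ν)) μs
      complete : ∀ μ → μ ∈Λ[ n , v ] → Any (μ ≈_) μs

  RowFinite : Set
  RowFinite = ∀ n v → ∃[ μs ] Enumerates n v μs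

  NoSources : Set
  NoSources = ∀ n v → ∃[ μ ] μ ∈Λ[ n , v ]

module CuntzKrieger (ℝ : RealField) where
  open CStar ℝ public

  -- The relations defining C⋆(Λ) for row-finite Λ. The sum over the finite set
  -- Λⁿ(v) is taken along an arbitrary duplicate-free enumeration of it.

  record Family {k : ℕ} (Λ : RankGraph k) {c ℓ : Level} (A : CStarAlgebra c ℓ) : Set (c ⊔ ℓ) where
    open CStarAlgebra A
    open RankGraph Λ using (Mor; Obj; ident; compose; d; r; s) renaming (_≈_ to _≈ᴹ_)
    field
      gen      : Mor → Carrier
      gen-cong : ∀ {μ ν} → μ ≈ᴹ ν → gen μ ≈ gen ν

    vertex : Obj → Carrier
    vertex v = gen (ident v)

    field
      partialIsometry   : ∀ μ → gen μ * (gen μ ⋆ * gen μ) ≈ gen μ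
      vertex-idempotent : ∀ v → vertex v * vertex v ≈ vertex v
      vertex-⋆          : ∀ v → vertex v ⋆ ≈ vertex v
      vertex-orthogonal : ∀ u v → u ≢ v → vertex u * vertex v ≈ 0#
      gen-compose       : ∀ μ ν e → gen (compose μ ν e) ≈ gen μ * gen ν
      gen⋆gen           : ∀ μ → gen μ ⋆ * gen μ ≈ vertex (s μ)
      vertex-sum        : ∀ n v μs → Enumerates Λ n v μs →
        vertex v ≈ foldr _+_ 0# (map (λ μ → gen μ * gen μ ⋆) μs)

  -- A is C⋆(Λ), characterized by its universal property. That the family
  -- generates A is a consequence of extend-unique.

  record IsGraphAlgebra {k : ℕ} (Λ : RankGraph k) {c ℓ : Level} (A : CStarAlgebra c ℓ) :
                        Set (lsuc (c ⊔ ℓ)) where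
    open Family
    open StarHom using (⟦_⟧)
    field
      family : Family Λ A
      extend : ∀ (B : CStarAlgebra c ℓ) (t : Family Λ B) → StarHom A B
      extend-gen : ∀ (B : CStarAlgebra c ℓ) (t : Family Λ B) μ →
        CStarAlgebra._≈_ B (⟦ extend B t ⟧ (gen family μ)) (gen t μ)
      extend-unique : ∀ (B : CStarAlgebra c ℓ) (φ ψ : StarHom A B) →
        (∀ μ → CStarAlgebra._≈_ B (⟦ φ ⟧ (gen family μ)) (⟦ ψ ⟧ (gen family μ))) →
        ∀ x → CStarAlgebra._≈_ B (⟦ φ ⟧ x) (⟦ ψ ⟧ x)

open import Data.Bool.Base using (Bool; true; false; not; if_then_else_)
import Data.Bool.Properties as Bool
open import Data.Fin.Patterns using (0F; 1F; 2F; 3F)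
import Data.Fin.Properties as Fin
open import Data.List.Membership.Propositional using (_∈_)
open import Data.List.Membership.Propositional.Properties using (∈-cartesianProduct⁺; ∈-allFin)
open import Data.List.Relation.Unary.Any.Properties using (lookup-index; lookup-result)
import Data.List.Relation.Unary.Any.Properties as Any
import Data.List.Relation.Unary.Unique.Setoid.Properties as UniqueSetoid
open import Data.List.Relation.Unary.Unique.Propositional using (Unique)
open import Data.List.Relation.Unary.Unique.Propositional.Properties using (allFin⁺; cartesianProduct⁺)
open import Data.Nat.Base using (NonZero; >-nonZero; _+_; _*_; _∸_; _/_; _%_; _≤_; _<_; z≤n; s≤s)
open import Data.Nat.DivMod using (_mod_; m%n<n; m%n≤n; m≡m%n+[m/n]*n; %-distribˡ-+; [m+kn]%n≡m%n; m<n⇒m%n≡m; m%n%n≡m%n; m/n≤m; m*[n/m]≡n)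
open import Data.Nat.Divisibility using (_∣_)
open import Data.Nat.ListAction using (sum)
open import Data.Nat.Properties
open import Data.Product.Properties using (≡-dec)
open import Relation.Binary.Bundles using (Setoid)
open import Relation.Binary.Definitions using (DecidableEquality)
open import Relation.Nullary.Decidable.Core using (⌊_⌋; map′; _×-dec_; ¬?)

-- Injective coding of pairs, and of the restriction of a sequence to
-- {0,…,n}, by natural numbers.

private
  pair : ℕ → ℕ → ℕ
  pair zero    b = suc (2 * b)
  pair (suc a) b = 2 * pair a b

  pair-injective : ∀ a b a′ b′ → pair a b ≡ pair a′ b′ → a ≡ a′ × b ≡ b′
  pair-injective zero    b zero     b′ e = ≡.refl , *-cancelˡ-≡ b b′ 2 (suc-injective e)
  pair-injective zero    b (suc a′) b′ e = contradiction (≡.sym e) (even≢odd (pair a′ b′) b)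
  pair-injective (suc a) b zero     b′ e = contradiction e (even≢odd (pair a b) b′)
  pair-injective (suc a) b (suc a′) b′ e
    with ≡.refl , b≡b′ ← pair-injective a b a′ b′ (*-cancelˡ-≡ _ _ 2 e) = ≡.refl , b≡b′

  seqCode : (ℕ → ℕ) → ℕ → ℕ
  seqCode h zero    = h 0
  seqCode h (suc n) = pair (h (suc n)) (seqCode h n)

  seqCode-injective : ∀ h h′ n → seqCode h n ≡ seqCode h′ n → ∀ p → p ≤ n → h p ≡ h′ p
  seqCode-injective h h′ zero    e .0 z≤n = e
  seqCode-injective h h′ (suc n) e p  p≤n with m≤n⇒m<n∨m≡n p≤n
  ... | inj₁ (s≤s p≤n′) = seqCode-injective h h′ n 
        (proj₂ (pair-injective (h (suc n)) (seqCode h n) (h′ (suc n)) (seqCode h′ n) e)) p p≤n′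
  ... | inj₂ ≡.refl     = proj₁ (pair-injective (h p) (seqCode h n) (h′ p) (seqCode h′ n) e)

  seqCode-cong : ∀ h h′ n → (∀ p → p ≤ n → h p ≡ h′ p) → seqCode h n ≡ seqCode h′ n
  seqCode-cong h h′ zero    e = e 0 z≤n
  seqCode-cong h h′ (suc n) e =
    ≡.cong₂ pair (e (suc n) ≤-refl) (seqCode-cong h h′ n λ p p≤n → e p (m≤n⇒m≤1+n p≤n))

record Finite (S : Set) : Set where
  field
    elements : List S
    complete : ∀ a → a ∈ elements
    unique   : Unique elements

Matrix : Set → Set
Matrix S = S → S → ℕ

module _ {S : Set} (fin : Finite S) where
  open Finite fin

  _⊗_ : Matrix S → Matrix S → Matrix S
  (M ⊗ N) a c = sum (map (λ b → M a b * N b c) elements)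

  Is01 : Matrix S → Set
  Is01 M = ∀ a b → M a b ≡ 0 ⊎ M a b ≡ 1

  record Admissible (N₁ N₂ : Matrix S) : Set where
    field
      is01₁   : Is01 N₁
      is01₂   : Is01 N₂
      commute : ∀ a b → (N₁ ⊗ N₂) a b ≡ (N₂ ⊗ N₁) a b
      is01₁₂  : Is01 (N₁ ⊗ N₂)

-- Every path a → b → c with a first step in N and a second in N′ is
-- completed to a commuting square by a unique path a → fill a c → c with a
-- first step in N′ and a second in N.

record Completion {S : Set} (N N′ : Matrix S) : Set where
  field
    fill        : S → S → S
    fill-first  : ∀ {a b c} → N a b ≡ 1 → N′ b c ≡ 1 → N′ a (fill a c) ≡ 1
    fill-second : ∀ {a b c} → N a b ≡ 1 → N′ b c ≡ 1 → N (fill a c) c ≡ 1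
    fill-unique : ∀ {a b b′ c} → N′ a b ≡ 1 → N b c ≡ 1 → N′ a b′ ≡ 1 → N b′ c ≡ 1 → b ≡ b′

private
  sum≥ : ∀ {S : Set} (f : S → ℕ) {b xs} → b ∈ xs → f b ≤ sum (map f xs)
  sum≥ f (here ≡.refl) = m≤m+n _ _
  sum≥ f (there b∈)    = ≤-trans (sum≥ f b∈) (m≤n+m _ _)

  sum≥₂ : ∀ {S : Set} (f : S → ℕ) {b b′ xs} → b ∈ xs → b′ ∈ xs →
          b ≡ b′ ⊎ f b + f b′ ≤ sum (map f xs)
  sum≥₂ f (here ≡.refl) (here ≡.refl) = inj₁ ≡.refl
  sum≥₂ f (here ≡.refl) (there q)     = inj₂ (+-monoʳ-≤ _ (sum≥ f q))
  sum≥₂ f {b} {b′} (there p) (here ≡.refl) =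
    inj₂ (≤-trans (≤-reflexive (+-comm (f b) (f b′))) (+-monoʳ-≤ _ (sum≥ f p)))
  sum≥₂ f (there p)     (there q)     =
    Sum.map₂ (λ le → ≤-trans le (m≤n+m _ _)) (sum≥₂ f p q)

  sum>0 : ∀ {S : Set} (f : S → ℕ) xs → sum (map f xs) ≢ 0 → ∃[ b ] f b ≢ 0
  sum>0 f []       ne = contradiction ≡.refl ne
  sum>0 f (x ∷ xs) ne with f x in eq
  ... | zero  = sum>0 f xs ne
  ... | suc _ = x , λ fx≡0 → contradiction (≡.trans (≡.sym eq) fx≡0) λ ()

module _ {S : Set} (fin : Finite S) where
  open Finite fin

  completion : ∀ {N N′} → Is01 fin N → Is01 fin N′ →
               (∀ a b → (_⊗_ fin N N′) a b ≡ (_⊗_ fin N′ N) a b) →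
               Is01 fin (_⊗_ fin N′ N) → Completion N N′
  completion {N} {N′} N01 N′01 comm NN′01 = record
    { fill        = λ a c → pick a c (search a c)
    ; fill-first  = λ {a} {b} {c} p q → proj₁ (found a c (search a c) p q)
    ; fill-second = λ {a} {b} {c} p q → proj₂ (found a c (search a c) p q)
    ; fill-unique = λ {a} {b} {b′} {c} p q p′ q′ →
        [ (λ b≡b′ → b≡b′) , (λ 2≤ → contradiction
            (≤-trans (≤-reflexive (≡.cong₂ _+_ (≡.sym (one p q)) (≡.sym (one p′ q′)))) 2≤)
            (bound a c)) ]′
        (sum≥₂ (λ b → N′ a b * N b c) (complete b) (complete b′))
    }
    where
    one : ∀ {x y} → x ≡ 1 → y ≡ 1 → x * y ≡ 1
    one p q = ≡.cong₂ _*_ p q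

    bound : ∀ a c → ¬ (2 ≤ (_⊗_ fin N′ N) a c)
    bound a c 2≤ with NN′01 a c
    ... | inj₁ e = contradiction (≤-trans 2≤ (≤-reflexive e)) λ ()
    ... | inj₂ e = contradiction (≤-trans 2≤ (≤-reflexive e)) λ { (s≤s ()) }

    search : ∀ a c → Dec (Any (λ b → N′ a b * N b c ≡ 1) elements)
    search a c = Any.any? (λ b → N′ a b * N b c ≟ 1) elements

    pick : ∀ a c → Dec (Any (λ b → N′ a b * N b c ≡ 1) elements) → S
    pick a c (yes any) = Any.lookup any
    pick a c (no _)    = a

    exists : ∀ {a b c} → N a b ≡ 1 → N′ b c ≡ 1 → ∃[ b′ ] N′ a b′ * N b′ c ≡ 1
    exists {a} {b} {c} p q
      with b′ , ne ← sum>0 (λ b → N′ a b * N b c) elements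
             (λ e → contradiction
               (≤-trans (≤-reflexive (≡.sym (one p q)))
                 (≤-trans (sum≥ (λ b → N a b * N′ b c) (complete b))
                          (≤-reflexive (≡.trans (comm a c) e)))) λ ())
      with N′01 a b′ | N01 b′ c
    ... | inj₁ e | _      = contradiction (≡.cong (_* N b′ c) e) ne
    ... | inj₂ _ | inj₁ e = contradiction (≡.trans (≡.cong (N′ a b′ *_) e) (*-zeroʳ (N′ a b′))) ne
    ... | inj₂ e | inj₂ e′ = b′ , one e e′

    found : ∀ a c (s : Dec (Any (λ b → N′ a b * N b c ≡ 1) elements)) {b} →
            N a b ≡ 1 → N′ b c ≡ 1 → N′ a (pick a c s) ≡ 1 × N (pick a c s) c ≡ 1
    found a c (yes any) p q =
      m*n≡1⇒m≡1 _ _ (lookup-result any) , m*n≡1⇒n≡1 (N′ a _) _ (lookup-result any)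
    found a c (no ¬any) p q with b′ , e ← exists p q =
      contradiction (Any.map (λ { ≡.refl → e }) (complete b′)) ¬any

-- The 2-rank graph Λ(S;N₁,N₂).

module Grids {S : Set} where

  -- f restricts to a morphism {0,…,m}×{0,…,n} → S.
  record IsGrid (N₁ N₂ : Matrix S) (m n : ℕ) (f : ℕ → ℕ → S) : Set where
    constructor grid
    field
      step₁ : ∀ p q → p < m → q ≤ n → N₁ (f p q) (f (suc p) q) ≡ 1
      step₂ : ∀ p q → p ≤ m → q < n → N₂ (f p q) (f p (suc q)) ≡ 1

  open IsGrid

  transpose : ∀ {N₁ N₂ m n f} → IsGrid N₁ N₂ m n f → IsGrid N₂ N₁ n m (flip f)
  transpose (grid h v) = grid (λ p q p< q≤ → v q p q≤ p<) (λ p q p≤ q< → h q p q< p≤)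

  -- Filling a rectangle from one column and one row, row 0 and column 0
  -- meeting in a corner; column steps towards the corner are N-steps, row
  -- steps away from it are N′-steps.

  module Rectangle {N N′ : Matrix S} (C : Completion N N′) (col row : ℕ → S) where
    open Completion C

    W : ℕ → ℕ → S
    W zero    k       = col k
    W (suc i) zero    = row (suc i)
    W (suc i) (suc k) = fill (W i (suc k)) (W (suc i) k)

    W-row : col 0 ≡ row 0 → ∀ i → W i 0 ≡ row i
    W-row corner zero    = corner
    W-row corner (suc i) = ≡.refl

    module _ {I K : ℕ} (corner : col 0 ≡ row 0)
             (col-step : ∀ k → k < K → N (col (suc k)) (col k) ≡ 1)
             (row-step : ∀ i → i < I → N′ (row i) (row (suc i)) ≡ 1) where

      W-N  : ∀ i k → i ≤ I → k < K → N (W i (suc k)) (W i k) ≡ 1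
      W-N′ : ∀ i k → i < I → k ≤ K → N′ (W i k) (W (suc i) k) ≡ 1

      W-N zero    k _   k<K = col-step k k<K
      W-N (suc i) k i<I k<K = fill-second (W-N i k (<⇒≤ i<I) k<K) (W-N′ i k i<I (<⇒≤ k<K))

      W-N′ i zero    i<I _   = ≡.subst (λ a → N′ a (row (suc i)) ≡ 1) (≡.sym (W-row corner i)) (row-step i i<I)
      W-N′ i (suc k) i<I k<K = fill-first (W-N i k (<⇒≤ i<I) k<K) (W-N′ i k i<I (<⇒≤ k<K))

  suc-∸-suc : ∀ {n k} → k < n → suc (n ∸ suc k) ≡ n ∸ k
  suc-∸-suc {suc n} {zero}  _         = ≡.refl
  suc-∸-suc {suc n} {suc k} (s≤s k<n) = suc-∸-suc k<n

  module Glue {N₁ N₂ : Matrix S} (C₁₂ : Completion N₁ N₂) (C₂₁ : Completion N₂ N₁)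
              (f g : ℕ → ℕ → S) (m n : ℕ) where
    module Lower = Rectangle C₂₁ (λ k → f m (n ∸ k)) (λ i → g i 0)
    module Upper = Rectangle C₁₂ (λ k → f (m ∸ k) n) (λ i → g 0 i)

    glue : ∀ p q → Dec (p ≤ m) → Dec (q ≤ n) → S
    glue p q (yes _) (yes _) = f p q
    glue p q (no _)  (yes _) = Lower.W (p ∸ m) (n ∸ q)
    glue p q (yes _) (no _)  = Upper.W (q ∸ n) (m ∸ p)
    glue p q (no _)  (no _)  = g (p ∸ m) (q ∸ n)

    χ : ℕ → ℕ → S
    χ p q = glue p q (p ≤? m) (q ≤? n)

    χ-first : ∀ p q → p ≤ m → q ≤ n → χ p q ≡ f p q
    χ-first p q p≤m q≤n with p ≤? m | q ≤? n
    ... | yes _   | yes _   = ≡.refl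
    ... | no p≰m  | _       = contradiction p≤m p≰m
    ... | yes _   | no q≰n  = contradiction q≤n q≰n

    module _ {M N : ℕ} (gf : IsGrid N₁ N₂ m n f) (gg : IsGrid N₁ N₂ M N g)
             (meet : f m n ≡ g 0 0) where

      private
        step-lower : ∀ k → k < n → N₂ (f m (n ∸ suc k)) (f m (n ∸ k)) ≡ 1
        step-lower k k<n = ≡.subst (λ j → N₂ (f m (n ∸ suc k)) (f m j) ≡ 1) (suc-∸-suc k<n)
          (step₂ gf m (n ∸ suc k) ≤-refl (≤-trans (≤-reflexive (suc-∸-suc k<n)) (m∸n≤m n k)))

        step-upper : ∀ k → k < m → N₁ (f (m ∸ suc k) n) (f (m ∸ k) n) ≡ 1
        step-upper k k<m = ≡.subst (λ j → N₁ (f (m ∸ suc k) n) (f j n) ≡ 1) (suc-∸-suc k<m)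
          (step₁ gf (m ∸ suc k) n (≤-trans (≤-reflexive (suc-∸-suc k<m)) (m∸n≤m m k)) ≤-refl)

      χ-second : ∀ p q → χ (m + p) (n + q) ≡ g p q
      χ-second p q with m + p ≤? m | n + q ≤? n
      χ-second zero    zero    | yes _ | yes _ =
        ≡.trans (≡.cong₂ f (+-identityʳ m) (+-identityʳ n)) meet
      χ-second (suc p) q       | yes l | _     = contradiction l (m+1+n≰m m)
      χ-second zero    (suc q) | yes _ | yes l = contradiction l (m+1+n≰m n)
      χ-second zero    zero    | yes _ | no ¬l = contradiction (≤-reflexive (+-identityʳ n)) ¬l
      χ-second zero    (suc q) | yes _ | no _
        rewrite m+n∸m≡n n (suc q) | +-identityʳ m | n∸n≡0 m = ≡.refl
      χ-second zero    q       | no ¬l | _     = contradiction (≤-reflexive (+-identityʳ m)) ¬l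
      χ-second (suc p) zero    | no _  | yes _
        rewrite m+n∸m≡n m (suc p) | +-identityʳ n | n∸n≡0 n = ≡.refl
      χ-second (suc p) (suc q) | no _  | yes l = contradiction l (m+1+n≰m n)
      χ-second (suc p) zero    | no _  | no ¬l = contradiction (≤-reflexive (+-identityʳ n)) ¬l
      χ-second (suc p) (suc q) | no _  | no _
        rewrite m+n∸m≡n m (suc p) | m+n∸m≡n n (suc q) = ≡.refl

      χ-N₁ : ∀ p q → p < m + M → q ≤ n + N → N₁ (χ p q) (χ (suc p) q) ≡ 1
      χ-N₁ p q p< q≤ with p ≤? m | suc p ≤? m | q ≤? n
      ... | no p≰m  | yes p<m | _       = contradiction (<⇒≤ p<m) p≰m
      ... | yes _   | yes p<m | yes q≤n = step₁ gf p q p<m q≤n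
      ... | yes _   | yes p<m | no _    =
        ≡.subst (λ k → N₁ (Upper.W (q ∸ n) k) (Upper.W (q ∸ n) (m ∸ suc p)) ≡ 1) (suc-∸-suc p<m)
          (Upper.W-N meet step-upper (λ i → step₂ gg 0 i z≤n) (q ∸ n) (m ∸ suc p)
            (m≤n+o⇒m∸n≤o q n q≤)
            (≤-trans (≤-reflexive (suc-∸-suc p<m)) (m∸n≤m m p)))
      ... | no p≰m  | no _    | yes q≤n rewrite +-∸-assoc 1 (≰⇒≥ p≰m) =
        Lower.W-N′ meet step-lower (λ i i< → step₁ gg i 0 i< z≤n) (p ∸ m) (n ∸ q)
          (m<n+o⇒m∸n<o′ (≰⇒≥ p≰m) p<) (m∸n≤m n q)
        where
        m<n+o⇒m∸n<o′ : m ≤ p → p < m + M → p ∸ m < M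
        m<n+o⇒m∸n<o′ m≤p lt = +-cancelˡ-< m _ _ (≤-trans (s≤s (≤-reflexive (m+[n∸m]≡n m≤p))) lt)
      ... | no p≰m  | no _    | no _    rewrite +-∸-assoc 1 (≰⇒≥ p≰m) =
        step₁ gg (p ∸ m) (q ∸ n)
          (+-cancelˡ-< m _ _ (≤-trans (s≤s (≤-reflexive (m+[n∸m]≡n (≰⇒≥ p≰m)))) p<))
          (m≤n+o⇒m∸n≤o q n q≤)
      ... | yes p≤m | no p≮m  | yes q≤n
        with ≡.refl ← ≤-antisym p≤m (≮⇒≥ p≮m)
        rewrite +-∸-assoc 1 (≤-refl {p}) =
        ≡.subst (λ j → N₁ j (Lower.W (suc (p ∸ p)) (n ∸ q)) ≡ 1)
          (≡.trans (≡.cong (λ i → Lower.W i (n ∸ q)) (n∸n≡0 p)) (≡.cong (f p) (m∸[m∸n]≡n q≤n)))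
          (Lower.W-N′ meet step-lower (λ i i< → step₁ gg i 0 i< z≤n) (p ∸ p) (n ∸ q)
            (+-cancelˡ-< p _ _ (≤-trans (s≤s (≤-reflexive (m+[n∸m]≡n (≤-refl {p})))) p<))
            (m∸n≤m n q))
      ... | yes p≤m | no p≮m  | no _
        with ≡.refl ← ≤-antisym p≤m (≮⇒≥ p≮m)
        rewrite +-∸-assoc 1 (≤-refl {p}) | n∸n≡0 p =
        ≡.subst (λ j → N₁ j (g 1 (q ∸ n)) ≡ 1)
          (≡.sym (Upper.W-row meet (q ∸ n)))
          (step₁ gg 0 (q ∸ n)
            (+-cancelˡ-< p _ _ (≤-trans (s≤s (≤-reflexive (+-identityʳ p))) p<))
            (m≤n+o⇒m∸n≤o q n q≤))

  -- A grid is determined by its restrictions to two consecutive blocks.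

  module _ {N₁ N₂ : Matrix S} (C₂₁ : Completion N₂ N₁) {m n M N : ℕ} {χ χ′ : ℕ → ℕ → S}
           (gχ : IsGrid N₁ N₂ (m + M) (n + N) χ) (gχ′ : IsGrid N₁ N₂ (m + M) (n + N) χ′)
           (first  : ∀ p q → p ≤ m → q ≤ n → χ p q ≡ χ′ p q)
           (second : ∀ p q → p ≤ M → q ≤ N → χ (m + p) (n + q) ≡ χ′ (m + p) (n + q)) where
    open Completion C₂₁

    determined-lower : ∀ i k → i ≤ M → k ≤ n → χ (m + i) (n ∸ k) ≡ χ′ (m + i) (n ∸ k)
    determined-lower zero    k       _   _   =
      first (m + 0) (n ∸ k) (≤-reflexive (+-identityʳ m)) (m∸n≤m n k)
    determined-lower (suc i) zero    i≤M _   =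
      ≡.subst (λ j → χ (m + suc i) j ≡ χ′ (m + suc i) j) (+-identityʳ n) (second (suc i) 0 i≤M z≤n)
    determined-lower (suc i) (suc k) i<M k<n = fill-unique
      (horizontal gχ) (vertical gχ)
      (≡.subst (λ a → N₁ a (χ′ (m + suc i) (n ∸ suc k)) ≡ 1)
        (≡.sym (determined-lower i (suc k) (<⇒≤ i<M) k<n)) (horizontal gχ′))
      (≡.subst (λ c → N₂ (χ′ (m + suc i) (n ∸ suc k)) c ≡ 1)
        (≡.sym (determined-lower (suc i) k i<M (<⇒≤ k<n))) (vertical gχ′))
      where
      n∸k≤ : n ∸ suc k < n + N
      n∸k≤ = ≤-trans (≤-reflexive (suc-∸-suc k<n)) (≤-trans (m∸n≤m n k) (m≤m+n n N))

      horizontal : ∀ {f} → IsGrid N₁ N₂ (m + M) (n + N) f →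
                   N₁ (f (m + i) (n ∸ suc k)) (f (m + suc i) (n ∸ suc k)) ≡ 1
      horizontal {f} (grid h _) = ≡.subst (λ j → N₁ (f (m + i) (n ∸ suc k)) (f j (n ∸ suc k)) ≡ 1)
        (≡.sym (+-suc m i)) (h (m + i) (n ∸ suc k) (+-monoʳ-< m i<M) (<⇒≤ n∸k≤))

      vertical : ∀ {f} → IsGrid N₁ N₂ (m + M) (n + N) f →
                 N₂ (f (m + suc i) (n ∸ suc k)) (f (m + suc i) (n ∸ k)) ≡ 1
      vertical {f} (grid _ v) = ≡.subst (λ j → N₂ (f (m + suc i) (n ∸ suc k)) (f (m + suc i) j) ≡ 1)
        (suc-∸-suc k<n) (v (m + suc i) (n ∸ suc k) (+-monoʳ-≤ m i<M) n∸k≤)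

  determined : {N₁ N₂ : Matrix S} → Completion N₁ N₂ → Completion N₂ N₁ →
    ∀ m n {M N} {χ χ′ : ℕ → ℕ → S} →
    IsGrid N₁ N₂ (m + M) (n + N) χ → IsGrid N₁ N₂ (m + M) (n + N) χ′ →
    (∀ p q → p ≤ m → q ≤ n → χ p q ≡ χ′ p q) →
    (∀ p q → p ≤ M → q ≤ N → χ (m + p) (n + q) ≡ χ′ (m + p) (n + q)) →
    ∀ p q → p ≤ m + M → q ≤ n + N → χ p q ≡ χ′ p q
  determined C₁₂ C₂₁ m n {M} {N} {χ} {χ′} gχ gχ′ first second p q p≤ q≤ with p ≤? m | q ≤? n
  ... | yes p≤m | yes q≤n = first p q p≤m q≤n
  ... | no p≰m  | yes q≤n = ≡.subst₂ (λ p q → χ p q ≡ χ′ p q) (m+[n∸m]≡n (≰⇒≥ p≰m)) (m∸[m∸n]≡n q≤n)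
    (determined-lower C₂₁ {m} {n} gχ gχ′ first second (p ∸ m) (n ∸ q)
      (m≤n+o⇒m∸n≤o p m p≤) (m∸n≤m n q))
  ... | yes p≤m | no q≰n  = ≡.subst₂ (λ p q → χ p q ≡ χ′ p q) (m∸[m∸n]≡n p≤m) (m+[n∸m]≡n (≰⇒≥ q≰n))
    (determined-lower C₁₂ {n} {m} (transpose gχ) (transpose gχ′)
      (λ p q p≤ q≤ → first q p q≤ p≤) (λ p q p≤ q≤ → second q p q≤ p≤) (q ∸ n) (m ∸ p)
      (m≤n+o⇒m∸n≤o q n q≤) (m∸n≤m m p))
  ... | no p≰m  | no q≰n  = ≡.subst₂ (λ p q → χ p q ≡ χ′ p q)
    (m+[n∸m]≡n (≰⇒≥ p≰m)) (m+[n∸m]≡n (≰⇒≥ q≰n))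
    (second (p ∸ m) (q ∸ n) (m≤n+o⇒m∸n≤o p m p≤) (m≤n+o⇒m∸n≤o q n q≤))

  χ-transpose : {N₁ N₂ : Matrix S} (C₁₂ : Completion N₁ N₂) (C₂₁ : Completion N₂ N₁) →
    ∀ f g m n p q → Glue.χ C₂₁ C₁₂ (flip f) (flip g) n m q p ≡ Glue.χ C₁₂ C₂₁ f g m n p q
  χ-transpose C₁₂ C₂₁ f g m n p q with p ≤? m | q ≤? n
  ... | yes _ | yes _ = ≡.refl
  ... | no _  | yes _ = ≡.refl
  ... | yes _ | no _  = ≡.refl
  ... | no _  | no _  = ≡.refl

  χ-isGrid : {N₁ N₂ : Matrix S} (C₁₂ : Completion N₁ N₂) (C₂₁ : Completion N₂ N₁) →
    ∀ {f g m n M N} → IsGrid N₁ N₂ m n f → IsGrid N₁ N₂ M N g → f m n ≡ g 0 0 →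
    IsGrid N₁ N₂ (m + M) (n + N) (Glue.χ C₁₂ C₂₁ f g m n)
  χ-isGrid {N₂ = N₂} C₁₂ C₂₁ {f} {g} {m} {n} gf gg meet = grid
    (Glue.χ-N₁ C₁₂ C₂₁ f g m n gf gg meet)
    (λ p q p≤ q< → ≡.subst₂ (λ a b → N₂ a b ≡ 1)
      (χ-transpose C₁₂ C₂₁ f g m n p q) (χ-transpose C₁₂ C₂₁ f g m n p (suc q))
      (Glue.χ-N₁ C₂₁ C₁₂ (flip f) (flip g) n m (transpose gf) (transpose gg) meet q p q< p≤))

module GridGraph {S : Set} (fin : Finite S) {N₁ N₂ : Matrix S} (admissible : Admissible fin N₁ N₂) where
  open Finite fin
  open Admissible admissible
  open Grids {S}
  open IsGrid

  -- A map {0,…,m}×{0,…,n} → S is represented by a function on ℕ × ℕ, whose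
  -- values elsewhere are disregarded.

  record Morphism : Set where
    constructor morphism
    field
      {width height} : ℕ
      {at}           : ℕ → ℕ → S
      isGrid         : IsGrid N₁ N₂ width height at

  open Morphism

  C₁₂ : Completion N₁ N₂
  C₁₂ = completion fin is01₁ is01₂ commute
    (λ a b → Sum.map (≡.trans (≡.sym (commute a b))) (≡.trans (≡.sym (commute a b))) (is01₁₂ a b))

  C₂₁ : Completion N₂ N₁
  C₂₁ = completion fin is01₂ is01₁ (λ a b → ≡.sym (commute a b)) is01₁₂

  infix 4 _≈_
  record _≈_ (φ ψ : Morphism) : Set where
    constructor equal
    field
      width≡  : width φ ≡ width ψ
      height≡ : height φ ≡ height ψ
      at≡     : ∀ p q → p ≤ width φ → q ≤ height φ → at φ p q ≡ at ψ p q

  open _≈_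

  ≈-sym : ∀ {φ ψ} → φ ≈ ψ → ψ ≈ φ
  ≈-sym (equal w h e) = equal (≡.sym w) (≡.sym h) λ p q p≤ q≤ →
    ≡.sym (e p q (≤-trans p≤ (≤-reflexive (≡.sym w))) (≤-trans q≤ (≤-reflexive (≡.sym h))))

  ≈-trans : ∀ {φ ψ χ} → φ ≈ ψ → ψ ≈ χ → φ ≈ χ
  ≈-trans (equal ≡.refl ≡.refl e) (equal ≡.refl ≡.refl e′) = equal ≡.refl ≡.refl λ p q p≤ q≤ →
    ≡.trans (e p q p≤ q≤) (e′ p q p≤ q≤)

  range source : Morphism → S
  range  φ = at φ 0 0
  source φ = at φ (width φ) (height φ)

  source-cong : ∀ {φ ψ} → φ ≈ ψ → source φ ≡ source ψ
  source-cong (equal ≡.refl ≡.refl e) = e _ _ ≤-refl ≤-refl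

  ident : S → Morphism
  ident a = morphism {0} {0} {λ _ _ → a} (grid (λ _ _ ()) (λ _ _ _ ()))

  module _ (φ ψ : Morphism) (e : source φ ≡ range ψ) where
    compose : Morphism
    compose = morphism (χ-isGrid C₁₂ C₂₁ (isGrid φ) (isGrid ψ) e)

    compose-first : ∀ p q → p ≤ width φ → q ≤ height φ → at compose p q ≡ at φ p q
    compose-first = Glue.χ-first C₁₂ C₂₁ (at φ) (at ψ) (width φ) (height φ)

    compose-second : ∀ p q → at compose (width φ + p) (height φ + q) ≡ at ψ p q
    compose-second = Glue.χ-second C₁₂ C₂₁ (at φ) (at ψ) (width φ) (height φ)
                       (isGrid φ) (isGrid ψ) e

    compose-unique : ∀ {f} → IsGrid N₁ N₂ (width φ + width ψ) (height φ + height ψ) f →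
      (∀ p q → p ≤ width φ → q ≤ height φ → at φ p q ≡ f p q) →
      (∀ p q → p ≤ width ψ → q ≤ height ψ → at ψ p q ≡ f (width φ + p) (height φ + q)) →
      ∀ p q → p ≤ width φ + width ψ → q ≤ height φ + height ψ → at compose p q ≡ f p q
    compose-unique gf first second = determined C₁₂ C₂₁ (width φ) (height φ) (isGrid compose) gf
      (λ p q p≤ q≤ → ≡.trans (compose-first p q p≤ q≤) (first p q p≤ q≤))
      (λ p q p≤ q≤ → ≡.trans (compose-second p q) (second p q p≤ q≤))

  compose-cong : ∀ {φ φ′ ψ ψ′} → φ ≈ φ′ → ψ ≈ ψ′ → ∀ e e′ → compose φ ψ e ≈ compose φ′ ψ′ e′
  compose-cong {φ} {φ′} {ψ} {ψ′} (equal ≡.refl ≡.refl e₁) (equal ≡.refl ≡.refl e₂) e e′ =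
    equal ≡.refl ≡.refl (compose-unique φ ψ e (isGrid (compose φ′ ψ′ e′))
      (λ p q p≤ q≤ → ≡.trans (e₁ p q p≤ q≤) (≡.sym (compose-first φ′ ψ′ e′ p q p≤ q≤)))
      (λ p q p≤ q≤ → ≡.trans (e₂ p q p≤ q≤) (≡.sym (compose-second φ′ ψ′ e′ p q))))

  assoc : ∀ φ₁ φ₂ φ₃ e₁ e₂ e₃ e₄ →
    compose (compose φ₁ φ₂ e₁) φ₃ e₂ ≈ compose φ₁ (compose φ₂ φ₃ e₃) e₄
  assoc φ₁ φ₂ φ₃ e₁ e₂ e₃ e₄ = equal (+-assoc m₁ m₂ m₃) (+-assoc n₁ n₂ n₃)
    (compose-unique (compose φ₁ φ₂ e₁) φ₃ e₂ gR
      (compose-unique φ₁ φ₂ e₁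
        (grid (λ p q p< q≤ → step₁ gR p q (≤-trans p< (m≤m+n _ m₃)) (≤-trans q≤ (m≤m+n _ n₃)))
              (λ p q p≤ q< → step₂ gR p q (≤-trans p≤ (m≤m+n _ m₃)) (≤-trans q< (m≤m+n _ n₃))))
        (λ p q p≤ q≤ → ≡.sym (compose-first φ₁ φ₂₃ e₄ p q p≤ q≤))
        (λ p q p≤ q≤ → ≡.sym (≡.trans (compose-second φ₁ φ₂₃ e₄ p q)
                                      (compose-first φ₂ φ₃ e₃ p q p≤ q≤))))
      (λ p q _ _ → ≡.sym (≡.trans
        (≡.cong₂ (at R) (+-assoc m₁ m₂ p) (+-assoc n₁ n₂ q))
        (≡.trans (compose-second φ₁ φ₂₃ e₄ (m₂ + p) (n₂ + q)) (compose-second φ₂ φ₃ e₃ p q)))))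
    where
    m₁ = width φ₁ ; m₂ = width φ₂ ; m₃ = width φ₃
    n₁ = height φ₁ ; n₂ = height φ₂ ; n₃ = height φ₃
    φ₂₃ = compose φ₂ φ₃ e₃
    R = compose φ₁ φ₂₃ e₄
    gR : IsGrid N₁ N₂ ((m₁ + m₂) + m₃) ((n₁ + n₂) + n₃) (at R)
    gR = ≡.subst₂ (λ m n → IsGrid N₁ N₂ m n (at R))
           (≡.sym (+-assoc m₁ m₂ m₃)) (≡.sym (+-assoc n₁ n₂ n₃)) (isGrid R)

  position : S → ℕ
  position a = toℕ (Any.index (complete a))

  position-injective : ∀ {a b} → position a ≡ position b → a ≡ b
  position-injective {a} {b} e = ≡.trans (lookup-index (complete a))
    (≡.trans (≡.cong (lookup elements) (toℕ-injective e)) (≡.sym (lookup-index (complete b))))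

  rowCode : Morphism → ℕ → ℕ
  rowCode φ p = seqCode (λ q → position (at φ p q)) (height φ)

  code : Morphism → ℕ
  code φ = pair (width φ) (pair (height φ) (seqCode (rowCode φ) (width φ)))

  code-cong : ∀ {φ ψ} → φ ≈ ψ → code φ ≡ code ψ
  code-cong {φ} {ψ} (equal ≡.refl ≡.refl e) = ≡.cong (pair (width φ)) (≡.cong (pair (height φ))
    (seqCode-cong (rowCode φ) (rowCode ψ) (width φ) λ p p≤ →
      seqCode-cong _ _ (height φ) λ q q≤ → ≡.cong position (e p q p≤ q≤)))

  code-injective : ∀ {φ ψ} → code φ ≡ code ψ → φ ≈ ψ
  code-injective {φ@(morphism {m} {n} _)} {ψ@(morphism {m′} {n′} _)} e
    with ≡.refl , e′ ← pair-injective m (pair n (seqCode (rowCode φ) m))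
                                      m′ (pair n′ (seqCode (rowCode ψ) m′)) e
    with ≡.refl , e″ ← pair-injective n (seqCode (rowCode φ) m) n′ (seqCode (rowCode ψ) m) e′
    = equal ≡.refl ≡.refl λ p q p≤ q≤ → position-injective
        (seqCode-injective (λ q → position (at φ p q)) (λ q → position (at ψ p q)) n
          (seqCode-injective (rowCode φ) (rowCode ψ) m e″ p p≤) q q≤)

  degree : Morphism → Vec ℕ 2
  degree φ = width φ ∷ height φ ∷ []

  factorize : ∀ φ m n → degree φ ≡ m ⊹ n →
    ∃[ μ ] ∃[ ν ] Σ (source ν ≡ range μ) λ e →
      φ ≈ compose ν μ e × degree μ ≡ m × degree ν ≡ n
  factorize (morphism {at = f} g) (m₁ ∷ m₂ ∷ []) (n₁ ∷ n₂ ∷ []) ≡.refl =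
    μ , ν , e , ≈-sym (equal (+-comm n₁ m₁) (+-comm n₂ m₂)
      (compose-unique ν μ e g′ (λ _ _ _ _ → ≡.refl) (λ _ _ _ _ → ≡.refl))) , ≡.refl , ≡.refl
    where
    g′ : IsGrid N₁ N₂ (n₁ + m₁) (n₂ + m₂) f
    g′ = ≡.subst₂ (λ m n → IsGrid N₁ N₂ m n f) (+-comm m₁ n₁) (+-comm m₂ n₂) g

    ν μ : Morphism
    ν = morphism {n₁} {n₂} {f} (grid
      (λ p q p< q≤ → step₁ g′ p q (≤-trans p< (m≤m+n n₁ m₁)) (≤-trans q≤ (m≤m+n n₂ m₂)))
      (λ p q p≤ q< → step₂ g′ p q (≤-trans p≤ (m≤m+n n₁ m₁)) (≤-trans q< (m≤m+n n₂ m₂))))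
    μ = morphism {m₁} {m₂} {λ p q → f (n₁ + p) (n₂ + q)} (grid
      (λ p q p< q≤ → ≡.subst (λ p′ → N₁ (f (n₁ + p) (n₂ + q)) (f p′ (n₂ + q)) ≡ 1)
        (≡.sym (+-suc n₁ p)) (step₁ g′ (n₁ + p) (n₂ + q) (+-monoʳ-< n₁ p<) (+-monoʳ-≤ n₂ q≤)))
      (λ p q p≤ q< → ≡.subst (λ q′ → N₂ (f (n₁ + p) (n₂ + q)) (f (n₁ + p) q′) ≡ 1)
        (≡.sym (+-suc n₂ q)) (step₂ g′ (n₁ + p) (n₂ + q) (+-monoʳ-≤ n₁ p≤) (+-monoʳ-< n₂ q<))))

    e : source ν ≡ range μ
    e = ≡.sym (≡.cong₂ f (+-identityʳ n₁) (+-identityʳ n₂))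

  factorize-unique : ∀ {μ ν μ′ ν′} e e′ → compose ν μ e ≈ compose ν′ μ′ e′ →
    degree μ ≡ degree μ′ → degree ν ≡ degree ν′ → μ ≈ μ′ × ν ≈ ν′
  factorize-unique {μ} {ν} {μ′} {ν′} e e′ (equal _ _ E) ≡.refl ≡.refl =
      equal ≡.refl ≡.refl (λ p q p≤ q≤ → ≡.trans (≡.sym (compose-second ν μ e p q))
        (≡.trans (E _ _ (+-monoʳ-≤ (width ν) p≤) (+-monoʳ-≤ (height ν) q≤))
                 (compose-second ν′ μ′ e′ p q)))
    , equal ≡.refl ≡.refl (λ p q p≤ q≤ → ≡.trans (≡.sym (compose-first ν μ e p q p≤ q≤))
        (≡.trans (E p q (≤-trans p≤ (m≤m+n _ _)) (≤-trans q≤ (m≤m+n _ _)))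
                 (compose-first ν′ μ′ e′ p q p≤ q≤)))

  gridGraph : RankGraph 2
  gridGraph = record
    { Obj           = S
    ; Mor           = Morphism
    ; _≈_           = _≈_
    ; isEquivalence = record
      { refl = equal ≡.refl ≡.refl (λ _ _ _ _ → ≡.refl) ; sym = ≈-sym ; trans = ≈-trans }
    ; r             = range
    ; s             = source
    ; r-cong        = λ φ≈ψ → at≡ φ≈ψ 0 0 z≤n z≤n
    ; s-cong        = source-cong
    ; ident         = ident
    ; r-ident       = λ _ → ≡.refl
    ; s-ident       = λ _ → ≡.refl
    ; compose       = compose
    ; compose-cong  = compose-cong
    ; r-compose     = λ φ ψ e → compose-first φ ψ e 0 0 z≤n z≤n
    ; s-compose     = λ φ ψ e → compose-second φ ψ e (width ψ) (height ψ)
    ; identityˡ     = λ φ e → equal ≡.refl ≡.refl λ p q _ _ → compose-second (ident (range φ)) φ e p q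
    ; identityʳ     = λ φ e → equal (+-identityʳ (width φ)) (+-identityʳ (height φ)) λ p q p≤ q≤ →
        compose-first φ (ident (source φ)) e p q
          (≤-trans p≤ (≤-reflexive (+-identityʳ _))) (≤-trans q≤ (≤-reflexive (+-identityʳ _)))
    ; assoc         = assoc
    ; countable     = code , code-cong , code-injective
    ; d             = degree
    ; d-cong        = λ { (equal ≡.refl ≡.refl _) → ≡.refl }
    ; d-ident       = λ _ → ≡.refl
    ; d-compose     = λ _ _ _ → ≡.refl
    ; factorize     = factorize
    ; factorize-unique = factorize-unique
    }

-- Functions on ℕ, standing for their restrictions to {0,…,n}.

module _ (A : Setoid 0ℓ 0ℓ) where
  private
    module A = Setoid A

  upTo : ℕ → Setoid 0ℓ 0ℓ
  upTo n = record
    { Carrier = ℕ → A.Carrier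
    ; _≈_     = λ f g → ∀ p → p ≤ n → f p A.≈ g p
    ; isEquivalence = record
      { refl  = λ _ _ → A.refl
      ; sym   = λ e p p≤n → A.sym (e p p≤n)
      ; trans = λ e e′ p p≤n → A.trans (e p p≤n) (e′ p p≤n)
      }
    }

  snoc : ℕ → (ℕ → A.Carrier) → A.Carrier → ℕ → A.Carrier
  snoc n f a p with p ≤? n
  ... | yes _ = f p
  ... | no _  = a

  sequences : List A.Carrier → (n : ℕ) → List (ℕ → A.Carrier)
  sequences as zero    = map (λ a _ → a) as
  sequences as (suc n) = cartesianProductWith (snoc n) (sequences as n) as

  snoc-init : ∀ n f a p → p ≤ n → snoc n f a p ≡ f p
  snoc-init n f a p p≤n with p ≤? n
  ... | yes _   = ≡.refl
  ... | no p≰n = contradiction p≤n p≰n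

  snoc-last : ∀ n f a → snoc n f a (suc n) ≡ a
  snoc-last n f a with suc n ≤? n
  ... | yes n<n = contradiction n<n (<-irrefl ≡.refl)
  ... | no _    = ≡.refl

  sequences-distinct : ∀ as → AllPairs (λ a b → ¬ (a A.≈ b)) as → ∀ n →
    AllPairs (λ f g → ¬ (Setoid._≈_ (upTo n) f g)) (sequences as n)
  sequences-distinct as as! zero    = UniqueSetoid.map⁺ A (upTo 0) {f = λ a _ → a} (λ e → e 0 z≤n) as!
  sequences-distinct as as! (suc n) = UniqueSetoid.cartesianProductWith⁺ (upTo n) A (upTo (suc n)) (snoc n)
    (λ {f} {a} {g} {b} e →
        (λ p p≤n → A.trans (A.reflexive (≡.sym (snoc-init n f _ p p≤n)))
          (A.trans (e p (m≤n⇒m≤1+n p≤n)) (A.reflexive (snoc-init n _ _ p p≤n))))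
      , A.trans (A.reflexive (≡.sym (snoc-last n f _)))
          (A.trans (e (suc n) ≤-refl) (A.reflexive (snoc-last n _ _))))
    (sequences-distinct as as! n) as!

  sequences-complete : ∀ as → (∀ a → Any (a A.≈_) as) → ∀ n f →
    Any (Setoid._≈_ (upTo n) f) (sequences as n)
  sequences-complete as all zero    f = Any.map⁺ {f = λ a _ → a} (Any.map (λ { e .0 z≤n → e }) (all (f 0)))
  sequences-complete as all (suc n) f = Any.cartesianProductWith⁺ (snoc n)
    (λ {g} {a} e e′ p p≤ → [ (λ { (s≤s p≤n) → A.trans (e p p≤n) (A.reflexive (≡.sym (snoc-init n g a p p≤n))) })
                           , (λ { ≡.refl → A.trans e′ (A.reflexive (≡.sym (snoc-last n g a))) }) ]′
                           (m≤n⇒m<n∨m≡n p≤))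
    (sequences-complete as all n f) (all (f (suc n)))

module _ {S : Set} (fin : Finite S) {N₁ N₂ : Matrix S} (admissible : Admissible fin N₁ N₂) where
  open Finite fin
  open GridGraph fin admissible
  open Grids {S}
  open IsGrid
  open Morphism
  open _≈_

  private
    Grid : ℕ → ℕ → Setoid 0ℓ 0ℓ
    Grid m n = upTo (upTo (≡.setoid S) n) m

    candidates : ∀ m n → List (ℕ → ℕ → S)
    candidates m n = sequences (upTo (≡.setoid S) n) (sequences (≡.setoid S) elements n) m

    _≟ˢ_ : DecidableEquality S
    a ≟ˢ b = map′ position-injective (≡.cong position) (position a ≟ position b)

    Valid : ℕ → ℕ → S → (ℕ → ℕ → S) → Set
    Valid m n v f = IsGrid N₁ N₂ m n f × f 0 0 ≡ v

    valid? : ∀ m n v f → Dec (Valid m n v f)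
    valid? m n v f = map′
      (λ (h , w , e) → grid (λ p q p< q≤ → h {p} p< {q} (s≤s q≤)) (λ p q p≤ q< → w {p} (s≤s p≤) {q} q<) , e)
      (λ (g , e) → (λ {p} p< {q} q≤ → step₁ g p q p< (≤-pred q≤))
                 , (λ {p} p≤ {q} q< → step₂ g p q (≤-pred p≤) q<) , e)
      ( allUpTo? (λ p → allUpTo? (λ q → N₁ (f p q) (f (suc p) q) ≟ 1) (suc n)) m
      ×-dec allUpTo? (λ p → allUpTo? (λ q → N₂ (f p q) (f p (suc q)) ≟ 1) n) (suc m)
      ×-dec f 0 0 ≟ˢ v)

    valid-resp : ∀ m n v {f g} → Setoid._≈_ (Grid m n) f g → Valid m n v f → Valid m n v g
    valid-resp m n v e (grid h w , e₀) =
      grid (λ p q p< q≤ → ≡.subst₂ (λ a b → N₁ a b ≡ 1) (e p (<⇒≤ p<) q q≤) (e (suc p) p< q q≤) (h p q p< q≤))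
           (λ p q p≤ q< → ≡.subst₂ (λ a b → N₂ a b ≡ 1) (e p p≤ q (<⇒≤ q<)) (e p p≤ (suc q) q<) (w p q p≤ q<))
      , ≡.trans (≡.sym (e 0 z≤n 0 z≤n)) e₀

    select : ∀ m n v → List (ℕ → ℕ → S) → List Morphism
    select m n v []       = []
    select m n v (f ∷ fs) with valid? m n v f
    ... | yes (g , _) = morphism g ∷ select m n v fs
    ... | no _        = select m n v fs


  rowFinite : RowFinite gridGraph
  rowFinite (m ∷ n ∷ []) v = select m n v (candidates m n) , record
    { sound    = sound (candidates m n)
    ; distinct = distinct (candidates m n)
        (sequences-distinct (upTo (≡.setoid S) n) (sequences (≡.setoid S) elements n)
          (sequences-distinct (≡.setoid S) elements unique n) m)
    ; complete = λ { φ (≡.refl , e) → found φ e (candidates m n)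
        (sequences-complete (upTo (≡.setoid S) n) (sequences (≡.setoid S) elements n)
          (sequences-complete (≡.setoid S) elements complete n) m (at φ)) }
    }
    where
    sound : ∀ fs → All (λ φ → degree φ ≡ m ∷ n ∷ [] × range φ ≡ v) (select m n v fs)
    sound []       = []
    sound (f ∷ fs) with valid? m n v f
    ... | yes (g , e) = (≡.refl , e) ∷ sound fs
    ... | no _        = sound fs

    fresh : ∀ {f} (g : IsGrid N₁ N₂ m n f) fs → All (λ f′ → ¬ Setoid._≈_ (Grid m n) f f′) fs →
            All (λ ψ → ¬ (morphism g ≈ ψ)) (select m n v fs)
    fresh g []        []       = []
    fresh g (f′ ∷ fs) (≉ ∷ ≉s) with valid? m n v f′
    ... | yes _ = (λ eq → ≉ λ p p≤ q q≤ → at≡ eq p q p≤ q≤) ∷ fresh g fs ≉s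
    ... | no _  = fresh g fs ≉s

    distinct : ∀ fs → AllPairs (λ f f′ → ¬ Setoid._≈_ (Grid m n) f f′) fs →
               AllPairs (λ φ ψ → ¬ (φ ≈ ψ)) (select m n v fs)
    distinct []       []         = []
    distinct (f ∷ fs) (≉s ∷ fs!) with valid? m n v f
    ... | yes (g , _) = fresh g fs ≉s ∷ distinct fs fs!
    ... | no _        = distinct fs fs!

    found : ∀ (φ : Morphism) → range φ ≡ v → ∀ fs →
      Any (Setoid._≈_ (Grid (width φ) (height φ)) (at φ)) fs →
      Any (φ ≈_) (select (width φ) (height φ) v fs)
    found φ e (f ∷ fs) (here eq) with valid? (width φ) (height φ) v f
    ... | yes _ = here (equal ≡.refl ≡.refl λ p q p≤ q≤ → eq p p≤ q q≤)
    ... | no ¬v = contradiction (valid-resp (width φ) (height φ) v eq (isGrid φ , e)) ¬v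
    found φ e (f ∷ fs) (there any) with valid? (width φ) (height φ) v f
    ... | yes _ = there (found φ e fs any)
    ... | no _  = found φ e fs any

open Finite

finiteFin : ∀ n → Finite (Fin n)
finiteFin n = record { elements = allFin n ; complete = ∈-allFin ; unique = allFin⁺ n }

finiteBool : Finite Bool
finiteBool = record
  { elements = false ∷ true ∷ []
  ; complete = λ { false → here ≡.refl ; true → there (here ≡.refl) }
  ; unique   = ((λ ()) ∷ []) ∷ [] ∷ []
  }

_×-finite_ : ∀ {S T : Set} → Finite S → Finite T → Finite (S × T)
F ×-finite G = record
  { elements = cartesianProduct (elements F) (elements G)
  ; complete = λ (a , b) → ∈-cartesianProduct⁺ (complete F a) (complete G b)
  ; unique   = cartesianProduct⁺ (unique F) (unique G)
  }

𝟙 : ∀ {P : Set} → Dec P → ℕ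
𝟙 P? = if ⌊ P? ⌋ then 1 else 0

module _ {P : Set} where

  𝟙-01 : (P? : Dec P) → 𝟙 P? ≡ 0 ⊎ 𝟙 P? ≡ 1
  𝟙-01 (yes _) = inj₂ ≡.refl
  𝟙-01 (no _)  = inj₁ ≡.refl

  𝟙-true : (P? : Dec P) → 𝟙 P? ≡ 1 → P
  𝟙-true (yes p) _ = p

  true-𝟙 : (P? : Dec P) → P → 𝟙 P? ≡ 1
  true-𝟙 (yes _) _ = ≡.refl
  true-𝟙 (no ¬p) p = contradiction p ¬p

iter : ∀ {A : Set} → (A → A) → ℕ → A → A
iter f zero    a = a
iter f (suc n) a = f (iter f n a)

other : ∀ {n} → 2 ≤ n → Fin n → Fin n
other (s≤s (s≤s _)) zero    = 1F
other (s≤s (s≤s _)) (suc _) = 0F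

other-≢ : ∀ {n} (2≤n : 2 ≤ n) i → i ≢ other 2≤n i
other-≢ (s≤s (s≤s _)) zero    ()
other-≢ (s≤s (s≤s _)) (suc _) ()

-- The matrices of both systems of polygons turn out to be of the following
-- kind: a polygon is indexed by a white vertex i, a black vertex j and a
-- residual index k, and a step changes one of the vertices to any other one
-- and applies a fixed map to k.

module ProductLike {α β : ℕ} {K : Set} (finiteK : Finite K) where

  Index : Set
  Index = Fin α × Fin β × K

  finiteIndex : Finite Index
  finiteIndex = finiteFin α ×-finite (finiteFin β ×-finite finiteK)

  WhiteStep BlackStep : (K → K) → Index → Index → Set
  WhiteStep σ (i , j , k) (i′ , j′ , k′) = i ≢ i′ × j ≡ j′ × k′ ≡ σ k
  BlackStep σ (i , j , k) (i′ , j′ , k′) = i ≡ i′ × j ≢ j′ × k′ ≡ σ k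

  Decides : Matrix Index → (Index → Index → Set) → Set
  Decides N R = ∀ A B → (N A B ≡ 1 → R A B) × (R A B → N A B ≡ 1)

  private
    01-≡ : ∀ {x y} → x ≡ 0 ⊎ x ≡ 1 → y ≡ 0 ⊎ y ≡ 1 → (x ≡ 1 → y ≡ 1) → (y ≡ 1 → x ≡ 1) → x ≡ y
    01-≡ (inj₁ p) (inj₁ q) f g = ≡.trans p (≡.sym q)
    01-≡ (inj₁ p) (inj₂ q) f g = ≡.trans (g q) (≡.sym q)
    01-≡ (inj₂ p) _        f g = ≡.trans p (≡.sym (f p))

    01-* : ∀ {x y} → x ≡ 0 ⊎ x ≡ 1 → y ≡ 0 ⊎ y ≡ 1 → x * y ≡ 0 ⊎ (x ≡ 1 × y ≡ 1)
    01-* (inj₁ ≡.refl) _             = inj₁ ≡.refl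
    01-* (inj₂ ≡.refl) (inj₁ ≡.refl) = inj₁ ≡.refl
    01-* (inj₂ ≡.refl) (inj₂ ≡.refl) = inj₂ (≡.refl , ≡.refl)

    sum-zeros : ∀ (f : Index → ℕ) xs → All (λ b → f b ≡ 0) xs → sum (map f xs) ≡ 0
    sum-zeros f []       _        = ≡.refl
    sum-zeros f (x ∷ xs) (p ∷ ps) = ≡.cong₂ _+_ p (sum-zeros f xs ps)

    sum-single : ∀ (f : Index → ℕ) {m} → (∀ b → m ≢ b → f b ≡ 0) →
                 ∀ xs → m ∈ xs → Unique xs → sum (map f xs) ≡ f m
    sum-single f zeros (x ∷ xs) (here ≡.refl) (x∉ ∷ _) =
      ≡.trans (≡.cong (f x +_) (sum-zeros f xs (All.map (zeros _) x∉))) (+-identityʳ (f x))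
    sum-single f {m} zeros (x ∷ xs) (there m∈) (x∉ ∷ u) =
      ≡.trans (≡.cong (_+ sum (map f xs)) (zeros x λ m≡x → All.lookup x∉ m∈ (≡.sym m≡x)))
              (sum-single f zeros xs m∈ u)

    -- A product of 0-1 matrices when there is at most one path from A to C.
    ⊗-single : ∀ {M N : Matrix Index} → Is01 finiteIndex M → Is01 finiteIndex N → ∀ A C mid →
      (∀ B → M A B ≡ 1 → N B C ≡ 1 → mid ≡ B) →
      _⊗_ finiteIndex M N A C ≡ M A mid * N mid C
    ⊗-single {M} {N} M01 N01 A C mid single = sum-single (λ B → M A B * N B C)
      (λ B mid≢B → [ (λ z → z) , (λ (p , q) → contradiction (single B p q) mid≢B) ]′
                     (01-* (M01 A B) (N01 B C)))
      (elements finiteIndex) (complete finiteIndex mid) (unique finiteIndex)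

  module _ {σ τ : K → K} (στ : ∀ k → σ (τ k) ≡ τ (σ k)) {M N : Matrix Index}
           (M01 : Is01 finiteIndex M) (N01 : Is01 finiteIndex N)
           (M-decides : Decides M (WhiteStep σ)) (N-decides : Decides N (BlackStep τ)) where

    private
      MN : ∀ A C → _⊗_ finiteIndex M N A C ≡
                   M A (proj₁ C , proj₁ (proj₂ A) , σ (proj₂ (proj₂ A))) *
                   N (proj₁ C , proj₁ (proj₂ A) , σ (proj₂ (proj₂ A))) C
      MN A C = ⊗-single M01 N01 A C _ λ B p q → single B (proj₁ (M-decides A B) p) (proj₁ (N-decides B C) q)
        where
        single : ∀ B → WhiteStep σ A B → BlackStep τ B C → _ ≡ B
        single B (_ , ≡.refl , ≡.refl) (≡.refl , _ , _) = ≡.refl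

      NM : ∀ A C → _⊗_ finiteIndex N M A C ≡
                   N A (proj₁ A , proj₁ (proj₂ C) , τ (proj₂ (proj₂ A))) *
                   M (proj₁ A , proj₁ (proj₂ C) , τ (proj₂ (proj₂ A))) C
      NM A C = ⊗-single N01 M01 A C _ λ B p q → single B (proj₁ (N-decides A B) p) (proj₁ (M-decides B C) q)
        where
        single : ∀ B → BlackStep τ A B → WhiteStep σ B C → _ ≡ B
        single B (≡.refl , _ , ≡.refl) (_ , ≡.refl , _) = ≡.refl

      01-*′ : ∀ {x y} → x ≡ 0 ⊎ x ≡ 1 → y ≡ 0 ⊎ y ≡ 1 → x * y ≡ 0 ⊎ x * y ≡ 1
      01-*′ p q = Sum.map₂ (λ (e , e′) → ≡.cong₂ _*_ e e′) (01-* p q)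

    isAdmissible : Admissible finiteIndex M N
    isAdmissible = record
      { is01₁   = M01
      ; is01₂   = N01
      ; commute = λ A C → ≡.trans (MN A C) (≡.trans
          (01-≡ (01-*′ (M01 _ _) (N01 _ _)) (01-*′ (N01 _ _) (M01 _ _))
            (λ e → let (p , _ , _) = proj₁ (M-decides _ _) (m*n≡1⇒m≡1 (M _ _) (N _ _) e)
                       (_ , q , k) = proj₁ (N-decides _ _) (m*n≡1⇒n≡1 (M _ _) (N _ _) e)
                   in ≡.cong₂ _*_ (proj₂ (N-decides _ _) (≡.refl , q , ≡.refl))
                        (proj₂ (M-decides _ _) (p , ≡.refl , ≡.trans k (≡.sym (στ _)))))
            (λ e → let (_ , q , _) = proj₁ (N-decides _ _) (m*n≡1⇒m≡1 (N _ _) (M _ _) e)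
                       (p , _ , k) = proj₁ (M-decides _ _) (m*n≡1⇒n≡1 (N _ _) (M _ _) e)
                   in ≡.cong₂ _*_ (proj₂ (M-decides _ _) (p , ≡.refl , ≡.refl))
                        (proj₂ (N-decides _ _) (≡.refl , q , ≡.trans k (στ _)))))
          (≡.sym (NM A C)))
      ; is01₁₂  = λ A C → Sum.map (≡.trans (MN A C)) (≡.trans (MN A C)) (01-*′ (M01 _ _) (N01 _ _))
      }

    -- Grids of any size starting at any polygon.
    module _ (2≤α : 2 ≤ α) (2≤β : 2 ≤ β) where

      wander : Index → ℕ → ℕ → Index
      wander (i , j , k) p q = iter (other 2≤α) p i , iter (other 2≤β) q j , iter σ p (iter τ q k)

      wander-isGrid : ∀ A m n → Grids.IsGrid M N m n (wander A)
      wander-isGrid (i , j , k) m n = Grids.grid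
        (λ p q _ _ → proj₂ (M-decides _ _) (other-≢ 2≤α _ , ≡.refl , ≡.refl))
        (λ p q _ _ → proj₂ (N-decides _ _) (≡.refl , other-≢ 2≤β _ , iter-τ p (iter τ q k)))
        where
        iter-τ : ∀ p k → iter σ p (τ k) ≡ τ (iter σ p k)
        iter-τ zero    k = ≡.refl
        iter-τ (suc p) k = ≡.trans (≡.cong σ (iter-τ p k)) (στ (iter σ p k))

admissible-swap : ∀ {S : Set} {fin : Finite S} {M N : Matrix S} → Admissible fin M N → Admissible fin N M
admissible-swap a = record
  { is01₁   = is01₂
  ; is01₂   = is01₁
  ; commute = λ x y → ≡.sym (commute x y)
  ; is01₁₂  = λ x y → Sum.map (≡.trans (≡.sym (commute x y))) (≡.trans (≡.sym (commute x y))) (is01₁₂ x y)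
  }
  where open Admissible a

-- The elements of {u_i^r, ū_i^r : i < n, r < t}, the last component telling
-- whether there is a bar. Indices and superscripts start from 0.

Letter : ℕ → ℕ → Set
Letter n t = Fin n × Fin t × Bool

plain barred : ∀ {n t} → Fin n → Fin t → Letter n t
plain  i r = i , r , false
barred i r = i , r , true

bar : ∀ {n t} → Letter n t → Letter n t
bar (i , r , b) = i , r , not b

_≟ᴸ_ : ∀ {n t} → DecidableEquality (Letter n t)
_≟ᴸ_ = ≡-dec Fin._≟_ (≡-dec Fin._≟_ Bool._≟_)

-- The pointed tiles are pairwise distinct as tuples, so that 𝒮(κ) may be
-- identified with the set of their indices.

module Tiles (α β : ℕ) where
  open ProductLike {α} {β} (finiteFin 4)

  Tile : Set
  Tile = Index

  tuple : Tile → Letter α 2 × Letter β 2 × Letter α 2 × Letter β 2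
  tuple (i , j , 0F) = plain  i 0F , plain  j 0F , plain  i 1F , plain  j 1F
  tuple (i , j , 1F) = barred i 0F , barred j 1F , barred i 1F , barred j 0F
  tuple (i , j , 2F) = plain  i 1F , plain  j 1F , plain  i 0F , plain  j 0F
  tuple (i , j , 3F) = barred i 1F , barred j 0F , barred i 0F , barred j 1F

  Adjacent₁ Adjacent₂ : Tile → Tile → Set
  Adjacent₁ A B = let (x₁ , y₁ , x₂ , y₂) = tuple A
                      (x₃ , y₃ , x₄ , y₄) = tuple B
                  in y₁ ≡ bar y₄ × x₁ ≢ bar x₃
  Adjacent₂ A B = let (x₁ , y₁ , x₂ , y₂) = tuple A
                      (x₃ , y₃ , x₄ , y₄) = tuple B
                  in x₂ ≡ bar x₃ × y₁ ≢ bar y₃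

  adjacent₁? : ∀ A B → Dec (Adjacent₁ A B)
  adjacent₁? A B = (_ ≟ᴸ _) ×-dec ¬? (_ ≟ᴸ _)

  adjacent₂? : ∀ A B → Dec (Adjacent₂ A B)
  adjacent₂? A B = (_ ≟ᴸ _) ×-dec ¬? (_ ≟ᴸ _)

  M₁ M₂ : Matrix Tile
  M₁ A B = 𝟙 (adjacent₁? A B)
  M₂ A B = 𝟙 (adjacent₂? A B)

  σ₁ σ₂ : Fin 4 → Fin 4
  σ₁ 0F = 1F
  σ₁ 1F = 0F
  σ₁ 2F = 3F
  σ₁ 3F = 2F
  σ₂ 0F = 3F
  σ₂ 1F = 2F
  σ₂ 2F = 1F
  σ₂ 3F = 0F

  σ₁σ₂ : ∀ k → σ₁ (σ₂ k) ≡ σ₂ (σ₁ k)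
  σ₁σ₂ 0F = ≡.refl
  σ₁σ₂ 1F = ≡.refl
  σ₁σ₂ 2F = ≡.refl
  σ₁σ₂ 3F = ≡.refl

  M₁-decides : Decides M₁ (WhiteStep σ₁)
  M₁-decides A B = (λ e → to A B (𝟙-true (adjacent₁? A B) e)) , (λ w → true-𝟙 (adjacent₁? A B) (from A B w))
    where
    to : ∀ A B → Adjacent₁ A B → WhiteStep σ₁ A B
    to (i , j , 0F) (_ , _ , 1F) (≡.refl , x) = (λ { ≡.refl → x ≡.refl }) , ≡.refl , ≡.refl
    to (i , j , 1F) (_ , _ , 0F) (≡.refl , x) = (λ { ≡.refl → x ≡.refl }) , ≡.refl , ≡.refl
    to (i , j , 2F) (_ , _ , 3F) (≡.refl , x) = (λ { ≡.refl → x ≡.refl }) , ≡.refl , ≡.refl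
    to (i , j , 3F) (_ , _ , 2F) (≡.refl , x) = (λ { ≡.refl → x ≡.refl }) , ≡.refl , ≡.refl
    to (i , j , 0F) (_ , _ , 0F) (() , _)
    to (i , j , 0F) (_ , _ , 2F) (() , _)
    to (i , j , 0F) (_ , _ , 3F) (() , _)
    to (i , j , 1F) (_ , _ , 1F) (() , _)
    to (i , j , 1F) (_ , _ , 2F) (() , _)
    to (i , j , 1F) (_ , _ , 3F) (() , _)
    to (i , j , 2F) (_ , _ , 0F) (() , _)
    to (i , j , 2F) (_ , _ , 1F) (() , _)
    to (i , j , 2F) (_ , _ , 2F) (() , _)
    to (i , j , 3F) (_ , _ , 0F) (() , _)
    to (i , j , 3F) (_ , _ , 1F) (() , _)
    to (i , j , 3F) (_ , _ , 3F) (() , _)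

    from : ∀ A B → WhiteStep σ₁ A B → Adjacent₁ A B
    from (i , j , 0F) B (i≢ , ≡.refl , ≡.refl) = ≡.refl , λ e → i≢ (≡.cong proj₁ e)
    from (i , j , 1F) B (i≢ , ≡.refl , ≡.refl) = ≡.refl , λ e → i≢ (≡.cong proj₁ e)
    from (i , j , 2F) B (i≢ , ≡.refl , ≡.refl) = ≡.refl , λ e → i≢ (≡.cong proj₁ e)
    from (i , j , 3F) B (i≢ , ≡.refl , ≡.refl) = ≡.refl , λ e → i≢ (≡.cong proj₁ e)

  M₂-decides : Decides M₂ (BlackStep σ₂)
  M₂-decides A B = (λ e → to A B (𝟙-true (adjacent₂? A B) e)) , (λ w → true-𝟙 (adjacent₂? A B) (from A B w))
    where
    to : ∀ A B → Adjacent₂ A B → BlackStep σ₂ A B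
    to (i , j , 0F) (_ , _ , 3F) (≡.refl , y) = ≡.refl , (λ { ≡.refl → y ≡.refl }) , ≡.refl
    to (i , j , 1F) (_ , _ , 2F) (≡.refl , y) = ≡.refl , (λ { ≡.refl → y ≡.refl }) , ≡.refl
    to (i , j , 2F) (_ , _ , 1F) (≡.refl , y) = ≡.refl , (λ { ≡.refl → y ≡.refl }) , ≡.refl
    to (i , j , 3F) (_ , _ , 0F) (≡.refl , y) = ≡.refl , (λ { ≡.refl → y ≡.refl }) , ≡.refl
    to (i , j , 0F) (_ , _ , 0F) (() , _)
    to (i , j , 0F) (_ , _ , 1F) (() , _)
    to (i , j , 0F) (_ , _ , 2F) (() , _)
    to (i , j , 1F) (_ , _ , 0F) (() , _)
    to (i , j , 1F) (_ , _ , 1F) (() , _)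
    to (i , j , 1F) (_ , _ , 3F) (() , _)
    to (i , j , 2F) (_ , _ , 0F) (() , _)
    to (i , j , 2F) (_ , _ , 2F) (() , _)
    to (i , j , 2F) (_ , _ , 3F) (() , _)
    to (i , j , 3F) (_ , _ , 1F) (() , _)
    to (i , j , 3F) (_ , _ , 2F) (() , _)
    to (i , j , 3F) (_ , _ , 3F) (() , _)

    from : ∀ A B → BlackStep σ₂ A B → Adjacent₂ A B
    from (i , j , 0F) B (≡.refl , j≢ , ≡.refl) = ≡.refl , λ e → j≢ (≡.cong proj₁ e)
    from (i , j , 1F) B (≡.refl , j≢ , ≡.refl) = ≡.refl , λ e → j≢ (≡.cong proj₁ e)
    from (i , j , 2F) B (≡.refl , j≢ , ≡.refl) = ≡.refl , λ e → j≢ (≡.cong proj₁ e)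
    from (i , j , 3F) B (≡.refl , j≢ , ≡.refl) = ≡.refl , λ e → j≢ (≡.cong proj₁ e)

  admissible : Admissible finiteIndex M₁ M₂
  admissible = isAdmissible σ₁σ₂ (λ A B → 𝟙-01 (adjacent₁? A B)) (λ A B → 𝟙-01 (adjacent₂? A B))
                            M₁-decides M₂-decides

  tileGraph : RankGraph 2
  tileGraph = GridGraph.gridGraph finiteIndex admissible

  tileGraph-rowFinite : RowFinite tileGraph
  tileGraph-rowFinite = rowFinite finiteIndex admissible

  tileGraph-noSources : 2 ≤ α → 2 ≤ β → NoSources tileGraph
  tileGraph-noSources 2≤α 2≤β (m ∷ n ∷ []) A =
      GridGraph.morphism (wander-isGrid σ₁σ₂ (λ A B → 𝟙-01 (adjacent₁? A B))
        (λ A B → 𝟙-01 (adjacent₂? A B)) M₁-decides M₂-decides 2≤α 2≤β A m n)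
    , ≡.refl , ≡.refl

-- Likewise for the pointed 2t-gons: (i , j , r , false) and (i , j , r , true)
-- are the indices of [u_i^r, v_j^r, u_i^{r+1}, …] and [ū_i^r, v̄_j^{r-1}, ū_i^{r-1}, …].
-- The entries x_k, y_k are numbered from k = 0, and arithmetic on the indices
-- k and on superscripts is modulo t, with t ∸ k for -k.

module Polygons (α β t : ℕ) .{{_ : NonZero t}} where
  open ProductLike {α} {β} (finiteFin t ×-finite finiteBool)

  Polygon : Set
  Polygon = Index

  idx : ℕ → Fin t
  idx n = n mod t

  shift : Fin t → ℕ → Fin t
  shift r n = idx (toℕ r + n)

  x : Polygon → Fin t → Letter α t
  x (i , j , r , false) k = plain  i (shift r (toℕ k))
  x (i , j , r , true)  k = barred i (shift r (t ∸ toℕ k))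

  y : Polygon → Fin t → Letter β t
  y (i , j , r , false) k = plain  j (shift r (toℕ k))
  y (i , j , r , true)  k = barred j (shift r (t ∸ suc (toℕ k)))

  record V-Adjacent (A B : Polygon) : Set where
    field
      x′    : Fin t → Letter α t
      x′≢x  : ∀ k → x′ k ≢ x A k
      x-B   : ∀ k → x B k ≡ bar (x′ (idx (t ∸ toℕ k)))
      y-B   : ∀ k → y B k ≡ bar (y A (idx (t ∸ suc (toℕ k))))

  record U-Adjacent (A B : Polygon) : Set where
    field
      y′    : Fin t → Letter β t
      y′≢y  : ∀ k → y′ k ≢ y A k
      x-B   : ∀ k → x B k ≡ bar (x A (idx (t / 2 + (t ∸ toℕ k))))
      y-B   : ∀ k → y B k ≡ bar (y′ (idx (t / 2 + (t ∸ suc (toℕ k)))))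

  toℕ-idx : ∀ n → toℕ (idx n) ≡ n % t
  toℕ-idx n = Fin.toℕ-fromℕ< (m%n<n n t)

  infix 4 _≡ₜ_
  _≡ₜ_ : ℕ → ℕ → Set
  m ≡ₜ n = m % t ≡ n % t

  +-congₜ : ∀ {a b c d} → a ≡ₜ b → c ≡ₜ d → a + c ≡ₜ b + d
  +-congₜ {a} {b} {c} {d} p q = ≡.trans (%-distribˡ-+ a c t)
    (≡.trans (≡.cong₂ (λ m n → (m + n) % t) p q) (≡.sym (%-distribˡ-+ b d t)))

  +-t : ∀ a → a + t ≡ₜ a
  +-t a = ≡.trans (≡.cong (λ n → (a + n) % t) (≡.sym (*-identityˡ t))) ([m+kn]%n≡m%n a 1 t)

  -- Modulo t, t ∸ n % t is -n and t ∸ suc (n % t) is -1-n.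
  neg : ∀ n → (t ∸ n % t) + n ≡ₜ 0
  neg n = ≡.trans (≡.cong (_% t) (begin
      (t ∸ n % t) + n                        ≡⟨ ≡.cong ((t ∸ n % t) +_) (m≡m%n+[m/n]*n n t) ⟩
      (t ∸ n % t) + (n % t + (n / t) * t)    ≡⟨ +-assoc (t ∸ n % t) (n % t) _ ⟨
      ((t ∸ n % t) + n % t) + (n / t) * t    ≡⟨ ≡.cong (_+ (n / t) * t) (m∸n+n≡m (m%n≤n n t)) ⟩
      suc (n / t) * t                        ∎))
    ([m+kn]%n≡m%n 0 (suc (n / t)) t)
    where open ≡.≡-Reasoning

  neg-suc : ∀ n → (t ∸ suc (n % t)) + suc n ≡ₜ 0
  neg-suc n = ≡.trans (≡.cong (_% t) (begin
      (t ∸ suc (n % t)) + suc n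
        ≡⟨ ≡.cong (λ m → (t ∸ suc (n % t)) + suc m) (m≡m%n+[m/n]*n n t) ⟩
      (t ∸ suc (n % t)) + (suc (n % t) + (n / t) * t)
        ≡⟨ +-assoc (t ∸ suc (n % t)) (suc (n % t)) _ ⟨
      ((t ∸ suc (n % t)) + suc (n % t)) + (n / t) * t
        ≡⟨ ≡.cong (_+ (n / t) * t) (m∸n+n≡m (m%n<n n t)) ⟩
      suc (n / t) * t ∎))
    ([m+kn]%n≡m%n 0 (suc (n / t)) t)
    where open ≡.≡-Reasoning

  +-cancelʳₜ : ∀ a b c → a + c ≡ₜ b + c → a ≡ₜ b
  +-cancelʳₜ a b c e = ≡.trans (≡.sym (drop a)) (≡.trans
    (+-congₜ {c = t ∸ c % t} {d = t ∸ c % t} e ≡.refl) (drop b))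
    where
    drop : ∀ a → (a + c) + (t ∸ c % t) ≡ₜ a
    drop a = ≡.trans (≡.cong (_% t) (≡.trans (+-assoc a c _) (≡.cong (a +_) (+-comm c _))))
      (≡.trans (+-congₜ {a = a} {b = a} ≡.refl (neg c)) (≡.cong (_% t) (+-identityʳ a)))

  idx-cong : ∀ {m n} → m ≡ₜ n → idx m ≡ idx n
  idx-cong {m} {n} e = toℕ-injective (≡.trans (toℕ-idx m) (≡.trans e (≡.sym (toℕ-idx n))))

  idx-injective : ∀ {m n} → idx m ≡ idx n → m ≡ₜ n
  idx-injective {m} {n} e = ≡.trans (≡.sym (toℕ-idx m)) (≡.trans (≡.cong toℕ e) (toℕ-idx n))

  idx-toℕ : ∀ r → idx (toℕ r) ≡ r
  idx-toℕ r = toℕ-injective (≡.trans (toℕ-idx (toℕ r)) (m<n⇒m%n≡m (Fin.toℕ<n r)))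

  toℕ-idxₜ : ∀ n → toℕ (idx n) ≡ₜ n
  toℕ-idxₜ n = ≡.trans (≡.cong (_% t) (toℕ-idx n)) (m%n%n≡m%n n t)

  shift-cong : ∀ r {m n} → m ≡ₜ n → shift r m ≡ shift r n
  shift-cong r e = idx-cong (+-congₜ {a = toℕ r} ≡.refl e)

  shift-shift : ∀ r m n → shift (shift r m) n ≡ shift r (m + n)
  shift-shift r m n = idx-cong (≡.trans (+-congₜ {c = n} (toℕ-idxₜ (toℕ r + m)) ≡.refl)
    (≡.cong (_% t) (+-assoc (toℕ r) m n)))

  shift-cancel : ∀ r r′ n → shift r n ≡ shift r′ n → r ≡ r′
  shift-cancel r r′ n e = ≡.trans (≡.sym (idx-toℕ r)) (≡.trans
    (idx-cong (+-cancelʳₜ (toℕ r) (toℕ r′) n (idx-injective e))) (idx-toℕ r′))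

  -- The effect of a step on (r , b), with h = t / 2 for U-adjacency and h = 0
  -- for V-adjacency.
  turn : ℕ → Fin t × Bool → Fin t × Bool
  turn h (r , false) = shift r h , true
  turn h (r , true)  = shift r (t ∸ h) , false

  x-label y-label : Fin t × Bool → Fin t → Fin t × Bool
  x-label (r , false) k = shift r (toℕ k) , false
  x-label (r , true)  k = shift r (t ∸ toℕ k) , true
  y-label (r , false) k = shift r (toℕ k) , false
  y-label (r , true)  k = shift r (t ∸ suc (toℕ k)) , true

  bar-label : Fin t × Bool → Fin t × Bool
  bar-label (r , b) = r , not b

  x≡ : ∀ i j c k → x (i , j , c) k ≡ (i , x-label c k)
  x≡ i j (r , false) k = ≡.refl
  x≡ i j (r , true)  k = ≡.refl

  y≡ : ∀ i j c k → y (i , j , c) k ≡ (j , y-label c k)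
  y≡ i j (r , false) k = ≡.refl
  y≡ i j (r , true)  k = ≡.refl

  module Turn (h : ℕ) (h≤t : h ≤ t) where

    private
      open import Algebra.Properties.CommutativeSemigroup +-commutativeSemigroup using (interchange)

      t+t : t + t ≡ₜ 0
      t+t = ≡.trans (+-t t) (+-t 0)

      -- (t ∸ h) + k = -(h + (t ∸ k))
      index-x : ∀ k → k ≤ t → (t ∸ h) + k ≡ₜ t ∸ (h + (t ∸ k)) % t
      index-x k k≤t = +-cancelʳₜ _ _ n (≡.trans (≡.trans (≡.cong (_% t) (begin
          ((t ∸ h) + k) + (h + (t ∸ k))   ≡⟨ interchange (t ∸ h) k h (t ∸ k) ⟩
          ((t ∸ h) + h) + (k + (t ∸ k))   ≡⟨ ≡.cong₂ _+_ (m∸n+n≡m h≤t) (m+[n∸m]≡n k≤t) ⟩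
          t + t                           ∎)) t+t) (≡.sym (neg n)))
        where
        n = h + (t ∸ k)
        open ≡.≡-Reasoning

      index-y : ∀ k → k < t → (t ∸ h) + k ≡ₜ t ∸ suc ((h + (t ∸ suc k)) % t)
      index-y k k<t = +-cancelʳₜ _ _ (suc n) (≡.trans (≡.trans (≡.cong (_% t) (begin
          ((t ∸ h) + k) + suc (h + (t ∸ suc k))
            ≡⟨ ≡.cong (((t ∸ h) + k) +_) (≡.trans (≡.sym (+-suc h _)) (≡.cong (h +_) (suc-∸-suc k<t))) ⟩
          ((t ∸ h) + k) + (h + (t ∸ k))   ≡⟨ interchange (t ∸ h) k h (t ∸ k) ⟩
          ((t ∸ h) + h) + (k + (t ∸ k))   ≡⟨ ≡.cong₂ _+_ (m∸n+n≡m h≤t) (m+[n∸m]≡n (<⇒≤ k<t)) ⟩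
          t + t                           ∎)) t+t) (≡.sym (neg-suc n)))
        where
        n = h + (t ∸ suc k)
        open ≡.≡-Reasoning
        open Grids {ℕ} using (suc-∸-suc)

    x-turn : ∀ c k → x-label (turn h c) k ≡ bar-label (x-label c (idx (h + (t ∸ toℕ k))))
    x-turn (r , false) k = ≡.cong (_, true) (≡.trans (shift-shift r h (t ∸ toℕ k))
      (shift-cong r (≡.sym (toℕ-idxₜ (h + (t ∸ toℕ k))))))
    x-turn (r , true)  k = ≡.cong (_, false) (≡.trans (shift-shift r (t ∸ h) (toℕ k))
      (shift-cong r (≡.trans (index-x (toℕ k) (<⇒≤ (Fin.toℕ<n k)))
        (≡.cong (λ n → (t ∸ n) % t) (≡.sym (toℕ-idx (h + (t ∸ toℕ k))))))))

    y-turn : ∀ c k → y-label (turn h c) k ≡ bar-label (y-label c (idx (h + (t ∸ suc (toℕ k)))))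
    y-turn (r , false) k = ≡.cong (_, true) (≡.trans (shift-shift r h (t ∸ suc (toℕ k)))
      (shift-cong r (≡.sym (toℕ-idxₜ (h + (t ∸ suc (toℕ k)))))))
    y-turn (r , true)  k = ≡.cong (_, false) (≡.trans (shift-shift r (t ∸ h) (toℕ k))
      (shift-cong r (≡.trans (index-y (toℕ k) (Fin.toℕ<n k))
        (≡.cong (λ n → (t ∸ suc n) % t) (≡.sym (toℕ-idx (h + (t ∸ suc (toℕ k)))))))))

  x-label-injective : ∀ c c′ k → x-label c k ≡ x-label c′ k → c ≡ c′
  x-label-injective (r , false) (r′ , false) k e =
    ≡.cong (_, false) (shift-cancel r r′ _ (≡.cong proj₁ e))
  x-label-injective (r , true) (r′ , true) k e =
    ≡.cong (_, true) (shift-cancel r r′ _ (≡.cong proj₁ e))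

  y-label-injective : ∀ c c′ k → y-label c k ≡ y-label c′ k → c ≡ c′
  y-label-injective (r , false) (r′ , false) k e =
    ≡.cong (_, false) (shift-cancel r r′ _ (≡.cong proj₁ e))
  y-label-injective (r , true) (r′ , true) k e =
    ≡.cong (_, true) (shift-cancel r r′ _ (≡.cong proj₁ e))

  bar-bar : ∀ {n} (l : Letter n t) → bar (bar l) ≡ l
  bar-bar (i , r , b) = ≡.cong (λ b → i , r , b) (Bool.not-involutive b)

  private
    module Turn₀ = Turn 0 z≤n
    module Turnₕ = Turn (t / 2) (m/n≤m t 2)

  V-step : ∀ {A B} → V-Adjacent A B → WhiteStep (turn 0) A B
  V-step {i , j , c} {i′ , j′ , c′} adj = i≢i′ , j≡j′ , c′≡
    where
    open V-Adjacent adj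
    y₀ : (j′ , y-label c′ (idx 0)) ≡ (j , y-label (turn 0 c) (idx 0))
    y₀ = ≡.trans (≡.sym (y≡ i′ j′ c′ (idx 0))) (≡.trans (y-B (idx 0)) (≡.trans
      (≡.cong bar (y≡ i j c _)) (≡.cong (j ,_) (≡.sym (Turn₀.y-turn c (idx 0))))))

    j≡j′ : j ≡ j′
    j≡j′ = ≡.sym (≡.cong proj₁ y₀)

    c′≡ : c′ ≡ turn 0 c
    c′≡ = y-label-injective c′ (turn 0 c) (idx 0) (≡.cong proj₂ y₀)

    i≢i′ : i ≢ i′
    i≢i′ i≡i′ = x′≢x m (begin
        x′ m                              ≡⟨ bar-bar (x′ m) ⟨
        bar (bar (x′ m))                  ≡⟨ ≡.cong bar (x-B (idx 0)) ⟨
        bar (x (i′ , j′ , c′) (idx 0))    ≡⟨ ≡.cong bar (x≡ i′ j′ c′ (idx 0)) ⟩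
        bar (i′ , x-label c′ (idx 0))     ≡⟨ ≡.cong₂ (λ i c → bar (i , x-label c (idx 0))) (≡.sym i≡i′) c′≡ ⟩
        bar (i , x-label (turn 0 c) (idx 0)) ≡⟨ ≡.cong (λ l → bar (i , l)) (Turn₀.x-turn c (idx 0)) ⟩
        bar (bar (i , x-label c m))       ≡⟨ bar-bar _ ⟩
        (i , x-label c m)                 ≡⟨ x≡ i j c m ⟨
        x (i , j , c) m                   ∎)
      where
      m = idx (t ∸ toℕ (idx 0))
      open ≡.≡-Reasoning

  step-V : ∀ {A B} → WhiteStep (turn 0) A B → V-Adjacent A B
  step-V {i , j , c} {i′ , .j , .(turn 0 c)} (i≢i′ , ≡.refl , ≡.refl) = record
    { x′   = λ k → i′ , x-label c k
    ; x′≢x = λ k e → i≢i′ (≡.sym (≡.cong proj₁ (≡.trans e (x≡ i j c k))))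
    ; x-B  = λ k → ≡.trans (x≡ i′ j (turn 0 c) k) (≡.cong (i′ ,_) (Turn₀.x-turn c k))
    ; y-B  = λ k → ≡.trans (y≡ i′ j (turn 0 c) k) (≡.trans
        (≡.cong (j ,_) (Turn₀.y-turn c k)) (≡.cong bar (≡.sym (y≡ i j c _))))
    }

  U-step : ∀ {A B} → U-Adjacent A B → BlackStep (turn (t / 2)) A B
  U-step {i , j , c} {i′ , j′ , c′} adj = i≡i′ , j≢j′ , c′≡
    where
    open U-Adjacent adj
    h = t / 2
    x₀ : (i′ , x-label c′ (idx 0)) ≡ (i , x-label (turn h c) (idx 0))
    x₀ = ≡.trans (≡.sym (x≡ i′ j′ c′ (idx 0))) (≡.trans (x-B (idx 0)) (≡.trans
      (≡.cong bar (x≡ i j c _)) (≡.cong (i ,_) (≡.sym (Turnₕ.x-turn c (idx 0))))))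

    i≡i′ : i ≡ i′
    i≡i′ = ≡.sym (≡.cong proj₁ x₀)

    c′≡ : c′ ≡ turn h c
    c′≡ = x-label-injective c′ (turn h c) (idx 0) (≡.cong proj₂ x₀)

    j≢j′ : j ≢ j′
    j≢j′ j≡j′ = y′≢y m (begin
        y′ m                              ≡⟨ bar-bar (y′ m) ⟨
        bar (bar (y′ m))                  ≡⟨ ≡.cong bar (y-B (idx 0)) ⟨
        bar (y (i′ , j′ , c′) (idx 0))    ≡⟨ ≡.cong bar (y≡ i′ j′ c′ (idx 0)) ⟩
        bar (j′ , y-label c′ (idx 0))     ≡⟨ ≡.cong₂ (λ j c → bar (j , y-label c (idx 0))) (≡.sym j≡j′) c′≡ ⟩
        bar (j , y-label (turn h c) (idx 0)) ≡⟨ ≡.cong (λ l → bar (j , l)) (Turnₕ.y-turn c (idx 0)) ⟩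
        bar (bar (j , y-label c m))       ≡⟨ bar-bar _ ⟩
        (j , y-label c m)                 ≡⟨ y≡ i j c m ⟨
        y (i , j , c) m                   ∎)
      where
      m = idx (h + (t ∸ suc (toℕ (idx 0))))
      open ≡.≡-Reasoning

  step-U : ∀ {A B} → BlackStep (turn (t / 2)) A B → U-Adjacent A B
  step-U {i , j , c} {.i , j′ , .(turn (t / 2) c)} (≡.refl , j≢j′ , ≡.refl) = record
    { y′   = λ k → j′ , y-label c k
    ; y′≢y = λ k e → j≢j′ (≡.sym (≡.cong proj₁ (≡.trans e (y≡ i j c k))))
    ; x-B  = λ k → ≡.trans (x≡ i j′ (turn (t / 2) c) k) (≡.trans
        (≡.cong (i ,_) (Turnₕ.x-turn c k)) (≡.cong bar (≡.sym (x≡ i j c _))))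
    ; y-B  = λ k → ≡.trans (y≡ i j′ (turn (t / 2) c) k) (≡.cong (j′ ,_) (Turnₕ.y-turn c k))
    }

  _≟ᴷ_ : DecidableEquality (Fin t × Bool)
  _≟ᴷ_ = ≡-dec Fin._≟_ Bool._≟_

  V-adjacent? : ∀ A B → Dec (V-Adjacent A B)
  V-adjacent? A@(i , j , c) B@(i′ , j′ , c′) = map′ step-V V-step
    (¬? (i Fin.≟ i′) ×-dec (j Fin.≟ j′) ×-dec (c′ ≟ᴷ turn 0 c))

  U-adjacent? : ∀ A B → Dec (U-Adjacent A B)
  U-adjacent? A@(i , j , c) B@(i′ , j′ , c′) = map′ step-U U-step
    ((i Fin.≟ i′) ×-dec ¬? (j Fin.≟ j′) ×-dec (c′ ≟ᴷ turn (t / 2) c))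

  M-U M-V : Matrix Polygon
  M-U A B = 𝟙 (U-adjacent? A B)
  M-V A B = 𝟙 (V-adjacent? A B)

  V-decides : Decides M-V (WhiteStep (turn 0))
  V-decides A B = (λ e → V-step (𝟙-true (V-adjacent? A B) e))
                , (λ w → true-𝟙 (V-adjacent? A B) (step-V w))

  U-decides : Decides M-U (BlackStep (turn (t / 2)))
  U-decides A B = (λ e → U-step (𝟙-true (U-adjacent? A B) e))
                , (λ w → true-𝟙 (U-adjacent? A B) (step-U w))

  module _ (2∣t : 2 ∣ t) where
    private
      h = t / 2

      h+h≡t : h + h ≡ t
      h+h≡t = ≡.trans (≡.cong (h +_) (≡.sym (+-identityʳ h))) (m*[n/m]≡n 2∣t)

      half : h ≡ₜ t ∸ h
      half = ≡.cong (_% t) (≡.trans (≡.sym (m+n∸n≡m h h)) (≡.cong (_∸ h) h+h≡t))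

    turn-turn : ∀ c → turn 0 (turn h c) ≡ turn h (turn 0 c)
    turn-turn (r , false) = ≡.cong (_, false) (≡.trans (shift-shift r h t) (≡.trans
      (shift-cong r (≡.trans (+-t h) half)) (≡.sym (shift-shift r 0 (t ∸ h)))))
    turn-turn (r , true)  = ≡.cong (_, true) (≡.trans (shift-shift r (t ∸ h) 0) (≡.trans
      (shift-cong r (≡.trans (≡.cong (_% t) (+-identityʳ (t ∸ h)))
        (≡.trans (≡.sym half) (≡.trans (≡.sym (+-t h)) (≡.cong (_% t) (+-comm h t))))))
      (≡.sym (shift-shift r t h))))

    admissible : Admissible finiteIndex M-U M-V
    admissible = admissible-swap (isAdmissible turn-turn
      (λ A B → 𝟙-01 (V-adjacent? A B)) (λ A B → 𝟙-01 (U-adjacent? A B)) V-decides U-decides)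

    polygonGraph : RankGraph 2
    polygonGraph = GridGraph.gridGraph finiteIndex admissible

    polygonGraph-rowFinite : RowFinite polygonGraph
    polygonGraph-rowFinite = rowFinite finiteIndex admissible

    polygonGraph-noSources : 2 ≤ α → 2 ≤ β → NoSources polygonGraph
    polygonGraph-noSources 2≤α 2≤β (m ∷ n ∷ []) A =
        GridGraph.morphism (Grids.transpose (wander-isGrid turn-turn (λ A B → 𝟙-01 (V-adjacent? A B))
          (λ A B → 𝟙-01 (U-adjacent? A B)) V-decides U-decides 2≤α 2≤β A n m))
      , ≡.refl , ≡.refl

-- Λ(κ) and Λ_t(κ) for the complete bipartite graph κ on α white and β black
-- vertices.

Λ : (α β : ℕ) → RankGraph 2
Λ α β = Tiles.tileGraph α β

Λₜ : (α β t : ℕ) → 2 ≤ t → 2 ∣ t → RankGraph 2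
Λₜ α β t 2≤t 2∣t = Polygons.polygonGraph α β t {{>-nonZero (<⇒≤ 2≤t)}} 2∣t

-- A step of a pointed 2t-gon changes one of the vertices i, j and acts on the
-- remaining index (r , b) by one of two commuting involutions, whose orbits
-- have four elements and are permuted as in the case of pointed tiles. Hence
-- Λₜ(κ) is a disjoint union of t / 2 copies of Λ(κ), with the two coordinates
-- of the degree exchanged. By the universal properties C⋆(Λₜ(κ)) is then a
-- direct sum of t / 2 copies of C⋆(Λ(κ)): the inclusions ψᵢ and the projections
-- φᵢ satisfy φᵢψᵢ = id and φᵢψⱼ = 0 for i ≠ j on generators, and as soon as the
-- images of the ψᵢ are orthogonal, Σ ψᵢφᵢ is a homomorphism, so that it is the
-- identity because it is so on generators. Finally K₀ and K₁ are additive.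
--
-- The orthogonality of the ψᵢ needs that the sum e of the vertex projections is
-- a unit of C⋆(Λ(κ)). Both x ↦ (2e - 1) x (2e - 1) and, once e is known to be
-- central, x ↦ e x are endomorphisms fixing the generators, so that both are
-- the identity.
module Submission where

open import Defs
open import Algebra.Bundles using (AbelianGroup; CommutativeMonoid; RawGroup)
open import Algebra.Construct.Pointwise using (isAbelianGroup)
open import Algebra.Morphism.Structures using (module GroupMorphisms)
open import Data.Bool.Base using (Bool; true; false)
open import Data.Fin.Base using (Fin; zero; suc; toℕ; fromℕ<; splitAt; _↑ˡ_; _↑ʳ_)
open import Data.Fin.Patterns using (0F; 1F; 2F; 3F)
import Data.Fin.Permutation as Permutation
open import Data.Fin.Properties using (_≟_; suc-injective; splitAt-↑ˡ; splitAt-↑ʳ; toℕ-injective; toℕ<n; toℕ-fromℕ<; fromℕ<-toℕ)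
open import Data.List.Base as List using (List; []; _∷_; foldr; length; lookup)
open import Data.List.Membership.Propositional.Properties using (∈-lookup)
import Data.List.Properties as List
open import Data.List.Relation.Unary.All as All using (All; []; _∷_)
import Data.List.Relation.Unary.All.Properties as All
open import Data.List.Relation.Unary.AllPairs using (AllPairs; []; _∷_)
open import Data.List.Relation.Unary.Any as Any using (Any; here; there)
open import Data.List.Relation.Unary.Any.Properties using (lookup-index)
open import Data.List.Relation.Unary.Unique.Propositional using (Unique)
open import Data.Nat.Base as ℕ using (ℕ; z≤n; s≤s)
open import Data.Nat.Properties as ℕ using (_<?_)
open import Data.Product.Base using (∃-syntax; _×_; _,_; proj₁; proj₂)
open import Data.Sum.Base using (_⊎_; inj₁; inj₂; [_,_]′)
open import Data.Vec.Base using (Vec; []; _∷_)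
open import Function.Base using (_∘_)
open import Level using (Level; _⊔_; Setω)
open import Relation.Binary.PropositionalEquality as ≡ using (_≡_; _≢_)
open import Relation.Binary.Structures using (IsEquivalence)
open import Relation.Nullary.Decidable.Core using (Dec; yes; no)
open import Relation.Nullary.Negation using (¬_; contradiction)
import Algebra.Properties.AbelianGroup as AbelianGroupProperties
import Algebra.Properties.CommutativeMonoid.Sum as CMSum
import Algebra.Properties.CommutativeSemigroup as CommutativeSemigroupProperties
import Algebra.Properties.Group as GroupProperties
import Algebra.Properties.Ring as RingProperties
import Algebra.Properties.RingWithoutOne as RingWithoutOneProperties
import Algebra.Solver.CommutativeMonoid as CMSolver
import Relation.Binary.Reasoning.Setoid as SetoidReasoning

-- A graph algebra is available only through its universal property: an identity in it is proved as
-- the equality of two homomorphisms that agree on generators. This is the difficulty with the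
-- orthogonality of the ψᵢ, as (x , y) ↦ ψᵢ(x)ψⱼ(y) is no homomorphism, and with the unit, as x ↦ e
-- x is not known to be multiplicative before e is central. Conjugation by 2e - 1 is multiplicative
-- from the start because (2e - 1)² = 1. Homomorphisms carry a bound, so each one constructed comes
-- with norm estimates, and these have to do without deciding the sign of a real number. K₀ is
-- defined through unitizations, and orthogonal homomorphisms do not add up after unital extension:
-- n of them would send 1 to n. The units help again here: for unital A, the unitization A⁺ is A ⊕
-- ℂ, and the scalar summand contributes nothing to K₀. For K₁, the condition that 1 + x be unitary
-- is written in terms of x alone, and orthogonal sums preserve it directly.

-- Inequalities in a constructive ordered field

module OrderedField (ℝ : RealField) where
  open RealField ℝ
  open RingProperties ring using (-‿distribʳ-*)

  <-respˡ : ∀ {x y z} → x ≈ y → x < z → y < z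
  <-respˡ = proj₂ <-resp-≈

  <-respʳ : ∀ {x y z} → x ≈ y → z < x → z < y
  <-respʳ = proj₁ <-resp-≈

  <⇒≤ : ∀ {x y} → x < y → x ≤ y
  <⇒≤ x<y y<x = <-irrefl refl (<-trans x<y y<x)

  ≈⇒≤ : ∀ {x y} → x ≈ y → x ≤ y
  ≈⇒≤ x≈y y<x = <-irrefl (sym x≈y) y<x

  -- As `≤` is the negation of the reverse `<`, mixed transitivity comes from cotransitivity:
  -- comparing the third number with the strict inequality leaves two cases, one of which the weak
  -- inequality refutes.
  ≤-<-trans : ∀ {x y z} → x ≤ y → y < z → x < z
  ≤-<-trans x≤y y<z = [ (λ y<x → contradiction y<x x≤y) , (λ x<z → x<z) ]′ (<-cotrans y<z _)

  <-≤-trans : ∀ {x y z} → x < y → y ≤ z → x < z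
  <-≤-trans x<y y≤z = [ (λ x<z → x<z) , (λ z<y → contradiction z<y y≤z) ]′ (<-cotrans x<y _)

  ≤-trans : ∀ {x y z} → x ≤ y → y ≤ z → x ≤ z
  ≤-trans x≤y y≤z z<x = y≤z (<-≤-trans z<x x≤y)

  +-monoʳ-< : ∀ {x y} z → x < y → z + x < z + y
  +-monoʳ-< z x<y = <-respˡ (+-comm _ z) (<-respʳ (+-comm _ z) (+-monoˡ-< z x<y))

  +-cancelʳ-< : ∀ {x y} z → x + z < y + z → x < y
  +-cancelʳ-< z lt = <-respˡ (drop _) (<-respʳ (drop _) (+-monoˡ-< (- z) lt))
    where
    drop : ∀ x → x + z - z ≈ x
    drop x = trans (+-assoc x z (- z)) (trans (+-congˡ (-‿inverseʳ z)) (+-identityʳ x))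

  +-monoˡ-≤ : ∀ {x y} z → x ≤ y → x + z ≤ y + z
  +-monoˡ-≤ z x≤y lt = x≤y (+-cancelʳ-< z lt)

  +-mono-≤ : ∀ {x y u v} → x ≤ y → u ≤ v → x + u ≤ y + v
  +-mono-≤ {x} {y} {u} {v} x≤y u≤v = ≤-trans (+-monoˡ-≤ u x≤y)
    (≤-trans (≈⇒≤ (+-comm y u)) (≤-trans (+-monoˡ-≤ y u≤v) (≈⇒≤ (+-comm v y))))

  +-mono-< : ∀ {x y u v} → x < y → u < v → x + u < y + v
  +-mono-< {y = y} {u = u} x<y u<v = <-trans (+-monoˡ-< u x<y) (+-monoʳ-< y u<v)

  positive-difference : ∀ {x y} → x < y → 0# < y - x
  positive-difference {x} x<y = <-respˡ (-‿inverseʳ x) (+-monoˡ-< (- x) x<y)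

  *-monoʳ-< : ∀ {x y z} → 0# < z → x < y → z * x < z * y
  *-monoʳ-< {x} {y} {z} 0<z x<y = +-cancelʳ-< (- (z * x))
    (<-respˡ (sym (-‿inverseʳ _))
      (<-respʳ (trans (distribˡ z y (- x)) (+-congˡ (sym (-‿distribʳ-* z x))))
        (*-positive 0<z (positive-difference x<y))))

  *-cancelˡ-< : ∀ {x y z} → 0# < z → z * x < z * y → x < y
  *-cancelˡ-< {x} {y} {z} 0<z lt = let w , 0<w , zw≈1 = recip 0<z in
    <-respˡ (cancel zw≈1 x) (<-respʳ (cancel zw≈1 y) (*-monoʳ-< 0<w lt))
    where
    cancel : ∀ {w} → z * w ≈ 1# → ∀ x → w * (z * x) ≈ x
    cancel {w} e x = trans (sym (*-assoc w z x))
      (trans (*-congʳ (trans (*-comm w z) e)) (*-identityˡ x))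

  -- A weak inequality is a negation, so that it may be proved by cases
  -- according to whether z is positive or zero.
  *-monoʳ-≤ : ∀ {x y z} → 0# ≤ z → x ≤ y → z * x ≤ z * y
  *-monoʳ-≤ {x} {y} {z} 0≤z x≤y lt = <-irrefl
    (trans (zero* y) (sym (zero* x))) lt
    where
    z≤0 : z ≤ 0#
    z≤0 0<z = x≤y (*-cancelˡ-< 0<z lt)
    zero* : ∀ x → z * x ≈ 0#
    zero* x = trans (*-congʳ (<-tight z≤0 0≤z)) (zeroˡ x)

  *-monoˡ-≤ : ∀ {x y z} → 0# ≤ z → x ≤ y → x * z ≤ y * z
  *-monoˡ-≤ {x} {y} {z} 0≤z x≤y = ≤-trans (≈⇒≤ (*-comm x z))
    (≤-trans (*-monoʳ-≤ 0≤z x≤y) (≈⇒≤ (*-comm z y)))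

  -- Takes the place of square roots, since homogeneity and the C⋆-identity speak of squares of
  -- norms. If `y < x`, then `y * y ≤ y * x < x * x`.
  square-cancel-≤ : ∀ {x y} → 0# ≤ y → x * x ≈ y * y → x ≤ y
  square-cancel-≤ {x} {y} 0≤y e y<x = <-irrefl (sym e)
    (≤-<-trans (*-monoʳ-≤ 0≤y (<⇒≤ y<x)) (<-respˡ (*-comm x y) (*-monoʳ-< (≤-<-trans 0≤y y<x) y<x)))

  -- The sign of `x` cannot be decided, but `x` can be compared with the strict inequality
  -- `0# < 1#`: either `x` itself or `1#` will do.
  positive-bound : ∀ x → ∃[ y ] 0# < y × x ≤ y
  positive-bound x = [ (λ 0<x → x , 0<x , ≈⇒≤ refl) , (λ x<1 → 1# , 0<1 , <⇒≤ x<1) ]′ (<-cotrans 0<1 x)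

  -- Turns the bound `K` of a homomorphism into a modulus of continuity. As `K` need not be
  -- invertible, it is first replaced by a positive `L` above it, and η is ε / `L`.
  scale-down : ∀ K {ε} → 0# < ε → ∃[ η ] 0# < η × (∀ {x y} → 0# ≤ x → x < η → y ≤ K * x → y < ε)
  scale-down K {ε} 0<ε with positive-bound K
  ... | L , 0<L , K≤L with recip 0<L
  ... | w , 0<w , Lw≈1 = w * ε , *-positive 0<w 0<ε , λ 0≤x x<η y≤Kx →
    ≤-<-trans (≤-trans y≤Kx (*-monoˡ-≤ 0≤x K≤L))
      (<-respʳ (trans (sym (*-assoc L w ε)) (trans (*-congʳ Lw≈1) (*-identityˡ ε))) (*-monoʳ-< 0<L x<η))

  half : ∃[ w ] 0# < w × w + w ≈ 1#
  half with recip (<-trans 0<1 (<-respˡ (+-identityʳ 1#) (+-monoʳ-< 1# 0<1)))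
  ... | w , 0<w , 2w≈1 = w , 0<w ,
    trans (sym (trans (distribʳ w 1# 1#) (+-cong (*-identityˡ w) (*-identityˡ w)))) 2w≈1

  bisect : ∀ {ε} → 0# < ε → ∃[ η ] 0# < η × η + η ≈ ε
  bisect {ε} 0<ε with half
  ... | w , 0<w , w+w≈1 = w * ε , *-positive 0<w 0<ε ,
    trans (sym (distribʳ ε w w)) (trans (*-congʳ w+w≈1) (*-identityˡ ε))

  -- A minimum would require deciding which number is smaller. Instead `y` is compared with the
  -- strict inequality x/2 < x, and either x/2 or `y` is taken.
  lower-bound₂ : ∀ {x y} → 0# < x → 0# < y → ∃[ z ] 0# < z × z ≤ x × z ≤ y
  lower-bound₂ {x} {y} 0<x 0<y with bisect 0<x
  ... | w , 0<w , w+w≈x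
    with w<x ← <-respˡ (+-identityʳ w) (<-respʳ w+w≈x (+-monoʳ-< w 0<w))
    with <-cotrans w<x y
  ... | inj₁ w<y = w , 0<w , <⇒≤ w<x , <⇒≤ w<y
  ... | inj₂ y<x = y , 0<y , <⇒≤ y<x , ≈⇒≤ refl

-- K₀ of direct sums

module _ {c ℓ : Level} (M : CommutativeMonoid c ℓ) where
  open CommutativeMonoid M
  open CMSum M using (sum; sum-cong-≋; sum-replicate-zero)

  sum-single : ∀ {n} (f : Fin n → Carrier) i → (∀ j → j ≢ i → f j ≈ ε) → sum f ≈ f i
  sum-single {ℕ.suc n} f zero    f≈ε = trans
    (∙-congˡ (trans (sum-cong-≋ (λ j → f≈ε (suc j) λ ())) (sum-replicate-zero n))) (identityʳ _)
  sum-single {ℕ.suc n} f (suc i) f≈ε = trans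
    (∙-cong (f≈ε zero λ ()) (sum-single (f ∘ suc) i λ j j≢i → f≈ε (suc j) (j≢i ∘ suc-injective)))
    (identityˡ _)

open StarRingHom

power : ∀ {c ℓ} → StarRing c ℓ → ℕ → StarRing c ℓ
power R n = record
  { ringWithoutOne = record
    { Carrier = Fin n → Carrier
    ; _≈_     = λ x y → ∀ i → x i ≈ y i
    ; _+_     = λ x y i → x i + y i
    ; _*_     = λ x y i → x i * y i
    ; -_      = λ x i → - x i
    ; 0#      = λ _ → 0#
    ; isRingWithoutOne = record
      { +-isAbelianGroup = isAbelianGroup (Fin n) +-isAbelianGroup
      ; *-cong           = λ p q i → *-cong (p i) (q i)
      ; *-assoc          = λ x y z i → *-assoc (x i) (y i) (z i)
      ; distrib          = (λ x y z i → distribˡ (x i) (y i) (z i))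
                         , (λ x y z i → distribʳ (x i) (y i) (z i))
      }
    }
  ; _⋆           = λ x i → x i ⋆
  ; ⋆-cong       = λ p i → ⋆-cong (p i)
  ; ⋆-involutive = λ x i → ⋆-involutive (x i)
  ; ⋆-+          = λ x y i → ⋆-+ (x i) (y i)
  ; ⋆-*          = λ x y i → ⋆-* (x i) (y i)
  }
  where open StarRing R

idʰ : ∀ {c ℓ} (R : StarRing c ℓ) → StarRingHom R R
idʰ R = record
  { ⟦_⟧ = λ x → x ; ⟦⟧-cong = λ p → p
  ; +-homo = λ _ _ → refl ; *-homo = λ _ _ → refl ; ⋆-homo = λ _ → refl }
  where open StarRing R

module _ {c₁ ℓ₁ c₂ ℓ₂ : Level} (R : StarRing c₁ ℓ₁) (S : StarRing c₂ ℓ₂) where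
  private
    module S = StarRing S

  zeroʰ : StarRingHom R S
  zeroʰ = record
    { ⟦_⟧     = λ _ → S.0#
    ; ⟦⟧-cong = λ _ → S.refl
    ; +-homo  = λ _ _ → S.sym (S.+-identityˡ S.0#)
    ; *-homo  = λ _ _ → S.sym (S.zeroˡ S.0#)
    ; ⋆-homo  = λ _ → S.sym (Matrices.0⋆≈0 S)
    }

module _ {c₁ ℓ₁ c₂ ℓ₂ c₃ ℓ₃ : Level} {R : StarRing c₁ ℓ₁} {S : StarRing c₂ ℓ₂} {T : StarRing c₃ ℓ₃} where
  private
    module T = StarRing T

  infixr 9 _∘ʰ_

  _∘ʰ_ : StarRingHom S T → StarRingHom R S → StarRingHom R T
  χ ∘ʰ φ = record
    { ⟦_⟧     = λ x → ⟦ χ ⟧ (⟦ φ ⟧ x)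
    ; ⟦⟧-cong = λ p → ⟦⟧-cong χ (⟦⟧-cong φ p)
    ; +-homo  = λ x y → T.trans (⟦⟧-cong χ (+-homo φ x y)) (+-homo χ _ _)
    ; *-homo  = λ x y → T.trans (⟦⟧-cong χ (*-homo φ x y)) (*-homo χ _ _)
    ; ⋆-homo  = λ x → T.trans (⟦⟧-cong χ (⋆-homo φ x)) (⋆-homo χ _)
    }

module _ {c₁ ℓ₁ c₂ ℓ₂ : Level} {R : StarRing c₁ ℓ₁} {S : StarRing c₂ ℓ₂} where
  private
    module R = StarRing R
    module S = StarRing S
    module MS = Matrices S

  tuple : ∀ {n} → (Fin n → StarRingHom R S) → StarRingHom R (power S n)
  tuple φ = record
    { ⟦_⟧     = λ x i → ⟦ φ i ⟧ x
    ; ⟦⟧-cong = λ p i → ⟦⟧-cong (φ i) p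
    ; +-homo  = λ x y i → +-homo (φ i) x y
    ; *-homo  = λ x y i → *-homo (φ i) x y
    ; ⋆-homo  = λ x i → ⋆-homo (φ i) x
    }

  Orthogonal : StarRingHom R S → StarRingHom R S → Set (c₁ ⊔ ℓ₂)
  Orthogonal φ χ = ∀ x y → ⟦ φ ⟧ x S.* ⟦ χ ⟧ y S.≈ S.0#

  PairwiseOrthogonal : ∀ {n} → (Fin n → StarRingHom R S) → Set (c₁ ⊔ ℓ₂)
  PairwiseOrthogonal χ = ∀ i j → i ≢ j → Orthogonal (χ i) (χ j)

  -- The product in the reverse order is the adjoint of `⟦ φ ⟧ (y ⋆) * ⟦ χ ⟧ (x ⋆)`.
  Orthogonal-sym : ∀ {φ χ} → Orthogonal φ χ → Orthogonal χ φ
  Orthogonal-sym {φ} {χ} φ⊥χ x y = begin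
    ⟦ χ ⟧ x S.* ⟦ φ ⟧ y                       ≈⟨ S.⋆-involutive _ ⟨
    (⟦ χ ⟧ x S.* ⟦ φ ⟧ y) S.⋆ S.⋆             ≈⟨ S.⋆-cong (S.⋆-* _ _) ⟩
    (⟦ φ ⟧ y S.⋆ S.* ⟦ χ ⟧ x S.⋆) S.⋆         ≈⟨ S.⋆-cong (S.*-cong (⋆-homo φ y) (⋆-homo χ x)) ⟨
    (⟦ φ ⟧ (y R.⋆) S.* ⟦ χ ⟧ (x R.⋆)) S.⋆     ≈⟨ S.⋆-cong (φ⊥χ _ _) ⟩
    S.0# S.⋆                                  ≈⟨ MS.0⋆≈0 ⟩
    S.0#                                      ∎
    where open SetoidReasoning S.setoid

  -- Orthogonality is what makes the sum multiplicative: in the double sum for a product only the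
  -- diagonal terms survive.
  glue : ∀ {n} (χ : Fin n → StarRingHom R S) → PairwiseOrthogonal χ → StarRingHom (power R n) S
  glue {n} χ χ⊥ = record
    { ⟦_⟧     = λ x → MS.sum λ i → ⟦ χ i ⟧ (x i)
    ; ⟦⟧-cong = λ p → MS.sum-cong-≋ λ i → ⟦⟧-cong (χ i) (p i)
    ; +-homo  = λ x y → S.trans (MS.sum-cong-≋ λ i → +-homo (χ i) (x i) (y i))
                                (MS.∑-distrib-+ (λ i → ⟦ χ i ⟧ (x i)) (λ i → ⟦ χ i ⟧ (y i)))
    ; *-homo  = λ x y → S.sym (begin
        MS.sum (λ i → ⟦ χ i ⟧ (x i)) S.* MS.sum (λ j → ⟦ χ j ⟧ (y j))
          ≈⟨ MS.sum-* _ (λ i → ⟦ χ i ⟧ (x i)) ⟩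
        MS.sum (λ i → ⟦ χ i ⟧ (x i) S.* MS.sum (λ j → ⟦ χ j ⟧ (y j)))
          ≈⟨ MS.sum-cong-≋ (λ i → MS.*-sum (⟦ χ i ⟧ (x i)) (λ j → ⟦ χ j ⟧ (y j))) ⟩
        MS.sum (λ i → MS.sum (λ j → ⟦ χ i ⟧ (x i) S.* ⟦ χ j ⟧ (y j)))
          ≈⟨ MS.sum-cong-≋ (λ i → sum-single S.+-commutativeMonoid
               (λ j → ⟦ χ i ⟧ (x i) S.* ⟦ χ j ⟧ (y j)) i
               (λ j j≢i → χ⊥ i j (j≢i ∘ ≡.sym) (x i) (y j))) ⟩
        MS.sum (λ i → ⟦ χ i ⟧ (x i) S.* ⟦ χ i ⟧ (y i))
          ≈⟨ MS.sum-cong-≋ (λ i → *-homo (χ i) (x i) (y i)) ⟨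
        MS.sum (λ i → ⟦ χ i ⟧ (x i R.* y i)) ∎)
    ; ⋆-homo  = λ x → S.trans (MS.sum-cong-≋ λ i → ⋆-homo (χ i) (x i))
                              (S.sym (MS.sum-⋆ (λ i → ⟦ χ i ⟧ (x i))))
    }
    where open SetoidReasoning S.setoid

module _ {c ℓ : Level} (R : StarRing c ℓ) where
  private
    module P = CommutativeMonoid (Matrices.projectionMonoid R)

  componentwise : ∀ p q p′ q′ → p P.≈ p′ → q P.≈ q′ → AbelianGroup._≈_ (K₀₀ R) (p , q) (p′ , q′)
  componentwise p q p′ q′ p∼p′ q∼q′ = P.ε ,
    P.∙-congʳ {P.ε} {p P.∙ q′} {p′ P.∙ q} (P.∙-cong {p} {p′} {q′} {q} p∼p′ (P.sym {q} {q′} q∼q′))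

module _ {c₁ ℓ₁ c₂ ℓ₂ : Level} {R : StarRing c₁ ℓ₁} {S : StarRing c₂ ℓ₂} where
  private
    module R = StarRing R
    module S = StarRing S
    module MR = Matrices R
    module MS = Matrices S
    module V = AbelianGroup (K₀₀ S)
  open MR.Projection
  open SetoidReasoning S.setoid

  -- Conjugation by the identity permutation is the way to pass from entrywise equality to
  -- equivalence of projections.
  mapProjection-ext : ∀ (φ χ : StarRingHom R S) → (∀ x → ⟦ φ ⟧ x S.≈ ⟦ χ ⟧ x) →
                      ∀ p → mapProjection φ p MS.∼ mapProjection χ p
  mapProjection-ext φ χ φ≈χ p = MS.∼-permute {mapProjection φ p} {mapProjection χ p}
    Permutation.id λ i j → φ≈χ (matrix p i j)

  -- The partial isometry is the matrix without rows, for which `v † ⊡ v` consists of empty sums.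
  mapProjection-zero : ∀ p → mapProjection (zeroʰ R S) p MS.∼ MS.0ₚ
  mapProjection-zero p = MS.equivalence (λ ()) (λ _ _ → S.refl) λ ()

  -- The two images of p stacked in a column form a partial isometry.
  mapProjection-+ : ∀ (φ χ ω : StarRingHom R S) → Orthogonal φ χ →
    (∀ x → ⟦ ω ⟧ x S.≈ ⟦ φ ⟧ x S.+ ⟦ χ ⟧ x) →
    ∀ p → mapProjection ω p MS.∼ (mapProjection φ p MS.⊕ₚ mapProjection χ p)
  mapProjection-+ φ χ ω φ⊥χ ω≈φ+χ p = MS.equivalence (λ i j → column (splitAt n i) j) source target
    where
    n = size p
    P = matrix p
    φP χP : MS.Mat n n
    φP = mapMat φ P
    χP = mapMat χ P
    φp = mapProjection φ p
    χp = mapProjection χ p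

    column : Fin n ⊎ Fin n → Fin n → S.Carrier
    column (inj₁ i) j = φP i j
    column (inj₂ i) j = χP i j

    source : ∀ i j →
      MS.sum (λ a → column (splitAt n a) i S.⋆ S.* column (splitAt n a) j) S.≈ ⟦ ω ⟧ (P i j)
    source i j = begin
      MS.sum (λ a → column (splitAt n a) i S.⋆ S.* column (splitAt n a) j)
        ≈⟨ MS.sum-split n _ ⟩
      MS.sum (λ a → column (splitAt n (a ↑ˡ n)) i S.⋆ S.* column (splitAt n (a ↑ˡ n)) j)
        S.+ MS.sum (λ a → column (splitAt n (n ↑ʳ a)) i S.⋆ S.* column (splitAt n (n ↑ʳ a)) j)
        ≈⟨ S.+-cong
             (MS.sum-cong-≋ λ a → S.reflexive
               (≡.cong (λ s → column s i S.⋆ S.* column s j) (splitAt-↑ˡ n a n)))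
             (MS.sum-cong-≋ λ a → S.reflexive
               (≡.cong (λ s → column s i S.⋆ S.* column s j) (splitAt-↑ʳ n n a))) ⟩
      (φP MS.† MS.⊡ φP) i j S.+ (χP MS.† MS.⊡ χP) i j
        ≈⟨ S.+-cong (MS._∼_.v†v≋p (MS.∼-refl {φp}) i j) (MS._∼_.v†v≋p (MS.∼-refl {χp}) i j) ⟩
      φP i j S.+ χP i j
        ≈⟨ ω≈φ+χ (P i j) ⟨
      ⟦ ω ⟧ (P i j) ∎

    cross : ∀ (φ χ : StarRingHom R S) → Orthogonal φ χ →
            ∀ i j → MS.sum (λ a → ⟦ φ ⟧ (P i a) S.* ⟦ χ ⟧ (P j a) S.⋆) S.≈ S.0#
    cross φ χ φ⊥χ i j = MS.sum-zero λ a →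
      S.trans (S.*-congˡ (S.sym (⋆-homo χ (P j a)))) (φ⊥χ _ _)

    blocks : ∀ s t → MS.sum (λ a → column s a S.* column t a S.⋆) S.≈ MS.block φP χP s t
    blocks (inj₁ i) (inj₁ j) = MS._∼_.vv†≋q (MS.∼-refl {φp}) i j
    blocks (inj₁ i) (inj₂ j) = cross φ χ φ⊥χ i j
    blocks (inj₂ i) (inj₁ j) = cross χ φ (Orthogonal-sym {φ = φ} {χ} φ⊥χ) i j
    blocks (inj₂ i) (inj₂ j) = MS._∼_.vv†≋q (MS.∼-refl {χp}) i j

    target : ∀ i j → MS.sum (λ a → column (splitAt n i) a S.* column (splitAt n j) a S.⋆)
                     S.≈ (φP MS.⊕ χP) i j
    target i j = blocks (splitAt n i) (splitAt n j)

  K₀₀-map-ext : ∀ (φ χ : StarRingHom R S) → (∀ x → ⟦ φ ⟧ x S.≈ ⟦ χ ⟧ x) →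
                ∀ z → K₀₀-map φ z V.≈ K₀₀-map χ z
  K₀₀-map-ext φ χ φ≈χ (p , q) = componentwise S
    (mapProjection φ p) (mapProjection φ q) (mapProjection χ p) (mapProjection χ q)
    (mapProjection-ext φ χ φ≈χ p) (mapProjection-ext φ χ φ≈χ q)

  K₀₀-map-zero : ∀ z → K₀₀-map (zeroʰ R S) z V.≈ V.ε
  K₀₀-map-zero (p , q) = componentwise S
    (mapProjection (zeroʰ R S) p) (mapProjection (zeroʰ R S) q) MS.0ₚ MS.0ₚ
    (mapProjection-zero p) (mapProjection-zero q)

  K₀₀-map-+ : ∀ (φ χ ω : StarRingHom R S) → Orthogonal φ χ →
    (∀ x → ⟦ ω ⟧ x S.≈ ⟦ φ ⟧ x S.+ ⟦ χ ⟧ x) →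
    ∀ z → K₀₀-map ω z V.≈ K₀₀-map φ z V.∙ K₀₀-map χ z
  K₀₀-map-+ φ χ ω φ⊥χ e (p , q) = componentwise S
    (mapProjection ω p) (mapProjection ω q)
    (mapProjection φ p MS.⊕ₚ mapProjection χ p) (mapProjection φ q MS.⊕ₚ mapProjection χ q)
    (mapProjection-+ φ χ ω φ⊥χ e p) (mapProjection-+ φ χ ω φ⊥χ e q)

K₀₀-map-id : ∀ {c ℓ} {R : StarRing c ℓ} (φ : StarRingHom R R) → (∀ x → StarRing._≈_ R (⟦ φ ⟧ x) x) →
             ∀ z → AbelianGroup._≈_ (K₀₀ R) (K₀₀-map φ z) z
K₀₀-map-id {R = R} φ φ≈id (p , q) = componentwise R (mapProjection φ p) (mapProjection φ q) p q (same p) (same q)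
  where
  open Matrices R
  same : ∀ p → mapProjection φ p ∼ p
  same p = ∼-permute {mapProjection φ p} {p} Permutation.id λ i j → φ≈id (Projection.matrix p i j)

K₀₀-map-∘ : ∀ {c₁ ℓ₁ c₂ ℓ₂ c₃ ℓ₃} {R : StarRing c₁ ℓ₁} {S : StarRing c₂ ℓ₂} {T : StarRing c₃ ℓ₃}
  (χ : StarRingHom S T) (φ : StarRingHom R S) (ω : StarRingHom R T) →
  (∀ x → StarRing._≈_ T (⟦ ω ⟧ x) (⟦ χ ⟧ (⟦ φ ⟧ x))) →
  ∀ z → AbelianGroup._≈_ (K₀₀ T) (K₀₀-map χ (K₀₀-map φ z)) (K₀₀-map ω z)
K₀₀-map-∘ {R = R} {T = T} χ φ ω e (p , q) = componentwise T
  (χφ p) (χφ q) (mapProjection ω p) (mapProjection ω q) (same p) (same q)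
  where
  open Matrices T
  χφ : Matrices.Projection R → Projection
  χφ p = mapProjection χ (mapProjection φ p)

  same : ∀ p → χφ p ∼ mapProjection ω p
  same p = ∼-permute {χφ p} {mapProjection ω p} Permutation.id
    λ i j → StarRing.sym T (e (Matrices.Projection.matrix p i j))

-- K₀₀ is used only through these properties.
record IsAdditive
  (V : ∀ {c ℓ} → StarRing c ℓ → AbelianGroup (c ⊔ ℓ) (c ⊔ ℓ))
  (map : ∀ {c₁ ℓ₁ c₂ ℓ₂} {R : StarRing c₁ ℓ₁} {S : StarRing c₂ ℓ₂} →
         StarRingHom R S → AbelianGroup.Carrier (V R) → AbelianGroup.Carrier (V S)) : Setω where
  field
    isHomomorphism : ∀ {c₁ ℓ₁ c₂ ℓ₂} {R : StarRing c₁ ℓ₁} {S : StarRing c₂ ℓ₂} (φ : StarRingHom R S) →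
      GroupMorphisms.IsGroupHomomorphism (AbelianGroup.rawGroup (V R)) (AbelianGroup.rawGroup (V S)) (map φ)
    map-id : ∀ {c ℓ} {R : StarRing c ℓ} (φ : StarRingHom R R) → (∀ x → StarRing._≈_ R (⟦ φ ⟧ x) x) →
      ∀ z → AbelianGroup._≈_ (V R) (map φ z) z
    map-∘ : ∀ {c₁ ℓ₁ c₂ ℓ₂ c₃ ℓ₃} {R : StarRing c₁ ℓ₁} {S : StarRing c₂ ℓ₂} {T : StarRing c₃ ℓ₃}
      (χ : StarRingHom S T) (φ : StarRingHom R S) (ω : StarRingHom R T) →
      (∀ x → StarRing._≈_ T (⟦ ω ⟧ x) (⟦ χ ⟧ (⟦ φ ⟧ x))) →
      ∀ z → AbelianGroup._≈_ (V T) (map χ (map φ z)) (map ω z)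
    map-ext : ∀ {c₁ ℓ₁ c₂ ℓ₂} {R : StarRing c₁ ℓ₁} {S : StarRing c₂ ℓ₂} (φ χ : StarRingHom R S) →
      (∀ x → StarRing._≈_ S (⟦ φ ⟧ x) (⟦ χ ⟧ x)) →
      ∀ z → AbelianGroup._≈_ (V S) (map φ z) (map χ z)
    map-zero : ∀ {c₁ ℓ₁ c₂ ℓ₂} {R : StarRing c₁ ℓ₁} {S : StarRing c₂ ℓ₂} →
      ∀ z → AbelianGroup._≈_ (V S) (map (zeroʰ R S) z) (AbelianGroup.ε (V S))
    map-+ : ∀ {c₁ ℓ₁ c₂ ℓ₂} {R : StarRing c₁ ℓ₁} {S : StarRing c₂ ℓ₂} (φ χ ω : StarRingHom R S) →
      Orthogonal φ χ → (∀ x → StarRing._≈_ S (⟦ ω ⟧ x) (StarRing._+_ S (⟦ φ ⟧ x) (⟦ χ ⟧ x))) →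
      ∀ z → AbelianGroup._≈_ (V S) (map ω z) (AbelianGroup._∙_ (V S) (map φ z) (map χ z))

  module _ {c₁ ℓ₁ c₂ ℓ₂ : Level} {R : StarRing c₁ ℓ₁} {S : StarRing c₂ ℓ₂} where
    private
      module S = StarRing S
      module MS = Matrices S
      module VS = AbelianGroup (V S)

    -- Induction that splits off `χ zero`. For `map-+` to apply, the sum of the remaining maps has
    -- to be a homomorphism itself, and so it is written as `glue` after the diagonal map into the
    -- power of `R`.
    map-sum : ∀ {n} (χ : Fin n → StarRingHom R S) → PairwiseOrthogonal χ → (ω : StarRingHom R S) →
      (∀ x → ⟦ ω ⟧ x S.≈ MS.sum (λ i → ⟦ χ i ⟧ x)) →
      ∀ z → map ω z VS.≈ CMSum.sum VS.commutativeMonoid (λ i → map (χ i) z)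
    map-sum {ℕ.zero}  χ χ⊥ ω e z = VS.trans (map-ext ω (zeroʰ R S) e z) (map-zero z)
    map-sum {ℕ.suc n} χ χ⊥ ω e z = VS.trans
      (map-+ (χ zero) rest ω zero⊥rest e z)
      (VS.∙-congˡ (map-sum (χ ∘ suc) rest⊥ rest (λ _ → S.refl) z))
      where
      rest⊥ : PairwiseOrthogonal (χ ∘ suc)
      rest⊥ i j i≢j = χ⊥ (suc i) (suc j) (i≢j ∘ suc-injective)

      rest : StarRingHom R S
      rest = glue (χ ∘ suc) rest⊥ ∘ʰ tuple (λ _ → idʰ R)

      zero⊥rest : Orthogonal (χ zero) rest
      zero⊥rest x y = S.trans (MS.*-sum (⟦ χ zero ⟧ x) (λ i → ⟦ χ (suc i) ⟧ y))
        (MS.sum-zero λ i → χ⊥ zero (suc i) (λ ()) x y)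

K₀₀-isAdditive : IsAdditive K₀₀ K₀₀-map
K₀₀-isAdditive = record
  { isHomomorphism = K₀₀-map-isHomomorphism
  ; map-id         = K₀₀-map-id
  ; map-∘          = K₀₀-map-∘
  ; map-ext        = λ {_ _ _ _ R S} → K₀₀-map-ext {R = R} {S}
  ; map-zero       = λ {_ _ _ _ R S} → K₀₀-map-zero {R = R} {S}
  ; map-+          = λ {_ _ _ _ R S} → K₀₀-map-+ {R = R} {S}
  }

module Biproduct {c₁ ℓ₁ c₂ ℓ₂ : Level} (G : AbelianGroup c₁ ℓ₁) (H : AbelianGroup c₂ ℓ₂) where
  private
    module G = AbelianGroup G
    module H = AbelianGroup H
    module ΣG = CMSum G.commutativeMonoid
    module ΣH = CMSum H.commutativeMonoid
  open GroupMorphisms G.rawGroup H.rawGroup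

  hom-sum : ∀ {f} → IsGroupHomomorphism f → ∀ {n} (x : Fin n → G.Carrier) →
            f (ΣG.sum x) H.≈ ΣH.sum (f ∘ x)
  hom-sum hom {ℕ.zero}  x = IsGroupHomomorphism.ε-homo hom
  hom-sum hom {ℕ.suc n} x = H.trans (IsGroupHomomorphism.homo hom _ _) (H.∙-congˡ (hom-sum hom (x ∘ suc)))

  -- An element is recovered from its components by `ΨΦ≈id`, hence injectivity. The preimage of `y`
  -- is the sum of the `Ψ i (y i)`: in component `i`, the maps `Φ i ∘ Ψ j` act as a Kronecker delta
  -- and leave one term.
  biproduct : ∀ {n} (Φ : Fin n → G.Carrier → H.Carrier) (Ψ : Fin n → H.Carrier → G.Carrier) →
    (∀ i → IsGroupHomomorphism (Φ i)) → (∀ i {x y} → x H.≈ y → Ψ i x G.≈ Ψ i y) →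
    (∀ i x → Φ i (Ψ i x) H.≈ x) → (∀ i j → i ≢ j → ∀ x → Φ i (Ψ j x) H.≈ H.ε) →
    (∀ x → ΣG.sum (λ i → Ψ i (Φ i x)) G.≈ x) →
    G.rawGroup ≅ᴳ H.rawGroup ^ᴳ n
  biproduct Φ Ψ Φ-hom Ψ-cong ΦΨ≈id ΦΨ≈0 ΨΦ≈id = (λ x i → Φ i x) , record
    { isGroupMonomorphism = record
      { isGroupHomomorphism = record
        { isMonoidHomomorphism = record
          { isMagmaHomomorphism = record
            { isRelHomomorphism = record { cong = λ x≈y i → Φ-cong i x≈y }
            ; homo = λ x y i → IsGroupHomomorphism.homo (Φ-hom i) x y
            }
          ; ε-homo = λ i → IsGroupHomomorphism.ε-homo (Φ-hom i)
          }
        ; ⁻¹-homo = λ x i → IsGroupHomomorphism.⁻¹-homo (Φ-hom i) x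
        }
      ; injective = λ {x} {y} Φx≈Φy → G.trans (G.sym (ΨΦ≈id x))
          (G.trans (ΣG.sum-cong-≋ λ i → Ψ-cong i (Φx≈Φy i)) (ΨΦ≈id y))
      }
    ; surjective = λ y → ΣG.sum (λ i → Ψ i (y i)) , λ z≈ i → H.trans (Φ-cong i z≈)
        (H.trans (hom-sum (Φ-hom i) (λ j → Ψ j (y j)))
        (H.trans (sum-single H.commutativeMonoid (λ j → Φ i (Ψ j (y j))) i
                   (λ j j≢i → ΦΨ≈0 i j (j≢i ∘ ≡.sym) (y j)))
                 (ΦΨ≈id i (y i))))
    }
    where
    Φ-cong : ∀ i {x y} → x G.≈ y → Φ i x H.≈ Φ i y
    Φ-cong i = IsGroupHomomorphism.⟦⟧-cong (Φ-hom i)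

-- K₀ of unital algebras through the splitting of the unitization

module Unital (ℝ : RealField) where
  open CStar ℝ

  private
    module C = StarRing ℂ-starRing

  record Unit {c ℓ : Level} (A : CStarAlgebra c ℓ) : Set (c ⊔ ℓ) where
    open CStarAlgebra A
    field
      e         : Carrier
      identityˡ : ∀ x → e * x ≈ x
      identityʳ : ∀ x → x * e ≈ x

    e⋆≈e : e ⋆ ≈ e
    e⋆≈e = begin
      e ⋆              ≈⟨ identityʳ (e ⋆) ⟨
      e ⋆ * e          ≈⟨ *-congˡ (⋆-involutive e) ⟨
      e ⋆ * e ⋆ ⋆      ≈⟨ ⋆-* (e ⋆) e ⟨
      (e ⋆ * e) ⋆      ≈⟨ ⋆-cong (identityʳ (e ⋆)) ⟩
      e ⋆ ⋆            ≈⟨ ⋆-involutive e ⟩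
      e                ∎
      where open SetoidReasoning setoid

  module _ {c ℓ : Level} (A : CStarAlgebra c ℓ) where
    open CStarAlgebra A

    ·-zeroˡ : ∀ x → 0ᶜ · x ≈ 0#
    ·-zeroˡ x = GroupProperties.identityˡ-unique +-group (0ᶜ · x) (0ᶜ · x)
      (trans (sym (·-distribʳ 0ᶜ 0ᶜ x)) (·-cong (C.+-identityˡ 0ᶜ) refl))

    ·-zeroʳ : ∀ z → z · 0# ≈ 0#
    ·-zeroʳ z = GroupProperties.identityˡ-unique +-group (z · 0#) (z · 0#)
      (trans (sym (·-distribˡ z 0# 0#)) (·-cong C.refl (+-identityˡ 0#)))

  -- A⁺ is the orthogonal sum of the ideal A and a copy of ℂ.
  module Splitting {c ℓ : Level} {A : CStarAlgebra c ℓ} (unit : Unit A) where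
    open CStarAlgebra A
    open Unit unit
    open KTheory A
    open SetoidReasoning setoid
    open RingWithoutOneProperties ringWithoutOne using (-‿distribʳ-*)
    open GroupProperties +-group using (⁻¹-involutive)
    open CommutativeSemigroupProperties (CommutativeMonoid.commutativeSemigroup +-commutativeMonoid)
      using (interchange)
    open CMSolver +-commutativeMonoid using (solve; _⊜_) renaming (_⊕_ to _:+_)
    private
      module A⁺ = StarRing unitization

    inclusion : StarRingHom starRing unitization
    inclusion = record
      { ⟦_⟧     = λ a → a , 0ᶜ
      ; ⟦⟧-cong = λ p → p , C.refl
      ; +-homo  = λ _ _ → refl , C.sym (C.+-identityˡ 0ᶜ)
      ; *-homo  = λ a b → sym (trans (+-congˡ (trans (+-cong (·-zeroˡ A b) (·-zeroˡ A a)) (+-identityˡ 0#)))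
                                     (+-identityʳ (a * b)))
                        , C.sym (C.zeroˡ 0ᶜ)
      ; ⋆-homo  = λ _ → refl , C.sym (Matrices.0⋆≈0 ℂ-starRing)
      }

    -- The retraction of A⁺ onto the ideal A that sends the adjoined 1 to `e`; within A⁺ it is
    -- multiplication by the central projection `(e , 0ᶜ)`.
    evaluation : StarRingHom unitization starRing
    evaluation = record
      { ⟦_⟧     = λ (a , z) → a + z · e
      ; ⟦⟧-cong = λ (p , q) → +-cong p (·-cong q refl)
      ; +-homo  = λ (a , z) (b , w) → trans (+-congˡ (·-distribʳ z w e)) (interchange a b (z · e) (w · e))
      ; *-homo  = λ (a , z) (b , w) → sym (begin
          (a + z · e) * (b + w · e)
            ≈⟨ trans (distribʳ _ a (z · e)) (+-cong (distribˡ a b (w · e)) (distribˡ (z · e) b (w · e))) ⟩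
          (a * b + a * (w · e)) + ((z · e) * b + (z · e) * (w · e))
            ≈⟨ +-cong (+-congˡ (trans (·-*-assocʳ w a e) (·-cong C.refl (identityʳ a))))
                 (+-cong (trans (·-*-assocˡ z e b) (·-cong C.refl (identityˡ b)))
                   (trans (·-*-assocˡ z e (w · e)) (trans (·-cong C.refl (identityˡ (w · e))) (sym (·-assoc z w e))))) ⟩
          (a * b + w · a) + (z · b + (z *ᶜ w) · e)
            ≈⟨ solve 4 (λ p q r s → (p :+ q) :+ (r :+ s) ⊜ (p :+ (r :+ q)) :+ s) refl
                 (a * b) (w · a) (z · b) ((z *ᶜ w) · e) ⟩
          (a * b + (z · b + w · a)) + (z *ᶜ w) · e ∎)
      ; ⋆-homo  = λ (a , z) → sym (trans (⋆-+ a (z · e)) (+-congˡ (trans (·-⋆ z e) (·-cong C.refl e⋆≈e))))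
      }

    -- 1 - e is the unit of this copy of ℂ.
    coscalar : StarRingHom ℂ-starRing unitization
    coscalar = record
      { ⟦_⟧     = λ z → z · (- e) , z
      ; ⟦⟧-cong = λ p → ·-cong p refl , p
      ; +-homo  = λ z w → ·-distribʳ z w (- e) , C.refl
      ; *-homo  = λ z w → sym (begin
          (z · - e) * (w · - e) + (z · w · - e + w · z · - e)
            ≈⟨ +-cong (trans (·-*-assocˡ z (- e) (w · - e)) (trans (·-cong C.refl (·-*-assocʳ w (- e) (- e)))
                        (trans (·-cong C.refl (·-cong C.refl -e*-e)) (sym (·-assoc z w e)))))
                      (+-cong (sym (·-assoc z w (- e))) (trans (sym (·-assoc w z (- e))) (·-cong (*ᶜ-comm w z) refl))) ⟩
          (z *ᶜ w) · e + ((z *ᶜ w) · - e + (z *ᶜ w) · - e)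
            ≈⟨ +-assoc _ _ _ ⟨
          ((z *ᶜ w) · e + (z *ᶜ w) · - e) + (z *ᶜ w) · - e
            ≈⟨ +-congʳ (cancel (z *ᶜ w)) ⟩
          0# + (z *ᶜ w) · - e
            ≈⟨ +-identityˡ _ ⟩
          (z *ᶜ w) · - e ∎) , C.refl
      ; ⋆-homo  = λ z → sym (trans (·-⋆ z (- e)) (·-cong C.refl -e⋆)) , C.refl
      }
      where
      *ᶜ-comm : ∀ z w → z *ᶜ w ≈ᶜ w *ᶜ z
      *ᶜ-comm (a +i b) (c +i d) =
          R.+-cong (R.*-comm a c) (R.-‿cong (R.*-comm b d))
        , R.trans (R.+-comm _ _) (R.+-cong (R.*-comm b c) (R.*-comm a d))

      cancel : ∀ z → z · e + z · - e ≈ 0#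
      cancel z = trans (sym (·-distribˡ z e (- e))) (trans (·-cong C.refl (-‿inverseʳ e)) (·-zeroʳ A z))

      -e*-e : - e * - e ≈ e
      -e*-e = trans (sym (-‿distribʳ-* (- e) e)) (trans (-‿cong (identityʳ (- e))) (⁻¹-involutive e))

      -e⋆ : (- e) ⋆ ≈ - e
      -e⋆ = GroupProperties.inverseˡ-unique +-group ((- e) ⋆) e (begin
        (- e) ⋆ + e        ≈⟨ +-congˡ e⋆≈e ⟨
        (- e) ⋆ + e ⋆      ≈⟨ ⋆-+ (- e) e ⟨
        (- e + e) ⋆        ≈⟨ ⋆-cong (-‿inverseˡ e) ⟩
        0# ⋆               ≈⟨ Matrices.0⋆≈0 starRing ⟩
        0#                 ∎)

    evaluation-inclusion : ∀ a → ⟦ evaluation ⟧ (⟦ inclusion ⟧ a) ≈ a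
    evaluation-inclusion a = trans (+-congˡ (·-zeroˡ A e)) (+-identityʳ a)

    -- The first map takes its values in A, whose elements are killed by 1 - `e`.
    splitting⊥ : Orthogonal (inclusion ∘ʰ evaluation) (coscalar ∘ʰ scalarPart)
    splitting⊥ (a , z) (b , w) = (begin
        x * (w · - e) + (0ᶜ · w · - e + w · x)
          ≈⟨ +-cong (trans (·-*-assocʳ w x (- e)) (·-cong C.refl
                (trans (sym (-‿distribʳ-* x e)) (-‿cong (identityʳ x)))))
              (trans (+-congʳ (·-zeroˡ A _)) (+-identityˡ (w · x))) ⟩
        w · - x + w · x
          ≈⟨ ·-distribˡ w (- x) x ⟨
        w · (- x + x)
          ≈⟨ ·-cong C.refl (-‿inverseˡ x) ⟩
        w · 0#
          ≈⟨ ·-zeroʳ A w ⟩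
        0# ∎) , C.zeroˡ w
      where
      x = a + z · e

    splitting : ∀ x → x A⁺.≈ ⟦ inclusion ∘ʰ evaluation ⟧ x A⁺.+ ⟦ coscalar ∘ʰ scalarPart ⟧ x
    splitting (a , z) = sym (begin
        (a + z · e) + z · - e    ≈⟨ +-assoc a _ _ ⟩
        a + (z · e + z · - e)    ≈⟨ +-congˡ (·-distribˡ z e (- e)) ⟨
        a + z · (e + - e)        ≈⟨ +-congˡ (trans (·-cong C.refl (-‿inverseʳ e)) (·-zeroʳ A z)) ⟩
        a + 0#                   ≈⟨ +-identityʳ a ⟩
        a                        ∎) , C.sym (C.+-identityˡ z)

-- Abstracts from the encoding of kernels by pairs: elements are compared only through `embed`, and
-- constructed only through `restrict`.
record IsKernel {c₁ ℓ₁ c₂ ℓ₂ c₃ ℓ₃ : Level} (G : AbelianGroup c₁ ℓ₁) (H : AbelianGroup c₂ ℓ₂)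
  (f : AbelianGroup.Carrier G → AbelianGroup.Carrier H) (K : AbelianGroup c₃ ℓ₃) :
  Set (c₁ ⊔ ℓ₁ ⊔ c₂ ⊔ ℓ₂ ⊔ c₃ ⊔ ℓ₃) where
  private
    module G = AbelianGroup G
    module H = AbelianGroup H
    module K = AbelianGroup K
  open GroupMorphisms K.rawGroup G.rawGroup
  field
    embed           : K.Carrier → G.Carrier
    isMonomorphism  : IsGroupMonomorphism embed
    vanishes        : ∀ x → f (embed x) H.≈ H.ε
    restrict        : ∀ g → f g H.≈ H.ε → K.Carrier
    embed-restrict  : ∀ g (e : f g H.≈ H.ε) → embed (restrict g e) G.≈ g

  open IsGroupMonomorphism isMonomorphism public

  embed-sum : ∀ {n} (x : Fin n → K.Carrier) →
    embed (CMSum.sum K.commutativeMonoid x) G.≈ CMSum.sum G.commutativeMonoid (embed ∘ x)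
  embed-sum = Biproduct.hom-sum K G isGroupHomomorphism

module _ {c₁ ℓ₁ c₂ ℓ₂ c₃ ℓ₃ c₄ ℓ₄ c₅ ℓ₅ c₆ ℓ₆ : Level}
         {G : AbelianGroup c₁ ℓ₁} {H : AbelianGroup c₂ ℓ₂} {f : AbelianGroup.Carrier G → AbelianGroup.Carrier H}
         {K : AbelianGroup c₃ ℓ₃} (ker : IsKernel G H f K)
         {G′ : AbelianGroup c₄ ℓ₄} {H′ : AbelianGroup c₅ ℓ₅} {f′ : AbelianGroup.Carrier G′ → AbelianGroup.Carrier H′}
         {K′ : AbelianGroup c₆ ℓ₆} (ker′ : IsKernel G′ H′ f′ K′) where
  private
    module G = AbelianGroup G
    module K = AbelianGroup K
    module G′ = AbelianGroup G′
    module H′ = AbelianGroup H′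
    module K′ = AbelianGroup K′
    module ker = IsKernel ker
    module ker′ = IsKernel ker′
    module GG′ = GroupMorphisms G.rawGroup G′.rawGroup

  module _ (F : G.Carrier → G′.Carrier) (f′F≈ε : ∀ x → f′ (F x) H′.≈ H′.ε) where

    -- `F` sends all of `G` into the kernel of `f′`, not only the kernel of `f`. This is the
    -- situation of maps A⁺ → B⁺ with values in the ideal B, whose scalar part is zero.
    kernelMap : K.Carrier → K′.Carrier
    kernelMap x = ker′.restrict (F (ker.embed x)) (f′F≈ε _)

    embed-kernelMap : ∀ x → ker′.embed (kernelMap x) G′.≈ F (ker.embed x)
    embed-kernelMap x = ker′.embed-restrict _ _

    kernelMap-isHomomorphism : GG′.IsGroupHomomorphism F →
      GroupMorphisms.IsGroupHomomorphism K.rawGroup K′.rawGroup kernelMap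
    kernelMap-isHomomorphism F-hom = record
      { isMonoidHomomorphism = record
        { isMagmaHomomorphism = record
          { isRelHomomorphism = record
            { cong = λ x≈y → reflect (Hom.⟦⟧-cong (ker.⟦⟧-cong x≈y)) (embed-kernelMap _) (embed-kernelMap _) }
          ; homo = λ x y → reflect (G′.trans (Hom.⟦⟧-cong (ker.∙-homo x y)) (Hom.homo _ _)) (embed-kernelMap _)
              (G′.trans (ker′.∙-homo _ _) (G′.∙-cong (embed-kernelMap x) (embed-kernelMap y)))
          }
        ; ε-homo = reflect (G′.trans (Hom.⟦⟧-cong ker.ε-homo) Hom.ε-homo) (embed-kernelMap _) ker′.ε-homo
        }
      ; ⁻¹-homo = λ x → reflect (G′.trans (Hom.⟦⟧-cong (ker.⁻¹-homo x)) (Hom.⁻¹-homo _)) (embed-kernelMap _)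
          (G′.trans (ker′.⁻¹-homo _) (G′.⁻¹-cong (embed-kernelMap x)))
      }
      where
      module Hom = GG′.IsGroupHomomorphism F-hom

      reflect : ∀ {g h x y} → g G′.≈ h → ker′.embed x G′.≈ g → ker′.embed y G′.≈ h → x K′.≈ y
      reflect g≈h x≈g y≈h = ker′.injective (G′.trans x≈g (G′.trans g≈h (G′.sym y≈h)))

-- Applied to V = K₀₀ and V₀ = K₀.
module UnitalK₀ (ℝ : RealField)
  (V : ∀ {c ℓ} → StarRing c ℓ → AbelianGroup (c ⊔ ℓ) (c ⊔ ℓ))
  (map : ∀ {c₁ ℓ₁ c₂ ℓ₂} {R : StarRing c₁ ℓ₁} {S : StarRing c₂ ℓ₂} →
         StarRingHom R S → AbelianGroup.Carrier (V R) → AbelianGroup.Carrier (V S))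
  (additive : IsAdditive V map)
  (V₀ : ∀ {c ℓ} → CStar.CStarAlgebra ℝ c ℓ → AbelianGroup (c ⊔ ℓ) (c ⊔ ℓ))
  (isKernel : ∀ {c ℓ} (A : CStar.CStarAlgebra ℝ c ℓ) →
     IsKernel (V (CStar.KTheory.unitization ℝ A)) (V (Complex.ℂ-starRing ℝ))
       (map {R = CStar.KTheory.unitization ℝ A} {S = Complex.ℂ-starRing ℝ} (CStar.KTheory.scalarPart ℝ A)) (V₀ A))
  where
  open CStar ℝ
  open Unital ℝ
  open KTheory using (unitization; scalarPart)
  open IsAdditive additive

  private
    module C = StarRing ℂ-starRing
    module Vℂ = AbelianGroup (V ℂ-starRing)

  module _ {c₁ ℓ₁ c₂ ℓ₂ : Level} (A : CStarAlgebra c₁ ℓ₁) (B : CStarAlgebra c₂ ℓ₂)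
           (unitA : Unit A) (unitB : Unit B) where
    private
      module A = CStarAlgebra A
      module B = CStarAlgebra B
      module A⁺ = StarRing (unitization A)
      module B⁺ = StarRing (unitization B)
      module VB = AbelianGroup (V (unitization B))
      module V₀A = AbelianGroup (V₀ A)
      module V₀B = AbelianGroup (V₀ B)
      module SA = Splitting unitA
      module SB = Splitting unitB
      module kerA = IsKernel (isKernel A)
      module kerB = IsKernel (isKernel B)

    -- Takes the place of the unital extension A⁺ → B⁺ of `f`. Because the scalar part of its values
    -- is zero, the corners of orthogonal homomorphisms are again orthogonal, and their sum is the
    -- corner of the sum.
    corner : StarRingHom A.starRing B.starRing → StarRingHom (unitization A) (unitization B)
    corner f = SB.inclusion ∘ʰ f ∘ʰ SA.evaluation

    private
      vanishing : ∀ f x → map (scalarPart B) (map (corner f) x) Vℂ.≈ Vℂ.ε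
      vanishing f x = Vℂ.trans
        (map-∘ (scalarPart B) (corner f) (zeroʰ (unitization A) ℂ-starRing) (λ _ → C.refl) x)
        (map-zero x)

    V₀-map : StarRingHom A.starRing B.starRing → V₀A.Carrier → V₀B.Carrier
    V₀-map f = kernelMap (isKernel A) (isKernel B) (map (corner f)) (vanishing f)

    embed-V₀-map : ∀ f x → kerB.embed (V₀-map f x) VB.≈ map (corner f) (kerA.embed x)
    embed-V₀-map f = embed-kernelMap (isKernel A) (isKernel B) (map (corner f)) (vanishing f)

    V₀-map-isHomomorphism : ∀ f → GroupMorphisms.IsGroupHomomorphism V₀A.rawGroup V₀B.rawGroup (V₀-map f)
    V₀-map-isHomomorphism f =
      kernelMap-isHomomorphism (isKernel A) (isKernel B) (map (corner f)) (vanishing f) (isHomomorphism (corner f))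

    V₀-map-zero : ∀ f → (∀ a → ⟦ f ⟧ a B.≈ B.0#) → ∀ x → V₀-map f x V₀B.≈ V₀B.ε
    V₀-map-zero f f≈0 x = kerB.injective (VB.trans (embed-V₀-map f x) (VB.trans
      (map-ext (corner f) (zeroʰ (unitization A) (unitization B)) (λ _ → f≈0 _ , C.refl) (kerA.embed x))
      (VB.trans (map-zero (kerA.embed x)) (VB.sym kerB.ε-homo))))

    V₀-map-sum : ∀ {n} (χ : Fin n → StarRingHom A.starRing B.starRing) → PairwiseOrthogonal χ →
      (f : StarRingHom A.starRing B.starRing) →
      (∀ a → ⟦ f ⟧ a B.≈ Matrices.sum B.starRing (λ i → ⟦ χ i ⟧ a)) →
      ∀ x → V₀-map f x V₀B.≈ CMSum.sum V₀B.commutativeMonoid (λ i → V₀-map (χ i) x)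
    V₀-map-sum χ χ⊥ f f≈ x = kerB.injective (begin
        kerB.embed (V₀-map f x)
          ≈⟨ embed-V₀-map f x ⟩
        map (corner f) (kerA.embed x)
          ≈⟨ map-sum (corner ∘ χ)
               (λ i j i≢j a b → B⁺.trans (B⁺.sym (*-homo SB.inclusion _ _)) (χ⊥ i j i≢j _ _ , C.refl))
               (corner f)
               (λ a → B⁺.trans (f≈ (⟦ SA.evaluation ⟧ a) , C.refl {0ᶜ})
                 (sum-homo SB.inclusion (λ i → ⟦ χ i ⟧ (⟦ SA.evaluation ⟧ a)))) (kerA.embed x) ⟩
        ΣV.sum (λ i → map (corner (χ i)) (kerA.embed x))
          ≈⟨ ΣV.sum-cong-≋ (λ i → embed-V₀-map (χ i) x) ⟨
        ΣV.sum (λ i → kerB.embed (V₀-map (χ i) x))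
          ≈⟨ kerB.embed-sum (λ i → V₀-map (χ i) x) ⟨
        kerB.embed (CMSum.sum V₀B.commutativeMonoid (λ i → V₀-map (χ i) x)) ∎)
      where
      module ΣV = CMSum VB.commutativeMonoid
      open SetoidReasoning VB.setoid

  module _ {c ℓ : Level} (A : CStarAlgebra c ℓ) (unit : Unit A) where
    private
      module A = CStarAlgebra A
      module A⁺ = StarRing (unitization A)
      module VA = AbelianGroup (V (unitization A))
      module V₀A = AbelianGroup (V₀ A)
      module S = Splitting unit
      module ker = IsKernel (isKernel A)

    -- The second summand of the splitting of A⁺ contributes nothing to V₀(A).
    V₀-map-id : ∀ f → (∀ a → ⟦ f ⟧ a A.≈ a) → ∀ x → V₀-map A A unit unit f x V₀A.≈ x
    V₀-map-id f f≈id x = ker.injective (begin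
        ker.embed (V₀-map A A unit unit f x)  ≈⟨ embed-V₀-map A A unit unit f x ⟩
        map F z                               ≈⟨ VA.identityʳ (map F z) ⟨
        map F z VA.∙ VA.ε                     ≈⟨ VA.∙-congˡ vanish ⟨
        map F z VA.∙ map J z                  ≈⟨ map-+ F J id⁺ F⊥J split z ⟨
        map id⁺ z                             ≈⟨ map-id id⁺ (λ _ → A⁺.refl) z ⟩
        z                                     ∎)
      where
      open SetoidReasoning VA.setoid
      z = ker.embed x
      F J id⁺ : StarRingHom (unitization A) (unitization A)
      F   = corner A A unit unit f
      J   = S.coscalar ∘ʰ scalarPart A
      id⁺ = idʰ (unitization A)

      F≈ : ∀ a → ⟦ F ⟧ a A⁺.≈ ⟦ S.inclusion ∘ʰ S.evaluation ⟧ a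
      F≈ a = f≈id (⟦ S.evaluation ⟧ a) , C.refl {0ᶜ}

      F⊥J : Orthogonal F J
      F⊥J a b = A⁺.trans (A⁺.*-congʳ {⟦ J ⟧ b} (F≈ a)) (S.splitting⊥ a b)

      split : ∀ a → a A⁺.≈ ⟦ F ⟧ a A⁺.+ ⟦ J ⟧ a
      split a = A⁺.trans (S.splitting a) (A⁺.+-congʳ {⟦ J ⟧ a} (A⁺.sym (F≈ a)))

      vanish : map J z VA.≈ VA.ε
      vanish = begin
        map J z                                ≈⟨ map-∘ S.coscalar (scalarPart A) J (λ _ → A⁺.refl) z ⟨
        map S.coscalar (map (scalarPart A) z)  ≈⟨ Hom.⟦⟧-cong (ker.vanishes x) ⟩
        map S.coscalar Vℂ.ε                    ≈⟨ Hom.ε-homo ⟩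
        VA.ε                                   ∎
        where
        module Hom = GroupMorphisms.IsGroupHomomorphism (isHomomorphism S.coscalar)

  module _ {c₁ ℓ₁ c₂ ℓ₂ c₃ ℓ₃ : Level}
           (A : CStarAlgebra c₁ ℓ₁) (B : CStarAlgebra c₂ ℓ₂) (C : CStarAlgebra c₃ ℓ₃)
           (unitA : Unit A) (unitB : Unit B) (unitC : Unit C) where
    private
      module A = CStarAlgebra A
      module B = CStarAlgebra B
      module C′ = CStarAlgebra C
      module VC = AbelianGroup (V (unitization C))

    -- Corners compose because `evaluation` undoes `inclusion` in the middle algebra `B`.
    V₀-map-∘ : ∀ (g : StarRingHom B.starRing C′.starRing) (f : StarRingHom A.starRing B.starRing) h →
      (∀ a → ⟦ h ⟧ a C′.≈ ⟦ g ⟧ (⟦ f ⟧ a)) →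
      ∀ x → AbelianGroup._≈_ (V₀ C) (V₀-map B C unitB unitC g (V₀-map A B unitA unitB f x))
                                    (V₀-map A C unitA unitC h x)
    V₀-map-∘ g f h h≈ x = IsKernel.injective (isKernel C) (begin
        embedC (V₀-map B C unitB unitC g (V₀-map A B unitA unitB f x))
          ≈⟨ embed-V₀-map B C unitB unitC g _ ⟩
        map g⁺ (IsKernel.embed (isKernel B) (V₀-map A B unitA unitB f x))
          ≈⟨ Hom.⟦⟧-cong (embed-V₀-map A B unitA unitB f x) ⟩
        map g⁺ (map f⁺ (IsKernel.embed (isKernel A) x))
          ≈⟨ map-∘ g⁺ f⁺ h⁺ (λ a → C′.trans (h≈ (⟦ SA.evaluation ⟧ a))
               (⟦⟧-cong g (B.sym (Splitting.evaluation-inclusion unitB (⟦ f ⟧ (⟦ SA.evaluation ⟧ a))))) , C.refl) _ ⟩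
        map h⁺ (IsKernel.embed (isKernel A) x)
          ≈⟨ embed-V₀-map A C unitA unitC h x ⟨
        embedC (V₀-map A C unitA unitC h x) ∎)
      where
      open SetoidReasoning VC.setoid
      module SA = Splitting unitA
      embedC = IsKernel.embed (isKernel C)
      f⁺ = corner A B unitA unitB f
      g⁺ = corner B C unitB unitC g
      h⁺ = corner A C unitA unitC h
      module Hom = GroupMorphisms.IsGroupHomomorphism (isHomomorphism g⁺)

record Decomposition {ℝ : RealField} {c ℓ : Level} (A B : CStar.CStarAlgebra ℝ c ℓ) (n : ℕ) : Set (c ⊔ ℓ) where
  open CStar ℝ
  private
    module A = CStarAlgebra A
    module B = CStarAlgebra B
  field
    proj : Fin n → StarHom A B
    incl : Fin n → StarHom B A

  projʰ : Fin n → StarRingHom A.starRing B.starRing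
  projʰ i = StarHom.starRingHom (proj i)

  inclʰ : Fin n → StarRingHom B.starRing A.starRing
  inclʰ i = StarHom.starRingHom (incl i)

  field
    incl⊥         : PairwiseOrthogonal inclʰ
    proj-incl     : ∀ i x → ⟦ projʰ i ⟧ (⟦ inclʰ i ⟧ x) B.≈ x
    proj-incl-≢   : ∀ i j → i ≢ j → ∀ x → ⟦ projʰ i ⟧ (⟦ inclʰ j ⟧ x) B.≈ B.0#
    sum-incl-proj : ∀ x → Matrices.sum A.starRing (λ i → ⟦ inclʰ i ⟧ (⟦ projʰ i ⟧ x)) A.≈ x

module DecomposeV₀ (ℝ : RealField)
  (V : ∀ {c ℓ} → StarRing c ℓ → AbelianGroup (c ⊔ ℓ) (c ⊔ ℓ))
  (map : ∀ {c₁ ℓ₁ c₂ ℓ₂} {R : StarRing c₁ ℓ₁} {S : StarRing c₂ ℓ₂} →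
         StarRingHom R S → AbelianGroup.Carrier (V R) → AbelianGroup.Carrier (V S))
  (additive : IsAdditive V map)
  (V₀ : ∀ {c ℓ} → CStar.CStarAlgebra ℝ c ℓ → AbelianGroup (c ⊔ ℓ) (c ⊔ ℓ))
  (isKernel : ∀ {c ℓ} (A : CStar.CStarAlgebra ℝ c ℓ) →
     IsKernel (V (CStar.KTheory.unitization ℝ A)) (V (Complex.ℂ-starRing ℝ))
       (map {R = CStar.KTheory.unitization ℝ A} {S = Complex.ℂ-starRing ℝ} (CStar.KTheory.scalarPart ℝ A)) (V₀ A))
  {c ℓ : Level}
  (A B : CStar.CStarAlgebra ℝ c ℓ) (unitA : Unital.Unit ℝ A) (unitB : Unital.Unit ℝ B)
  {n : ℕ} (dec : Decomposition A B n) where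
  open CStar ℝ
  open UnitalK₀ ℝ V map additive V₀ isKernel
  open Decomposition dec
  private
    module A = CStarAlgebra A
    module B = CStarAlgebra B
    module V₀A = AbelianGroup (V₀ A)
    module V₀B = AbelianGroup (V₀ B)
    module ΣA = CMSum V₀A.commutativeMonoid

    Φ : Fin n → V₀A.Carrier → V₀B.Carrier
    Φ i = V₀-map A B unitA unitB (projʰ i)

    Ψ : Fin n → V₀B.Carrier → V₀A.Carrier
    Ψ i = V₀-map B A unitB unitA (inclʰ i)

    ΦΨ : Fin n → Fin n → V₀B.Carrier → V₀B.Carrier
    ΦΨ i j = V₀-map B B unitB unitB (projʰ i ∘ʰ inclʰ j)

    ΦΨ≈ : ∀ i j x → Φ i (Ψ j x) V₀B.≈ ΦΨ i j x
    ΦΨ≈ i j x = V₀-map-∘ B A B unitB unitA unitB (projʰ i) (inclʰ j) (projʰ i ∘ʰ inclʰ j) (λ _ → B.refl) x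

    -- The endomorphisms `inclʰ i ∘ʰ projʰ i` are orthogonal with sum the identity of `A`, so that
    -- additivity decomposes the identity of `V₀ A`.
    ΣΨΦ≈ : ∀ x → ΣA.sum (λ i → Ψ i (Φ i x)) V₀A.≈ x
    ΣΨΦ≈ x = V₀A.trans
      (ΣA.sum-cong-≋ λ i →
        V₀-map-∘ A B A unitA unitB unitA (inclʰ i) (projʰ i) (inclʰ i ∘ʰ projʰ i) (λ _ → A.refl) x)
      (V₀A.trans
        (V₀A.sym (V₀-map-sum A A unitA unitA (λ i → inclʰ i ∘ʰ projʰ i)
          (λ i j i≢j a b → incl⊥ i j i≢j _ _) (idʰ A.starRing) (λ a → A.sym (sum-incl-proj a)) x))
        (V₀-map-id A unitA (idʰ A.starRing) (λ _ → A.refl) x))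

  V₀-decompose : V₀A.rawGroup ≅ᴳ V₀B.rawGroup ^ᴳ n
  V₀-decompose = Biproduct.biproduct (V₀ A) (V₀ B) Φ Ψ
    (λ i → V₀-map-isHomomorphism A B unitA unitB (projʰ i))
    (λ i → GroupMorphisms.IsGroupHomomorphism.⟦⟧-cong (V₀-map-isHomomorphism B A unitB unitA (inclʰ i)))
    (λ i x → V₀B.trans (ΦΨ≈ i i x) (V₀-map-id B unitB (projʰ i ∘ʰ inclʰ i) (proj-incl i) x))
    (λ i j i≢j x → V₀B.trans (ΦΨ≈ i j x)
      (V₀-map-zero B B unitB unitB (projʰ i ∘ʰ inclʰ j) (proj-incl-≢ i j i≢j) x))
    ΣΨΦ≈

module _ (ℝ : RealField) {c ℓ : Level} (A : CStar.CStarAlgebra ℝ c ℓ) where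
  open CStar ℝ using (module KTheory)
  private
    module A⁺ = StarRing (KTheory.unitization A)
    module V = AbelianGroup (K₀₀ (KTheory.unitization A))
    open Matrices (KTheory.unitization A) using (0ₚ; ∼-permute)

  K₀-isKernel : IsKernel (K₀₀ (CStar.KTheory.unitization ℝ A)) (K₀₀ (Complex.ℂ-starRing ℝ))
    (K₀₀-map {R = CStar.KTheory.unitization ℝ A} {S = Complex.ℂ-starRing ℝ} (CStar.KTheory.scalarPart ℝ A))
    (KTheory.K₀ A)
  K₀-isKernel = record
    { embed          = proj₁
    ; isMonomorphism = record
      { isGroupHomomorphism = record
        { isMonoidHomomorphism = record
          { isMagmaHomomorphism = record
            { isRelHomomorphism = record { cong = λ p → p }
            ; homo = λ _ _ → 0ₚ , ∼-permute Permutation.id λ _ _ → A⁺.refl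
            }
          ; ε-homo = V.refl {V.ε}
          }
        ; ⁻¹-homo = λ _ → 0ₚ , ∼-permute Permutation.id λ _ _ → A⁺.refl
        }
      ; injective = λ p → p
      }
    ; vanishes       = proj₂
    ; restrict       = _,_
    ; embed-restrict = λ g _ → V.refl {g}
    }

K₀-decompose : ∀ (ℝ : RealField) {c ℓ} (A B : CStar.CStarAlgebra ℝ c ℓ) →
  Unital.Unit ℝ A → Unital.Unit ℝ B → ∀ {n} → Decomposition A B n →
  CStar.K ℝ zero A ≅ᴳ CStar.K ℝ zero B ^ᴳ n
K₀-decompose ℝ A B unitA unitB dec =
  DecomposeV₀.V₀-decompose ℝ K₀₀ K₀₀-map K₀₀-isAdditive (CStar.KTheory.K₀ ℝ) (K₀-isKernel ℝ) A B unitA unitB dec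

-- K₁ of direct sums

coordinate : ∀ {c ℓ} {R : StarRing c ℓ} {n} → Fin n → StarRingHom (power R n) R
coordinate {R = R} i = record
  { ⟦_⟧ = λ x → x i ; ⟦⟧-cong = λ p → p i
  ; +-homo = λ _ _ → refl ; *-homo = λ _ _ → refl ; ⋆-homo = λ _ → refl }
  where open StarRing R

-- 1 + x is unitary.
Unitary¹⁺ : ∀ {c ℓ} (R : StarRing c ℓ) {n} → Matrices.Mat R n n → Set ℓ
Unitary¹⁺ R x = (x ⊞ x † ⊞ x † ⊡ x) ≋ 𝟘 × (x ⊞ x † ⊞ x ⊡ x †) ≋ 𝟘
  where open Matrices R

module _ {c₁ ℓ₁ c₂ ℓ₂ : Level} {R : StarRing c₁ ℓ₁} {S : StarRing c₂ ℓ₂} (φ : StarRingHom R S) where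
  private
    module R = StarRing R
    module S = StarRing S
    module MR = Matrices R
    module MS = Matrices S

  mapMat-† : ∀ {m n} (x : MR.Mat m n) → mapMat φ (x MR.†) MS.≋ mapMat φ x MS.†
  mapMat-† x i j = ⋆-homo φ (x j i)

  -- Both conditions are ⋆-polynomials in `x` without constant term, so that a homomorphism
  -- preserves them whatever it does to units.
  mapMat-Unitary : ∀ {n} {x : MR.Mat n n} → Unitary¹⁺ R x → Unitary¹⁺ S (mapMat φ x)
  mapMat-Unitary {x = x} (p , q) =
      expand (x MR.†) x (MS.⊡-cong (mapMat-† x) MS.≋-refl) p
    , expand x (x MR.†) (MS.⊡-cong {X = mapMat φ x} MS.≋-refl (mapMat-† x)) q
    where
    expand : ∀ a b {e} → mapMat φ a MS.⊡ mapMat φ b MS.≋ e → (x MR.⊞ x MR.† MR.⊞ a MR.⊡ b) MR.≋ MR.𝟘 →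
             (mapMat φ x MS.⊞ mapMat φ x MS.† MS.⊞ e) MS.≋ MS.𝟘
    expand a b {e} e≈ p i j = begin
      (⟦ φ ⟧ (x i j) S.+ ⟦ φ ⟧ (x j i) S.⋆) S.+ e i j
        ≈⟨ S.+-cong (S.+-congˡ (⋆-homo φ (x j i))) (S.trans (⊡-homo φ a b i j) (e≈ i j)) ⟨
      (⟦ φ ⟧ (x i j) S.+ ⟦ φ ⟧ (x j i R.⋆)) S.+ ⟦ φ ⟧ ((a MR.⊡ b) i j)
        ≈⟨ S.trans (+-homo φ _ _) (S.+-congʳ (+-homo φ _ _)) ⟨
      ⟦ φ ⟧ ((x i j R.+ x j i R.⋆) R.+ (a MR.⊡ b) i j)
        ≈⟨ S.trans (⟦⟧-cong φ (p i j)) (0-homo φ) ⟩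
      S.0# ∎
      where open SetoidReasoning S.setoid

-- Only the matrix product takes an argument: finite sums in `power R n` are componentwise because
-- `coordinate` is a homomorphism.
power-Unitary : ∀ {c ℓ} (R : StarRing c ℓ) {n k} (x : Fin n → Matrices.Mat R k k) →
                (∀ i → Unitary¹⁺ R (x i)) → Unitary¹⁺ (power R n) (λ a b i → x i a b)
power-Unitary R {n} {k} x unitary =
    (λ a b i → trans (+-congˡ (sum-homo (coordinate {R = R} i) {k} (λ l j → x j l a ⋆ * x j l b)))
                     (proj₁ (unitary i) a b))
  , (λ a b i → trans (+-congˡ (sum-homo (coordinate {R = R} i) {k} (λ l j → x j a l * x j b l ⋆)))
                     (proj₂ (unitary i) a b))
  where open StarRing R

-- Padding matrices with zeros

module Padding {ℝ : RealField} {c ℓ : Level} (A : CStar.CStarAlgebra ℝ c ℓ) where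
  open CStar ℝ
  open CStarAlgebra A
  open KTheory A
  open Matrices starRing
  open SetoidReasoning setoid

  -- All paddings of `x` are restrictions of this one function on ℕ × ℕ, which makes sums over index
  -- ranges of different lengths comparable.
  extend : ∀ {n} → Mat n n → ℕ → ℕ → Carrier
  extend {n} x p q with p <? n | q <? n
  ... | yes p<n | yes q<n = x (fromℕ< p<n) (fromℕ< q<n)
  ... | _       | _       = 0#

  pad≡extend : ∀ {n} k (x : Mat n n) i j → pad k x i j ≡ extend x (toℕ i) (toℕ j)
  pad≡extend {n} k x i j with toℕ i <? n | toℕ j <? n
  ... | yes _ | yes _ = ≡.refl
  ... | yes _ | no _  = ≡.refl
  ... | no _  | _     = ≡.refl

  extend-inside : ∀ {n} (x : Mat n n) i j → extend x (toℕ i) (toℕ j) ≡ x i j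
  extend-inside {n} x i j with toℕ i <? n | toℕ j <? n
  ... | yes p | yes q = ≡.cong₂ x (fromℕ<-toℕ i p) (fromℕ<-toℕ j q)
  ... | no i≮n | _    = contradiction (toℕ<n i) i≮n
  ... | yes _ | no j≮n = contradiction (toℕ<n j) j≮n

  extend-outsideˡ : ∀ {n} (x : Mat n n) p q → n ℕ.≤ p → extend x p q ≡ 0#
  extend-outsideˡ {n} x p q n≤p with p <? n | q <? n
  ... | yes p<n | _ = contradiction p<n (ℕ.≤⇒≯ n≤p)
  ... | no _    | _ = ≡.refl

  extend-outsideʳ : ∀ {n} (x : Mat n n) p q → n ℕ.≤ q → extend x p q ≡ 0#
  extend-outsideʳ {n} x p q n≤q with p <? n | q <? n
  ... | _     | yes q<n = contradiction q<n (ℕ.≤⇒≯ n≤q)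
  ... | yes _ | no _    = ≡.refl
  ... | no _  | no _    = ≡.refl

  pad-cong : ∀ {n} k {x y : Mat n n} → x ≋ y → pad k x ≋ pad k y
  pad-cong {n} k x≋y i j with toℕ i <? n | toℕ j <? n
  ... | yes _ | yes _ = x≋y _ _
  ... | yes _ | no _  = refl
  ... | no _  | _     = refl

  pad-† : ∀ {n} k (x : Mat n n) → pad k (x †) ≋ pad k x †
  pad-† {n} k x i j with toℕ i <? n | toℕ j <? n
  ... | yes _ | yes _ = refl
  ... | yes _ | no _  = sym 0⋆≈0
  ... | no _  | yes _ = sym 0⋆≈0
  ... | no _  | no _  = sym 0⋆≈0

  pad-⊞ : ∀ {n} k (x y : Mat n n) → pad k (x ⊞ y) ≋ pad k x ⊞ pad k y
  pad-⊞ {n} k x y i j with toℕ i <? n | toℕ j <? n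
  ... | yes _ | yes _ = refl
  ... | yes _ | no _  = sym (+-identityˡ 0#)
  ... | no _  | _     = sym (+-identityˡ 0#)

  pad-𝟘 : ∀ {n} k → pad k (𝟘 {n} {n}) ≋ 𝟘
  pad-𝟘 {n} k i j with toℕ i <? n | toℕ j <? n
  ... | yes _ | yes _ = refl
  ... | yes _ | no _  = refl
  ... | no _  | _     = refl

  sum-truncate : ∀ {n k} (f : ℕ → Carrier) → n ℕ.≤ k → (∀ p → n ℕ.≤ p → f p ≈ 0#) →
                 sum {k} (f ∘ toℕ) ≈ sum {n} (f ∘ toℕ)
  sum-truncate {k = k} f z≤n f≈0 = sum-zero {k} λ i → f≈0 (toℕ i) z≤n
  sum-truncate f (s≤s n≤k) f≈0 = +-congˡ (sum-truncate (f ∘ ℕ.suc) n≤k λ p n≤p → f≈0 (ℕ.suc p) (s≤s n≤p))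

  pad-⊡ : ∀ {n k} (x y : Mat n n) → n ℕ.≤ k → pad k (x ⊡ y) ≋ pad k x ⊡ pad k y
  pad-⊡ {n} {k} x y n≤k i j = sym (begin
    sum {k} (λ l → pad k x i l * pad k y l j)
      ≈⟨ sum-cong-≋ {k} (λ l → reflexive (≡.cong₂ _*_ (pad≡extend k x i l) (pad≡extend k y l j))) ⟩
    sum {k} (λ l → extend x p (toℕ l) * extend y (toℕ l) q)
      ≈⟨ sum-truncate (λ r → extend x p r * extend y r q) n≤k
           (λ r n≤r → trans (*-congʳ (reflexive (extend-outsideʳ x p r n≤r))) (zeroˡ _)) ⟩
    sum {n} (λ l → extend x p (toℕ l) * extend y (toℕ l) q)
      ≈⟨ product p q ⟩
    extend (x ⊡ y) p q
      ≡⟨ pad≡extend k (x ⊡ y) i j ⟨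
    pad k (x ⊡ y) i j ∎)
    where
    p = toℕ i
    q = toℕ j

    product : ∀ p q → sum {n} (λ l → extend x p (toℕ l) * extend y (toℕ l) q) ≈ extend (x ⊡ y) p q
    product p q with ℕ.<-≤-connex p n | ℕ.<-≤-connex q n
    ... | inj₂ n≤p | _ = trans
      (sum-zero {n} λ l → trans (*-congʳ (reflexive (extend-outsideˡ x p (toℕ l) n≤p))) (zeroˡ _))
      (reflexive (≡.sym (extend-outsideˡ (x ⊡ y) p q n≤p)))
    ... | inj₁ _ | inj₂ n≤q = trans
      (sum-zero {n} λ l → trans (*-congˡ (reflexive (extend-outsideʳ y (toℕ l) q n≤q))) (zeroʳ _))
      (reflexive (≡.sym (extend-outsideʳ (x ⊡ y) p q n≤q)))
    -- Inside the block, `p` and `q` are replaced by `toℕ` of indices below `n`, to which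
    -- `extend-inside` applies.
    ... | inj₁ p<n | inj₁ q<n = ≡.subst₂
      (λ p q → sum {n} (λ l → extend x p (toℕ l) * extend y (toℕ l) q) ≈ extend (x ⊡ y) p q)
      (toℕ-fromℕ< p<n) (toℕ-fromℕ< q<n)
      (trans (sum-cong-≋ {n} λ l → reflexive (≡.cong₂ _*_ (extend-inside x _ l) (extend-inside y l _)))
             (reflexive (≡.sym (extend-inside (x ⊡ y) _ _))))

  pad-pad : ∀ {n k} m (x : Mat n n) → n ℕ.≤ k → pad m (pad k x) ≋ pad m x
  pad-pad {n} {k} m x n≤k i j = reflexive (≡.trans (pad≡extend m (pad k x) i j)
    (≡.trans (lemma (toℕ i) (toℕ j)) (≡.sym (pad≡extend m x i j))))
    where
    lemma : ∀ p q → extend (pad k x) p q ≡ extend x p q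
    lemma p q with ℕ.<-≤-connex p k | ℕ.<-≤-connex q k
    ... | inj₂ k≤p | _ = ≡.trans (extend-outsideˡ (pad k x) p q k≤p)
      (≡.sym (extend-outsideˡ x p q (ℕ.≤-trans n≤k k≤p)))
    ... | inj₁ _ | inj₂ k≤q = ≡.trans (extend-outsideʳ (pad k x) p q k≤q)
      (≡.sym (extend-outsideʳ x p q (ℕ.≤-trans n≤k k≤q)))
    ... | inj₁ p<k | inj₁ q<k = ≡.subst₂ (λ p q → extend (pad k x) p q ≡ extend x p q)
      (toℕ-fromℕ< p<k) (toℕ-fromℕ< q<k)
      (≡.trans (extend-inside (pad k x) _ _) (pad≡extend k x _ _))

  pad-unitary : ∀ {n k} {x : Mat n n} → n ℕ.≤ k → IsUnitary x → IsUnitary (pad k x)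
  pad-unitary {n} {k} {x} n≤k (p , q) =
      combine (x †) x (⊡-cong {Y = pad k x} (pad-† k x) ≋-refl) p
    , combine x (x †) (⊡-cong {X = pad k x} ≋-refl (pad-† k x)) q
    where
    combine : ∀ a b {e} → pad k a ⊡ pad k b ≋ e → (x ⊞ x † ⊞ a ⊡ b) ≋ 𝟘 →
              (pad k x ⊞ pad k x † ⊞ e) ≋ 𝟘
    combine a b {e} e≋ p i j = begin
      (pad k x i j + pad k x j i ⋆) + e i j
        ≈⟨ +-cong (+-congˡ (pad-† k x i j)) (trans (pad-⊡ a b n≤k i j) (e≋ i j)) ⟨
      (pad k x i j + pad k (x †) i j) + pad k (a ⊡ b) i j
        ≈⟨ trans (pad-⊞ k (x ⊞ x †) (a ⊡ b) i j) (+-congʳ (pad-⊞ k x (x †) i j)) ⟨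
      pad k (x ⊞ x † ⊞ a ⊡ b) i j
        ≈⟨ trans (pad-cong k p i j) (pad-𝟘 {n} k i j) ⟩
      0# ∎

mapMat-pad : ∀ {ℝ : RealField} {c₁ ℓ₁ c₂ ℓ₂} {A : CStar.CStarAlgebra ℝ c₁ ℓ₁} {B : CStar.CStarAlgebra ℝ c₂ ℓ₂}
  (φ : StarRingHom (CStar.CStarAlgebra.starRing A) (CStar.CStarAlgebra.starRing B)) →
  ∀ {n} k (x : Matrices.Mat (CStar.CStarAlgebra.starRing A) n n) →
  Matrices._≋_ (CStar.CStarAlgebra.starRing B)
    (mapMat φ (CStar.KTheory.pad ℝ A k x)) (CStar.KTheory.pad ℝ B k (mapMat φ x))
mapMat-pad {B = B} φ {n} k x i j with toℕ i <? n | toℕ j <? n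
... | yes _ | yes _ = CStar.CStarAlgebra.refl B
... | yes _ | no _  = 0-homo φ
... | no _  | _     = 0-homo φ

-- Norm bounds and continuity

module Norms {ℝ : RealField} {c ℓ : Level} (A : CStar.CStarAlgebra ℝ c ℓ) where
  open CStar ℝ
  open CStarAlgebra A
  open OrderedField ℝ
  open RingWithoutOneProperties ringWithoutOne using (-‿distribˡ-*; -‿distribʳ-*)
  open GroupProperties +-group using (⁻¹-involutive; inverseˡ-unique)

  -‿⋆ : ∀ x → (- x) ⋆ ≈ - (x ⋆)
  -‿⋆ x = inverseˡ-unique _ _ (trans (sym (⋆-+ (- x) x))
    (trans (⋆-cong (-‿inverseˡ x)) (Matrices.0⋆≈0 starRing)))

  -- `‖‖-definite` leads from norm zero to the zero element. The converse comes from homogeneity for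
  -- the scalar `0ᶜ`, which shows that the square of the norm vanishes.
  ‖0‖≤0 : ‖ 0# ‖ R.≤ R.0#
  ‖0‖≤0 = square-cancel-≤ (≈⇒≤ R.refl) (R.trans (‖‖-cong-square (sym 0·0≈0))
    (R.trans (‖‖-scale 0ᶜ 0#) (R.trans (R.*-congʳ ∣0∣²) (R.trans (R.zeroˡ _) (R.sym (R.zeroˡ _))))))
    where
    0·0≈0 : 0ᶜ · 0# ≈ 0#
    0·0≈0 = GroupProperties.identityˡ-unique +-group (0ᶜ · 0#) (0ᶜ · 0#)
      (trans (sym (·-distribˡ 0ᶜ 0# 0#)) (·-cong (R.refl , R.refl) (+-identityˡ 0#)))

    ∣0∣² : ∣ 0ᶜ ∣² R.≈ R.0#
    ∣0∣² = R.trans (R.+-cong (R.zeroˡ _) (R.zeroˡ _)) (R.+-identityˡ _)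

    ‖‖-cong-square : ∀ {x y} → x ≈ y → ‖ x ‖ R.* ‖ x ‖ R.≈ ‖ y ‖ R.* ‖ y ‖
    ‖‖-cong-square e = R.*-cong (‖‖-cong e) (‖‖-cong e)

  -- By the C⋆-identity the norm depends only on `x ⋆ * x`, which is the same for `- x`.
  ‖-‖≤ : ∀ x → ‖ - x ‖ R.≤ ‖ x ‖
  ‖-‖≤ x = square-cancel-≤ (‖‖-nonNeg x)
    (R.trans (R.sym (‖‖-C⋆ (- x))) (R.trans (‖‖-cong square) (‖‖-C⋆ x)))
    where
    square : (- x) ⋆ * - x ≈ x ⋆ * x
    square = begin
      (- x) ⋆ * - x      ≈⟨ *-congʳ (-‿⋆ x) ⟩
      - (x ⋆) * - x      ≈⟨ -‿distribˡ-* (x ⋆) (- x) ⟨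
      - (x ⋆ * - x)      ≈⟨ -‿cong (-‿distribʳ-* (x ⋆) x) ⟨
      - - (x ⋆ * x)      ≈⟨ ⁻¹-involutive _ ⟩
      x ⋆ * x            ∎
      where open SetoidReasoning setoid

module BoundedMaps (ℝ : RealField) where
  open CStar ℝ
  open OrderedField ℝ

  -- A bound is part of the data of a `StarHom`, so the homomorphisms constructed below are
  -- assembled from maps that are bounded in this sense, multiplicative or not.
  Bounded : ∀ {c₁ ℓ₁ c₂ ℓ₂} (A : CStarAlgebra c₁ ℓ₁) (B : CStarAlgebra c₂ ℓ₂) →
            (CStarAlgebra.Carrier A → CStarAlgebra.Carrier B) → Set c₁
  Bounded A B f = ∃[ K ] ∀ x → B.‖ f x ‖ R.≤ K R.* A.‖ x ‖
    where
    module A = CStarAlgebra A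
    module B = CStarAlgebra B

  module _ {c₁ ℓ₁ : Level} (A : CStarAlgebra c₁ ℓ₁) where
    open CStarAlgebra A
    open Norms A

    bounded-id : Bounded A A (λ x → x)
    bounded-id = R.1# , λ x → ≈⇒≤ (R.sym (R.*-identityˡ _))

    bounded-neg : Bounded A A (λ x → - x)
    bounded-neg = R.1# , λ x → ≤-trans (‖-‖≤ x) (≈⇒≤ (R.sym (R.*-identityˡ _)))

    bounded-*ˡ : ∀ a → Bounded A A (a *_)
    bounded-*ˡ a = ‖ a ‖ , ‖‖-* a

    bounded-*ʳ : ∀ a → Bounded A A (_* a)
    bounded-*ʳ a = ‖ a ‖ , λ x → ≤-trans (‖‖-* x a) (≈⇒≤ (R.*-comm _ _))

  module _ {c₁ ℓ₁ c₂ ℓ₂ : Level} (A : CStarAlgebra c₁ ℓ₁) (B : CStarAlgebra c₂ ℓ₂) where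
    private
      module A = CStarAlgebra A
      module B = CStarAlgebra B

    bounded-zero : Bounded A B (λ _ → B.0#)
    bounded-zero = R.0# , λ x → ≤-trans (Norms.‖0‖≤0 B) (≈⇒≤ (R.sym (R.zeroˡ _)))

    bounded-+ : ∀ {f g} → Bounded A B f → Bounded A B g → Bounded A B (λ x → f x B.+ g x)
    bounded-+ (K , f≤) (L , g≤) = K R.+ L , λ x → ≤-trans (B.‖‖-triangle _ _)
      (≤-trans (+-mono-≤ (f≤ x) (g≤ x)) (≈⇒≤ (R.sym (R.distribʳ _ K L))))

    bounded-sum : ∀ {n} {f : Fin n → A.Carrier → B.Carrier} → (∀ i → Bounded A B (f i)) →
                  Bounded A B (λ x → Matrices.sum B.starRing (λ i → f i x))
    bounded-sum {ℕ.zero}  f-bounded = bounded-zero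
    bounded-sum {ℕ.suc n} f-bounded = bounded-+ (f-bounded zero) (bounded-sum (f-bounded ∘ suc))

  -- The bound `L` may be negative, whereas multiplying the estimate for `f` by it requires a
  -- nonnegative factor; hence the passage to a positive `M` above `L`.
  bounded-∘ : ∀ {c₁ ℓ₁ c₂ ℓ₂ c₃ ℓ₃} (A : CStarAlgebra c₁ ℓ₁) (B : CStarAlgebra c₂ ℓ₂) (C : CStarAlgebra c₃ ℓ₃) →
    ∀ {f g} → Bounded B C g → Bounded A B f → Bounded A C (g ∘ f)
  bounded-∘ A B C {f} {g} (L , g≤) (K , f≤) with positive-bound L
  ... | M , 0<M , L≤M = M R.* K , λ x →
    ≤-trans (g≤ (f x)) (≤-trans (*-monoˡ-≤ (CStarAlgebra.‖‖-nonNeg B (f x)) L≤M)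
      (≤-trans (*-monoʳ-≤ (<⇒≤ 0<M) (f≤ x)) (≈⇒≤ (R.sym (R.*-assoc _ _ _)))))

-- Continuity of a family of functions on the unit interval, uniform in the
-- family.
module Paths {ℝ : RealField} {c ℓ : Level} (A : CStar.CStarAlgebra ℝ c ℓ) where
  open CStar ℝ
  open CStarAlgebra A hiding (zero)
  open KTheory A using (Interval)
  open Norms A
  open OrderedField ℝ

  Continuous : {I : Set} → (Interval → I → Carrier) → Set
  Continuous f = ∀ s ε → R.0# R.< ε → ∃[ δ ] R.0# R.< δ ×
    (∀ s′ → R.Within δ (proj₁ s) (proj₁ s′) → ∀ i → ‖ f s i + (- f s′ i) ‖ R.< ε)

  constant-< : ∀ {x y} → x ≈ y → ∀ {ε} → R.0# R.< ε → ‖ x + (- y) ‖ R.< ε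
  constant-< {x} {y} x≈y 0<ε = ≤-<-trans (≤-trans (≈⇒≤ (‖‖-cong
    (trans (+-congʳ x≈y) (-‿inverseʳ y)))) ‖0‖≤0) 0<ε

  continuous-zero : {I : Set} → Continuous {I} (λ _ _ → 0#)
  continuous-zero s ε 0<ε = R.1# , R.0<1 , λ _ _ _ → constant-< refl 0<ε

  continuous-+ : {I : Set} {f g : Interval → I → Carrier} → Continuous f → Continuous g →
                 Continuous (λ s i → f s i + g s i)
  continuous-+ {f = f} {g} f-cont g-cont s ε 0<ε with bisect 0<ε
  ... | η , 0<η , η+η≈ε with f-cont s η 0<η | g-cont s η 0<η
  ... | δ₁ , 0<δ₁ , f< | δ₂ , 0<δ₂ , g< with lower-bound₂ 0<δ₁ 0<δ₂
  ... | δ , 0<δ , δ≤δ₁ , δ≤δ₂ = δ , 0<δ , λ s′ (p , q) i →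
    ≤-<-trans (≤-trans (≈⇒≤ (‖‖-cong (difference (f s i) (g s i) (f s′ i) (g s′ i)))) (‖‖-triangle _ _))
      (<-respʳ η+η≈ε (+-mono-< (f< s′ (<-≤-trans p δ≤δ₁ , <-≤-trans q δ≤δ₁) i)
                               (g< s′ (<-≤-trans p δ≤δ₂ , <-≤-trans q δ≤δ₂) i)))
    where
    open CommutativeSemigroupProperties (CommutativeMonoid.commutativeSemigroup +-commutativeMonoid)
      using (interchange)
    open AbelianGroupProperties +-abelianGroup using (⁻¹-∙-comm)

    difference : ∀ a b a′ b′ → (a + b) + (- (a′ + b′)) ≈ (a + (- a′)) + (b + (- b′))
    difference a b a′ b′ = trans (+-congˡ (sym (⁻¹-∙-comm a′ b′))) (interchange a b (- a′) (- b′))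

  continuous-sum : {I : Set} → ∀ {n} {f : Fin n → Interval → I → Carrier} → (∀ j → Continuous (f j)) →
                   Continuous (λ s i → Matrices.sum starRing (λ j → f j s i))
  continuous-sum {n = ℕ.zero}  f-cont = continuous-zero
  continuous-sum {n = ℕ.suc n} f-cont = continuous-+ (f-cont zero) (continuous-sum (f-cont ∘ suc))

module _ {ℝ : RealField} {c₁ ℓ₁ c₂ ℓ₂ : Level} {A : CStar.CStarAlgebra ℝ c₁ ℓ₁} {B : CStar.CStarAlgebra ℝ c₂ ℓ₂}
         (φ : CStar.StarHom ℝ A B) where
  open CStar ℝ
  open OrderedField ℝ
  private
    module A = CStarAlgebra A
    module B = CStarAlgebra B
    module φ = StarHom φ

  -‿homo : ∀ x → φ.⟦ A.- x ⟧ B.≈ B.- φ.⟦ x ⟧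
  -‿homo x = GroupProperties.inverseˡ-unique B.+-group _ _
    (B.trans (B.sym (φ.+-homo (A.- x) x)) (B.trans (φ.⟦⟧-cong (A.-‿inverseˡ x)) φ.0-homo))

  continuous-map : {I : Set} {f : KTheory.Interval A → I → A.Carrier} → Paths.Continuous A f →
                   Paths.Continuous B (λ s i → φ.⟦ f s i ⟧)
  continuous-map {f = f} f-cont s ε 0<ε with scale-down (proj₁ φ.bounded) 0<ε
  ... | η , 0<η , small with f-cont s η 0<η
  ... | δ , 0<δ , f< = δ , 0<δ , λ s′ near i → small (A.‖‖-nonNeg _) (f< s′ near i)
    (≤-trans (≈⇒≤ (B.‖‖-cong (B.sym (B.trans (φ.+-homo _ _) (B.+-congˡ (-‿homo _))))))
             (proj₂ φ.bounded _))

upper-bound : ∀ {n} (f : Fin n → ℕ) → ∃[ k ] ∀ i → f i ℕ.≤ k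
upper-bound {ℕ.zero}  f = 0 , λ ()
upper-bound {ℕ.suc n} f with upper-bound (f ∘ suc)
... | k , f≤k = f zero ℕ.+ k , λ where
  zero    → ℕ.m≤m+n (f zero) k
  (suc i) → ℕ.≤-trans (f≤k i) (ℕ.m≤n+m k (f zero))

-- Homotopies of unitaries and the decomposition of K₁

module Homotopies {ℝ : RealField} {c ℓ : Level} (A : CStar.CStarAlgebra ℝ c ℓ) where
  open CStar ℝ
  open CStarAlgebra A
  open KTheory A
  open Matrices starRing
  open Paths A
  open Padding A
  open Unitary
  private
    module H = Homotopic

  entries : ∀ {n} → (Interval → Mat n n) → Interval → Fin n × Fin n → Carrier
  entries f s (i , j) = f s i j

  homotopic-resp : ∀ {n} {x x′ y y′ : Mat n n} → x ≋ x′ → y ≋ y′ → Homotopic x y → Homotopic x′ y′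
  homotopic-resp x≋x′ y≋y′ h = record
    { path       = H.path h
    ; isUnitary  = H.isUnitary h
    ; start      = λ s s≈0 → ≋-trans (H.start h s s≈0) x≋x′
    ; end        = λ s s≈1 → ≋-trans (H.end h s s≈1) y≋y′
    ; continuous = H.continuous h
    }

  homotopic-refl : ∀ {n} {x y : Mat n n} → IsUnitary x → x ≋ y → Homotopic x y
  homotopic-refl {x = x} x-unitary x≋y = record
    { path       = λ _ → x
    ; isUnitary  = λ _ → x-unitary
    ; start      = λ _ _ → ≋-refl
    ; end        = λ _ _ → x≋y
    ; continuous = λ _ _ 0<ε → R.1# , R.0<1 , λ _ _ _ _ → constant-< refl 0<ε
    }

  entries-continuous : ∀ {n} {x y : Mat n n} (h : Homotopic x y) → Continuous (entries (H.path h))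
  entries-continuous h s ε 0<ε with H.continuous h s ε 0<ε
  ... | δ , 0<δ , small = δ , 0<δ , λ s′ near (i , j) → small s′ near i j

  continuous-pad : ∀ {n} k {f : Interval → Mat n n} → Continuous (entries f) →
                   Continuous (entries (λ s → pad k (f s)))
  continuous-pad {n} k {f} f-cont s ε 0<ε with f-cont s ε 0<ε
  ... | δ , 0<δ , small = δ , 0<δ , λ s′ near (i , j) → pad-small s′ near i j
    where
    pad-small : ∀ s′ → R.Within δ (proj₁ s) (proj₁ s′) → ∀ i j →
                ‖ pad k (f s) i j + (- pad k (f s′) i j) ‖ R.< ε
    pad-small s′ near i j with toℕ i <? n | toℕ j <? n
    ... | yes _ | yes _ = small s′ near (_ , _)
    ... | yes _ | no _  = constant-< refl 0<ε
    ... | no _  | _     = constant-< refl 0<ε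

  -- The homomorphism laws of `K₁-map` hold entrywise, so that constant paths prove them.
  same-size : ∀ {n} {x y : Mat n n} (x-unitary : IsUnitary x) (y-unitary : IsUnitary y) → x ≋ y →
    StablyHomotopic (record { matrix = x ; isUnitary = x-unitary }) (record { matrix = y ; isUnitary = y-unitary })
  same-size {n} x-unitary y-unitary x≋y = n , ℕ.≤-refl , ℕ.≤-refl ,
    homotopic-refl (pad-unitary ℕ.≤-refl x-unitary) (pad-cong n x≋y)

module _ {ℝ : RealField} {c₁ ℓ₁ c₂ ℓ₂ : Level}
         {A : CStar.CStarAlgebra ℝ c₁ ℓ₁} {B : CStar.CStarAlgebra ℝ c₂ ℓ₂} (φ : CStar.StarHom ℝ A B) where
  open CStar ℝ
  private
    module A = CStarAlgebra A
    module B = CStarAlgebra B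
    module KA = KTheory A
    module KB = KTheory B
    module MA = Matrices A.starRing
    module HA = Homotopies A
    module HB = Homotopies B
    module K₁A = RawGroup KA.K₁
    module K₁B = RawGroup KB.K₁
    φʰ = StarHom.starRingHom φ
  open KTheory.Homotopic

  homotopic-map : ∀ {n} {x y : MA.Mat n n} → KA.Homotopic x y → KB.Homotopic (mapMat φʰ x) (mapMat φʰ y)
  homotopic-map h = record
    { path       = λ s → mapMat φʰ (path h s)
    ; isUnitary  = λ s → mapMat-Unitary φʰ (isUnitary h s)
    ; start      = λ s s≈0 i j → ⟦⟧-cong φʰ (start h s s≈0 i j)
    ; end        = λ s s≈1 i j → ⟦⟧-cong φʰ (end h s s≈1 i j)
    ; continuous = λ s ε 0<ε → let δ , 0<δ , small = continuous-map φ (HA.entries-continuous h) s ε 0<ε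
                               in δ , 0<δ , λ s′ near i j → small s′ near (i , j)
    }

  K₁-map : KA.Unitary → KB.Unitary
  K₁-map u = record
    { matrix    = mapMat φʰ (KA.Unitary.matrix u)
    ; isUnitary = mapMat-Unitary φʰ (KA.Unitary.isUnitary u)
    }

  open GroupMorphisms KA.K₁ KB.K₁

  K₁-map-isHomomorphism : IsGroupHomomorphism K₁-map
  K₁-map-isHomomorphism = record
    { isMonoidHomomorphism = record
      { isMagmaHomomorphism = record
        { isRelHomomorphism = record
          { cong = λ {u} {v} (k , u≤k , v≤k , h) → k , u≤k , v≤k ,
              HB.homotopic-resp (mapMat-pad {A = A} {B} φʰ k (KA.Unitary.matrix u))
                                (mapMat-pad {A = A} {B} φʰ k (KA.Unitary.matrix v)) (homotopic-map h) }
        ; homo = λ u v → HB.same-size (KB.Unitary.isUnitary (K₁-map (u K₁A.∙ v)))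
            (KB.Unitary.isUnitary (K₁-map u K₁B.∙ K₁-map v)) (⊕-homo φʰ (KA.Unitary.matrix u) (KA.Unitary.matrix v))
        }
      ; ε-homo = HB.same-size (KB.Unitary.isUnitary (K₁-map K₁A.ε)) (KB.Unitary.isUnitary K₁B.ε) λ ()
      }
    ; ⁻¹-homo = λ u → HB.same-size (KB.Unitary.isUnitary (K₁-map (u K₁A.⁻¹))) (KB.Unitary.isUnitary (K₁-map u K₁B.⁻¹))
        (mapMat-† φʰ (KA.Unitary.matrix u))
    }

module DecomposeK₁ {ℝ : RealField} {c ℓ : Level} {A B : CStar.CStarAlgebra ℝ c ℓ} {n : ℕ}
                   (dec : Decomposition A B n) where
  open CStar ℝ
  open Decomposition dec
  private
    module A = CStarAlgebra A
    module B = CStarAlgebra B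
    module KA = KTheory A
    module KB = KTheory B
    module MA = Matrices A.starRing
    module MB = Matrices B.starRing
    module HA = Homotopies A
    module HB = Homotopies B
    module PB = Padding B
  open KTheory.Homotopic
  open KTheory.Unitary using (size; matrix)

  assemble : ∀ {k} → (Fin n → MB.Mat k k) → MA.Mat k k
  assemble x a b = MA.sum λ i → ⟦ inclʰ i ⟧ (x i a b)

  assemble-cong : ∀ {k} {x y : Fin n → MB.Mat k k} → (∀ i → x i MB.≋ y i) → assemble x MA.≋ assemble y
  assemble-cong x≋y a b = MA.sum-cong-≋ λ i → ⟦⟧-cong (inclʰ i) (x≋y i a b)

  -- The family of the `x i` is a single unitary over the power of `B`, and `glue` is a homomorphism
  -- from this power to `A`.
  assemble-unitary : ∀ {k} {x : Fin n → MB.Mat k k} → (∀ i → KB.IsUnitary (x i)) → KA.IsUnitary (assemble x)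
  assemble-unitary {x = x} x-unitary =
    mapMat-Unitary (glue inclʰ incl⊥) (power-Unitary B.starRing x x-unitary)

  proj-assemble : ∀ {k} (x : Fin n → MB.Mat k k) i → mapMat (projʰ i) (assemble x) MB.≋ x i
  proj-assemble x i a b = B.trans (sum-homo (projʰ i) (λ j → ⟦ inclʰ j ⟧ (x j a b)))
    (B.trans (sum-single B.+-commutativeMonoid (λ j → ⟦ projʰ i ⟧ (⟦ inclʰ j ⟧ (x j a b))) i
               (λ j j≢i → proj-incl-≢ i j (j≢i ∘ ≡.sym) (x j a b)))
             (proj-incl i (x i a b)))

  homotopic-assemble : ∀ {k} {x y : Fin n → MB.Mat k k} → (∀ i → KB.Homotopic (x i) (y i)) →
                       KA.Homotopic (assemble x) (assemble y)
  homotopic-assemble h = record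
    { path       = λ s → assemble (λ i → path (h i) s)
    ; isUnitary  = λ s → assemble-unitary (λ i → isUnitary (h i) s)
    ; start      = λ s s≈0 → assemble-cong (λ i → start (h i) s s≈0)
    ; end        = λ s s≈1 → assemble-cong (λ i → end (h i) s s≈1)
    ; continuous = λ s ε 0<ε →
        let δ , 0<δ , small = Paths.continuous-sum A
              (λ i → continuous-map (incl i) (HB.entries-continuous (h i))) s ε 0<ε
        in δ , 0<δ , λ s′ near a b → small s′ near (a , b)
    }

  homotopic-pad : ∀ {k m} {x y : MB.Mat k k} → k ℕ.≤ m → KB.Homotopic x y → KB.Homotopic (KB.pad m x) (KB.pad m y)
  homotopic-pad {m = m} k≤m h = record
    { path       = λ s → KB.pad m (path h s)
    ; isUnitary  = λ s → PB.pad-unitary k≤m (isUnitary h s)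
    ; start      = λ s s≈0 → PB.pad-cong m (start h s s≈0)
    ; end        = λ s s≈1 → PB.pad-cong m (end h s s≈1)
    ; continuous = λ s ε 0<ε →
        let δ , 0<δ , small = HB.continuous-pad m (HB.entries-continuous h) s ε 0<ε
        in δ , 0<δ , λ s′ near a b → small s′ near (a , b)
    }

  -- The homotopies of the components live in different sizes. Padded to a common size they are
  -- assembled into one path, at whose ends `sum-incl-proj` gives back `u` and `v`.
  K₁-injective : ∀ {u v} → (∀ i → KB.StablyHomotopic (K₁-map (proj i) u) (K₁-map (proj i) v)) →
                 KA.StablyHomotopic u v
  K₁-injective {u} {v} h = k , u≤k , v≤k ,
    HA.homotopic-resp (reassemble u (λ i → proj₁ (proj₂ (h i)))) (reassemble v (λ i → proj₁ (proj₂ (proj₂ (h i)))))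
      (homotopic-assemble λ i → homotopic-pad (mᵢ≤k i) (proj₂ (proj₂ (proj₂ (h i)))))
    where
    m = proj₁ (upper-bound (λ i → proj₁ (h i)))
    -- For `n` = 0 the bound `m` says nothing about the sizes of `u` and `v`, which are therefore
    -- added.
    k = size u ℕ.+ (size v ℕ.+ m)
    u≤k = ℕ.m≤m+n (size u) (size v ℕ.+ m)
    v≤k = ℕ.≤-trans (ℕ.m≤m+n (size v) m) (ℕ.m≤n+m (size v ℕ.+ m) (size u))
    mᵢ≤k : ∀ i → proj₁ (h i) ℕ.≤ k
    mᵢ≤k i = ℕ.≤-trans (proj₂ (upper-bound (λ i → proj₁ (h i))) i)
      (ℕ.≤-trans (ℕ.m≤n+m m (size v)) (ℕ.m≤n+m (size v ℕ.+ m) (size u)))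

    reassemble : ∀ w → (∀ i → size w ℕ.≤ proj₁ (h i)) →
      assemble (λ i → KB.pad k (KB.pad (proj₁ (h i)) (mapMat (projʰ i) (matrix w)))) MA.≋ KA.pad k (matrix w)
    reassemble w w≤ = MA.≋-trans
      (assemble-cong λ i → MB.≋-trans (PB.pad-pad k (mapMat (projʰ i) (matrix w)) (w≤ i))
        (MB.≋-sym (mapMat-pad {A = A} {B} (projʰ i) k (matrix w))))
      (λ a b → sum-incl-proj (KA.pad k (matrix w) a b))

  -- The preimage is assembled from the `y i` padded to a common size. A homotopy from `z` to `u` is
  -- mapped by `proj i` to a homotopy that ends, up to entrywise equality, at a padding of `y i`.
  K₁-surjective : ∀ (y : Fin n → KB.Unitary) → ∃[ u ] ∀ {z} → KA.StablyHomotopic z u →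
                  ∀ i → KB.StablyHomotopic (K₁-map (proj i) z) (y i)
  K₁-surjective y = u , λ {z} (k , z≤k , m≤k , h) i → k , z≤k , ℕ.≤-trans (y≤m i) m≤k ,
    HB.homotopic-resp (mapMat-pad {A = A} {B} (projʰ i) k (matrix z))
      (MB.≋-trans (mapMat-pad {A = A} {B} (projʰ i) k (matrix u))
        (MB.≋-trans (PB.pad-cong k (proj-assemble (λ i → KB.pad m (matrix (y i))) i))
                    (PB.pad-pad k (matrix (y i)) (y≤m i))))
      (homotopic-map (proj i) h)
    where
    m = proj₁ (upper-bound (size ∘ y))
    y≤m = proj₂ (upper-bound (size ∘ y))
    u : KA.Unitary
    u = record
      { matrix    = assemble (λ i → KB.pad m (matrix (y i)))
      ; isUnitary = assemble-unitary (λ i → PB.pad-unitary (y≤m i) (KTheory.Unitary.isUnitary (y i)))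
      }

  K₁-decompose : KA.K₁ ≅ᴳ KB.K₁ ^ᴳ n
  K₁-decompose = (λ u i → K₁-map (proj i) u) , record
    { isGroupMonomorphism = record
      { isGroupHomomorphism = record
        { isMonoidHomomorphism = record
          { isMagmaHomomorphism = record
            { isRelHomomorphism = record { cong = λ {u} {v} u≈v i → hom.⟦⟧-cong i {u} {v} u≈v }
            ; homo = λ u v i → hom.homo i u v
            }
          ; ε-homo = λ i → hom.ε-homo i
          }
        ; ⁻¹-homo = λ u i → hom.⁻¹-homo i u
        }
      ; injective = λ {u} {v} → K₁-injective {u} {v}
      }
    ; surjective = K₁-surjective
    }
    where
    module hom (i : Fin n) = GroupMorphisms.IsGroupHomomorphism (K₁-map-isHomomorphism (proj i))

-- Units of graph algebras

lookup-injective : ∀ {A : Set} {xs : List A} → Unique xs → ∀ i j → lookup xs i ≡ lookup xs j → i ≡ j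
lookup-injective (_ ∷ _)   zero    zero    _ = ≡.refl
lookup-injective (x∉ ∷ _)  zero    (suc j) e = contradiction e (All.lookup x∉ (∈-lookup j))
lookup-injective (x∉ ∷ _)  (suc i) zero    e = contradiction (≡.sym e) (All.lookup x∉ (∈-lookup i))
lookup-injective (_ ∷ xs!) (suc i) (suc j) e = ≡.cong suc (lookup-injective xs! i j e)

module StarHoms (ℝ : RealField) where
  open CStar ℝ
  open BoundedMaps ℝ

  idˢ : ∀ {c ℓ} (A : CStarAlgebra c ℓ) → StarHom A A
  idˢ A = record
    { starRingHom = idʰ (CStarAlgebra.starRing A)
    ; ·-homo      = λ _ _ → CStarAlgebra.refl A
    ; bounded     = bounded-id A
    }

  zeroˢ : ∀ {c₁ ℓ₁ c₂ ℓ₂} (A : CStarAlgebra c₁ ℓ₁) (B : CStarAlgebra c₂ ℓ₂) → StarHom A B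
  zeroˢ A B = record
    { starRingHom = zeroʰ (CStarAlgebra.starRing A) (CStarAlgebra.starRing B)
    ; ·-homo      = λ z x → CStarAlgebra.sym B (Unital.·-zeroʳ ℝ B z)
    ; bounded     = bounded-zero A B
    }

  compose : ∀ {c₁ ℓ₁ c₂ ℓ₂ c₃ ℓ₃} (A : CStarAlgebra c₁ ℓ₁) (B : CStarAlgebra c₂ ℓ₂) (C : CStarAlgebra c₃ ℓ₃) →
            StarHom B C → StarHom A B → StarHom A C
  compose A B C χ φ = record
    { starRingHom = StarHom.starRingHom χ ∘ʰ StarHom.starRingHom φ
    ; ·-homo      = λ z x → CStarAlgebra.trans C (StarHom.⟦⟧-cong χ (StarHom.·-homo φ z x)) (StarHom.·-homo χ z _)
    ; bounded     = bounded-∘ A B C (StarHom.bounded χ) (StarHom.bounded φ)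
    }

-- left x = (2e - 1) x and right x = x (2e - 1), where e is a projection.
module Reflection {ℝ : RealField} {c ℓ : Level} (A : CStar.CStarAlgebra ℝ c ℓ)
  (e : CStar.CStarAlgebra.Carrier A)
  (ee≈e : CStar.CStarAlgebra._≈_ A (CStar.CStarAlgebra._*_ A e e) e)
  (e⋆≈e : CStar.CStarAlgebra._≈_ A (CStar.CStarAlgebra._⋆ A e) e) where
  open CStar ℝ
  open CStarAlgebra A
  open BoundedMaps ℝ
  open OrderedField ℝ using (half)
  open SetoidReasoning setoid
  open RingWithoutOneProperties ringWithoutOne using (-‿distribˡ-*; -‿distribʳ-*)
  open AbelianGroupProperties +-abelianGroup using (⁻¹-∙-comm; ⁻¹-involutive)
  open GroupProperties +-group using (inverseˡ-unique; ∙-cancelʳ)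
  open CommutativeSemigroupProperties (CommutativeMonoid.commutativeSemigroup +-commutativeMonoid)
    using (interchange)
  open Norms A using (-‿⋆)

  double-cancel : ∀ {x y} → x + x ≈ y + y → x ≈ y
  double-cancel {x} {y} 2x≈2y with half
  ... | w , _ , w+w≈1 = trans (sym (halve x)) (trans (·-cong (R.refl , R.refl) 2x≈2y) (halve y))
    where
    halve : ∀ x → (w +i R.0#) · (x + x) ≈ x
    halve x = begin
      (w +i R.0#) · (x + x)                        ≈⟨ ·-distribˡ _ x x ⟩
      (w +i R.0#) · x + (w +i R.0#) · x            ≈⟨ ·-distribʳ _ _ x ⟨
      ((w +i R.0#) +ᶜ (w +i R.0#)) · x             ≈⟨ ·-cong (w+w≈1 , R.+-identityˡ R.0#) refl ⟩
      1ᶜ · x                                       ≈⟨ ·-identity x ⟩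
      x                                            ∎

  ·-‿- : ∀ z x → - (z · x) ≈ z · (- x)
  ·-‿- z x = sym (inverseˡ-unique _ _ (trans (sym (·-distribˡ z (- x) x))
    (trans (·-cong (R.refl , R.refl) (-‿inverseˡ x)) (Unital.·-zeroʳ ℝ A z))))

  left right : Carrier → Carrier
  left  x = (e * x + e * x) + - x
  right x = (x * e + x * e) + - x

  left-cong : ∀ {x y} → x ≈ y → left x ≈ left y
  left-cong p = +-cong (+-cong (*-congˡ p) (*-congˡ p)) (-‿cong p)

  right-cong : ∀ {x y} → x ≈ y → right x ≈ right y
  right-cong p = +-cong (+-cong (*-congʳ p) (*-congʳ p)) (-‿cong p)

  left-+ : ∀ x y → left (x + y) ≈ left x + left y
  left-+ x y = begin
    (e * (x + y) + e * (x + y)) + - (x + y)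
      ≈⟨ +-cong (+-cong (distribˡ e x y) (distribˡ e x y)) (sym (⁻¹-∙-comm x y)) ⟩
    ((e * x + e * y) + (e * x + e * y)) + (- x + - y)
      ≈⟨ +-congʳ (interchange _ _ _ _) ⟩
    ((e * x + e * x) + (e * y + e * y)) + (- x + - y)
      ≈⟨ interchange _ _ _ _ ⟩
    left x + left y ∎

  right-+ : ∀ x y → right (x + y) ≈ right x + right y
  right-+ x y = begin
    ((x + y) * e + (x + y) * e) + - (x + y)
      ≈⟨ +-cong (+-cong (distribʳ e x y) (distribʳ e x y)) (sym (⁻¹-∙-comm x y)) ⟩
    ((x * e + y * e) + (x * e + y * e)) + (- x + - y)
      ≈⟨ +-congʳ (interchange _ _ _ _) ⟩
    ((x * e + x * e) + (y * e + y * e)) + (- x + - y)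
      ≈⟨ interchange _ _ _ _ ⟩
    right x + right y ∎

  left-neg : ∀ x → left (- x) ≈ - left x
  left-neg x = inverseˡ-unique _ _ (trans (sym (left-+ (- x) x)) (trans (left-cong (-‿inverseˡ x)) left-0))
    where
    left-0 : left 0# ≈ 0#
    left-0 = trans (+-cong (trans (+-cong (zeroʳ e) (zeroʳ e)) (+-identityˡ 0#)) refl) (-‿inverseʳ 0#)

  left-* : ∀ x y → left (x * y) ≈ left x * y
  left-* x y = sym (trans (distribʳ y _ _) (+-cong
    (trans (distribʳ y _ _) (+-cong (*-assoc e x y) (*-assoc e x y))) (sym (-‿distribˡ-* x y))))

  right-* : ∀ x y → right (x * y) ≈ x * right y
  right-* x y = sym (trans (distribˡ x _ _) (+-cong
    (trans (distribˡ x _ _) (+-cong (sym (*-assoc x y e)) (sym (*-assoc x y e)))) (sym (-‿distribʳ-* x y))))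

  -- Associativity around a middle factor 2e - 1, which is only a formal expression as long as `A`
  -- is not known to have a unit.
  right-*-left : ∀ x y → right x * y ≈ x * left y
  right-*-left x y = begin
    ((x * e + x * e) + - x) * y          ≈⟨ trans (distribʳ y _ _) (+-congʳ (distribʳ y _ _)) ⟩
    ((x * e) * y + (x * e) * y) + - x * y
      ≈⟨ +-cong (+-cong (*-assoc x e y) (*-assoc x e y)) (trans (sym (-‿distribˡ-* x y)) (-‿distribʳ-* x y)) ⟩
    (x * (e * y) + x * (e * y)) + x * - y ≈⟨ trans (distribˡ x _ _) (+-congʳ (distribˡ x _ _)) ⟨
    x * left y                           ∎

  -- (2e - 1)² = 4e² - 4e + 1 = 1, as e² = e.
  left-left : ∀ x → left (left x) ≈ x
  left-left x = begin
    (e * left x + e * left x) + - left x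
      ≈⟨ +-cong (+-cong e*left e*left) (trans (sym (⁻¹-∙-comm _ _)) (+-congˡ (⁻¹-involutive x))) ⟩
    (e * x + e * x) + (- (e * x + e * x) + x)
      ≈⟨ +-assoc _ _ _ ⟨
    ((e * x + e * x) + - (e * x + e * x)) + x
      ≈⟨ trans (+-congʳ (-‿inverseʳ _)) (+-identityˡ x) ⟩
    x ∎
    where
    eex : e * (e * x) ≈ e * x
    eex = trans (sym (*-assoc e e x)) (*-congʳ ee≈e)

    e*left : e * left x ≈ e * x
    e*left = begin
      e * ((e * x + e * x) + - x)              ≈⟨ trans (distribˡ e _ _) (+-congʳ (distribˡ e _ _)) ⟩
      (e * (e * x) + e * (e * x)) + e * - x    ≈⟨ +-cong (+-cong eex eex) (sym (-‿distribʳ-* e x)) ⟩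
      (e * x + e * x) + - (e * x)              ≈⟨ +-assoc _ _ _ ⟩
      e * x + (e * x + - (e * x))              ≈⟨ trans (+-congˡ (-‿inverseʳ _)) (+-identityʳ _) ⟩
      e * x                                    ∎

  left-right : ∀ x → left (right x) ≈ right (left x)
  left-right x = trans (left-+ _ _) (+-cong (trans (left-+ _ _) (+-cong (left-* x e) (left-* x e))) (left-neg x))

  left-⋆ : ∀ x → left x ⋆ ≈ right (x ⋆)
  left-⋆ x = trans (⋆-+ _ _) (+-cong (trans (⋆-+ _ _) (+-cong ex⋆ ex⋆)) (-‿⋆ x))
    where
    ex⋆ : (e * x) ⋆ ≈ x ⋆ * e
    ex⋆ = trans (⋆-* e x) (*-congˡ e⋆≈e)

  right-⋆ : ∀ x → right x ⋆ ≈ left (x ⋆)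
  right-⋆ x = trans (⋆-+ _ _) (+-cong (trans (⋆-+ _ _) (+-cong xe⋆ xe⋆)) (-‿⋆ x))
    where
    xe⋆ : (x * e) ⋆ ≈ e * x ⋆
    xe⋆ = trans (⋆-* x e) (*-congʳ e⋆≈e)

  left-· : ∀ z x → left (z · x) ≈ z · left x
  left-· z x = sym (trans (·-distribˡ z _ _) (+-cong (trans (·-distribˡ z _ _)
    (+-cong (sym (·-*-assocʳ z e x)) (sym (·-*-assocʳ z e x)))) (sym (·-‿- z x))))

  right-· : ∀ z x → right (z · x) ≈ z · right x
  right-· z x = sym (trans (·-distribˡ z _ _) (+-cong (trans (·-distribˡ z _ _)
    (+-cong (sym (·-*-assocˡ z x e)) (sym (·-*-assocˡ z x e)))) (sym (·-‿- z x))))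

  reflection : StarHom A A
  reflection = record
    { starRingHom = record
      { ⟦_⟧     = λ x → left (right x)
      ; ⟦⟧-cong = λ p → left-cong (right-cong p)
      ; +-homo  = λ x y → trans (left-cong (right-+ x y)) (left-+ _ _)
      ; *-homo  = λ x y → sym (begin
          left (right x) * left (right y)      ≈⟨ left-* _ _ ⟨
          left (right x * left (right y))      ≈⟨ left-cong (*-congˡ (left-right y)) ⟩
          left (right x * right (left y))      ≈⟨ left-cong (right-* _ _) ⟨
          -- The two inner factors 2e - 1 meet here and cancel.
          left (right (right x * left y))      ≈⟨ left-cong (right-cong (trans (right-*-left x (left y)) (*-congˡ (left-left y)))) ⟩
          left (right (x * y))                 ∎)
      ; ⋆-homo  = λ x → sym (trans (left-⋆ (right x)) (trans (right-cong (right-⋆ x)) (sym (left-right (x ⋆)))))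
      }
    ; ·-homo  = λ z x → trans (left-cong (right-· z x)) (left-· z _)
    ; bounded = bounded-∘ A A A {f = right} {left}
        (bounded-+ A A (bounded-+ A A (bounded-*ˡ A e) (bounded-*ˡ A e)) (bounded-neg A))
        (bounded-+ A A (bounded-+ A A (bounded-*ʳ A e) (bounded-*ʳ A e)) (bounded-neg A))
    }

  reflection-fixes : ∀ {x} → e * x ≈ x → x * e ≈ x → left (right x) ≈ x
  reflection-fixes {x} ex≈x xe≈x = trans (left-cong (fix xe≈x)) (fix ex≈x)
    where
    fix : ∀ {y} → y ≈ x → (y + y) + - x ≈ x
    fix p = trans (+-congʳ (+-cong p p)) (trans (+-assoc x x (- x)) (trans (+-congˡ (-‿inverseʳ x)) (+-identityʳ x)))

  -- Multiplied by 2e - 1 on the left, the hypothesis says that x(2e - 1) = (2e - 1)x; then - `x`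
  -- and the factor 2 cancel.
  central : (∀ x → left (right x) ≈ x) → ∀ x → x * e ≈ e * x
  central fixed x = double-cancel (∙-cancelʳ (- x) _ _ (trans (sym (left-left (right x))) (left-cong (fixed x))))

  module _ (e-central : ∀ x → x * e ≈ e * x) where

    compression : StarHom A A
    compression = record
      { starRingHom = record
        { ⟦_⟧     = e *_
        ; ⟦⟧-cong = *-congˡ
        ; +-homo  = distribˡ e
        ; *-homo  = λ x y → sym (begin
            (e * x) * (e * y)    ≈⟨ *-assoc e x _ ⟩
            e * (x * (e * y))    ≈⟨ *-congˡ (*-assoc x e y) ⟨
            e * ((x * e) * y)    ≈⟨ *-congˡ (trans (*-congʳ (e-central x)) (*-assoc e x y)) ⟩
            e * (e * (x * y))    ≈⟨ *-assoc e e _ ⟨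
            (e * e) * (x * y)    ≈⟨ *-congʳ ee≈e ⟩
            e * (x * y)          ∎)
        ; ⋆-homo  = λ x → sym (trans (⋆-* e x) (trans (*-congˡ e⋆≈e) (e-central (x ⋆))))
        }
      ; ·-homo  = λ z x → ·-*-assocʳ z e x
      ; bounded = bounded-*ˡ A e
      }

module GraphUnit {ℝ : RealField} {k : ℕ} {Λ : RankGraph k} (finite : Finite (RankGraph.Obj Λ))
  {c ℓ : Level} {A : CStar.CStarAlgebra ℝ c ℓ} (graph : CuntzKrieger.IsGraphAlgebra ℝ Λ A) where
  open CuntzKrieger ℝ
  open CStarAlgebra A hiding (zero; complete)
  open IsGraphAlgebra graph
  open Family family
  open RankGraph Λ using (Obj; r; s; r-ident; s-ident; identityˡ; identityʳ)
  open Finite finite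
  open Matrices starRing using (sum; sum-cong-≋; *-sum; sum-*; sum-⋆)

  private
    at : Fin (length elements) → Obj
    at = lookup elements

    index : Obj → Fin (length elements)
    index v = Any.index (complete v)

    at-index : ∀ v → at (index v) ≡ v
    at-index v = ≡.sym (lookup-index (complete v))

    at-≢ : ∀ v j → j ≢ index v → at j ≢ v
    at-≢ v j j≢ e = j≢ (lookup-injective unique j (index v) (≡.trans e (≡.sym (at-index v))))

  e : Carrier
  e = sum (λ i → vertex (at i))

  e-vertex : ∀ v → e * vertex v ≈ vertex v
  e-vertex v = begin
    e * vertex v                                   ≈⟨ sum-* (vertex v) (λ i → vertex (at i)) ⟩
    sum (λ i → vertex (at i) * vertex v)           ≈⟨ sum-single +-commutativeMonoid (λ i → vertex (at i) * vertex v) (index v)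
                                                        (λ j j≢ → vertex-orthogonal _ _ (at-≢ v j j≢)) ⟩
    vertex (at (index v)) * vertex v               ≡⟨ ≡.cong (λ u → vertex u * vertex v) (at-index v) ⟩
    vertex v * vertex v                            ≈⟨ vertex-idempotent v ⟩
    vertex v                                       ∎
    where open SetoidReasoning setoid

  e⋆≈e : e ⋆ ≈ e
  e⋆≈e = trans (sum-⋆ (λ i → vertex (at i))) (sum-cong-≋ λ i → vertex-⋆ (at i))

  ee≈e : e * e ≈ e
  ee≈e = trans (*-sum e (λ i → vertex (at i))) (sum-cong-≋ λ i → e-vertex (at i))

  vertex-e : ∀ v → vertex v * e ≈ vertex v
  vertex-e v = begin
    vertex v * e             ≈⟨ *-cong (vertex-⋆ v) e⋆≈e ⟨
    vertex v ⋆ * e ⋆         ≈⟨ ⋆-* e (vertex v) ⟨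
    (e * vertex v) ⋆         ≈⟨ ⋆-cong (e-vertex v) ⟩
    vertex v ⋆               ≈⟨ vertex-⋆ v ⟩
    vertex v                 ∎
    where open SetoidReasoning setoid

  e-gen : ∀ μ → e * gen μ ≈ gen μ
  e-gen μ = begin
    e * gen μ                      ≈⟨ *-congˡ split ⟩
    e * (vertex (r μ) * gen μ)     ≈⟨ *-assoc e _ _ ⟨
    (e * vertex (r μ)) * gen μ     ≈⟨ *-congʳ (e-vertex (r μ)) ⟩
    vertex (r μ) * gen μ           ≈⟨ split ⟨
    gen μ                          ∎
    where
    open SetoidReasoning setoid
    split : gen μ ≈ vertex (r μ) * gen μ
    split = trans (sym (gen-cong (identityˡ μ (s-ident _)))) (gen-compose _ _ _)

  gen-e : ∀ μ → gen μ * e ≈ gen μ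
  gen-e μ = begin
    gen μ * e                      ≈⟨ *-congʳ split ⟩
    (gen μ * vertex (s μ)) * e     ≈⟨ *-assoc _ _ e ⟩
    gen μ * (vertex (s μ) * e)     ≈⟨ *-congˡ (vertex-e (s μ)) ⟩
    gen μ * vertex (s μ)           ≈⟨ split ⟨
    gen μ                          ∎
    where
    open SetoidReasoning setoid
    split : gen μ ≈ gen μ * vertex (s μ)
    split = trans (sym (gen-cong (identityʳ μ (≡.sym (r-ident _))))) (gen-compose _ _ _)

  private
    module Refl = Reflection A e ee≈e e⋆≈e

    e-central : ∀ x → x * e ≈ e * x
    e-central = Refl.central (extend-unique A Refl.reflection (StarHoms.idˢ ℝ A)
      (λ μ → Refl.reflection-fixes (e-gen μ) (gen-e μ)))

    e-identityˡ : ∀ x → e * x ≈ x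
    e-identityˡ = extend-unique A (Refl.compression e-central) (StarHoms.idˢ ℝ A) e-gen

  unit : Unital.Unit ℝ A
  unit = record
    { e         = e
    ; identityˡ = e-identityˡ
    ; identityʳ = λ x → trans (e-central x) (e-identityˡ x)
    }

-- Disjoint unions of graphs

-- σ permutes the coordinates of degrees.
record Copies {k : ℕ} (Λ′ Λ : RankGraph k) (n : ℕ) : Set where
  private
    module Λ′ = RankGraph Λ′
    module Λ = RankGraph Λ
  field
    σ            : Vec ℕ k → Vec ℕ k
    σ-involutive : ∀ m → σ (σ m) ≡ m
    copy         : Fin n → Λ.Mor → Λ′.Mor
    copyᵒ        : Fin n → Λ.Obj → Λ′.Obj
    base         : Λ′.Mor → Λ.Mor
    baseᵒ        : Λ′.Obj → Λ.Obj
    part         : Λ′.Obj → Fin n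
    copy-cong    : ∀ i {μ ν} → μ Λ.≈ ν → copy i μ Λ′.≈ copy i ν
    base-cong    : ∀ {μ ν} → μ Λ′.≈ ν → base μ Λ.≈ base ν
    base-copy    : ∀ i μ → base (copy i μ) Λ.≈ μ
    copy-base    : ∀ μ → copy (part (Λ′.r μ)) (base μ) Λ′.≈ μ
    part-copyᵒ   : ∀ i v → part (copyᵒ i v) ≡ i
    baseᵒ-copyᵒ  : ∀ i v → baseᵒ (copyᵒ i v) ≡ v
    copyᵒ-baseᵒ  : ∀ v → copyᵒ (part v) (baseᵒ v) ≡ v
    r-copy       : ∀ i μ → Λ′.r (copy i μ) ≡ copyᵒ i (Λ.r μ)
    s-copy       : ∀ i μ → Λ′.s (copy i μ) ≡ copyᵒ i (Λ.s μ)
    d-copy       : ∀ i μ → Λ′.d (copy i μ) ≡ σ (Λ.d μ)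
    copy-ident   : ∀ i v → copy i (Λ.ident v) Λ′.≈ Λ′.ident (copyᵒ i v)
    copy-compose : ∀ i μ ν e e′ → copy i (Λ.compose μ ν e) Λ′.≈ Λ′.compose (copy i μ) (copy i ν) e′

  private
    module E′ = IsEquivalence Λ′.isEquivalence
    module E = IsEquivalence Λ.isEquivalence
    open ≡.≡-Reasoning

  r-base : ∀ μ → Λ.r (base μ) ≡ baseᵒ (Λ′.r μ)
  r-base μ = begin
    Λ.r (base μ)                                  ≡⟨ baseᵒ-copyᵒ (part (Λ′.r μ)) _ ⟨
    baseᵒ (copyᵒ (part (Λ′.r μ)) (Λ.r (base μ)))  ≡⟨ ≡.cong baseᵒ (r-copy _ (base μ)) ⟨
    baseᵒ (Λ′.r (copy (part (Λ′.r μ)) (base μ)))  ≡⟨ ≡.cong baseᵒ (Λ′.r-cong (copy-base μ)) ⟩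
    baseᵒ (Λ′.r μ)                                ∎

  s-copy-base : ∀ μ → Λ′.s μ ≡ copyᵒ (part (Λ′.r μ)) (Λ.s (base μ))
  s-copy-base μ = ≡.trans (≡.sym (Λ′.s-cong (copy-base μ))) (s-copy _ (base μ))

  s-base : ∀ μ → Λ.s (base μ) ≡ baseᵒ (Λ′.s μ)
  s-base μ = ≡.sym (≡.trans (≡.cong baseᵒ (s-copy-base μ)) (baseᵒ-copyᵒ _ _))

  part-s : ∀ μ → part (Λ′.s μ) ≡ part (Λ′.r μ)
  part-s μ = ≡.trans (≡.cong part (s-copy-base μ)) (part-copyᵒ _ _)

  d-base : ∀ μ → Λ.d (base μ) ≡ σ (Λ′.d μ)
  d-base μ = begin
    Λ.d (base μ)                               ≡⟨ σ-involutive _ ⟨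
    σ (σ (Λ.d (base μ)))                       ≡⟨ ≡.cong σ (d-copy _ (base μ)) ⟨
    σ (Λ′.d (copy (part (Λ′.r μ)) (base μ)))   ≡⟨ ≡.cong σ (Λ′.d-cong (copy-base μ)) ⟩
    σ (Λ′.d μ)                                 ∎

  base-ident : ∀ v → base (Λ′.ident v) Λ.≈ Λ.ident (baseᵒ v)
  base-ident v = E.trans (base-cong (E′.sym (≡.subst
    (λ u → copy (part v) (Λ.ident (baseᵒ v)) Λ′.≈ Λ′.ident u) (copyᵒ-baseᵒ v) (copy-ident (part v) (baseᵒ v)))))
    (base-copy (part v) _)

  composable-base : ∀ {μ ν} → Λ′.s μ ≡ Λ′.r ν → Λ.s (base μ) ≡ Λ.r (base ν)
  composable-base {μ} {ν} e = ≡.trans (s-base μ) (≡.trans (≡.cong baseᵒ e) (≡.sym (r-base ν)))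

  -- Derived from `copy-compose`: composable morphisms lie in the same part, so that the composite
  -- of `μ` and `ν` is the copy of a composite, and `base` undoes `copy`.
  base-compose : ∀ μ ν e → base (Λ′.compose μ ν e) Λ.≈ Λ.compose (base μ) (base ν) (composable-base e)
  base-compose μ ν e = E.trans
    (base-cong (E′.sym (E′.trans (copy-compose i (base μ) (base ν) (composable-base e) e′)
      (Λ′.compose-cong (copy-base μ)
        (≡.subst (λ j → copy j (base ν) Λ′.≈ ν) (≡.trans (≡.cong part (≡.sym e)) (part-s μ)) (copy-base ν)) e′ e))))
    (base-copy i _)
    where
    i = part (Λ′.r μ)
    e′ : Λ′.s (copy i (base μ)) ≡ Λ′.r (copy i (base ν))
    e′ = ≡.trans (s-copy i (base μ)) (≡.trans (≡.cong (copyᵒ i) (composable-base e)) (≡.sym (r-copy i (base ν))))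

  -- What `base` forgets is the part, and this is determined by the common range.
  base-injective : ∀ {μ ν} → Λ′.r μ ≡ Λ′.r ν → base μ Λ.≈ base ν → μ Λ′.≈ ν
  base-injective {μ} {ν} e b = E′.trans (E′.sym (copy-base μ))
    (E′.trans (copy-cong _ b) (≡.subst (λ j → copy j (base ν) Λ′.≈ ν) (≡.cong part (≡.sym e)) (copy-base ν)))

module _ {k : ℕ} {Λ₁ Λ₂ : RankGraph k} where
  private
    module Λ₁ = RankGraph Λ₁
    module Λ₂ = RankGraph Λ₂
    module E₂ = IsEquivalence Λ₂.isEquivalence

  -- Transports the index set of the sums in the Cuntz-Krieger relations, along `copy` in one
  -- direction and `base` in the other. Injectivity is taken among morphisms with a common range,
  -- the form in which `base` has it.
  enumerates-map : ∀ {m₁ v₁ m₂ v₂} (f : Λ₁.Mor → Λ₂.Mor) →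
    (∀ {μ} → _∈Λ[_,_] Λ₁ μ m₁ v₁ → _∈Λ[_,_] Λ₂ (f μ) m₂ v₂) →
    (∀ {μ ν} → Λ₁.r μ ≡ Λ₁.r ν → f μ Λ₂.≈ f ν → μ Λ₁.≈ ν) →
    (∀ {μ ν} → μ Λ₁.≈ ν → f μ Λ₂.≈ f ν) →
    (∀ {ν} → _∈Λ[_,_] Λ₂ ν m₂ v₂ → ∃[ μ ] _∈Λ[_,_] Λ₁ μ m₁ v₁ × ν Λ₂.≈ f μ) →
    ∀ {μs} → Enumerates Λ₁ m₁ v₁ μs → Enumerates Λ₂ m₂ v₂ (List.map f μs)
  enumerates-map {m₁} {v₁} f f∈ f-injective f-cong f-surjective enum = record
    { sound    = All.map⁺ (All.map f∈ sound)
    ; distinct = pairs sound distinct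
    ; complete = λ ν ν∈ → let μ , μ∈ , ν≈fμ = f-surjective ν∈ in covers ν≈fμ (complete μ μ∈)
    }
    where
    open Enumerates enum

    fresh : ∀ {μ νs} → _∈Λ[_,_] Λ₁ μ m₁ v₁ → All (λ ν → _∈Λ[_,_] Λ₁ ν m₁ v₁) νs →
            All (λ ν → ¬ (μ Λ₁.≈ ν)) νs → All (λ ν → ¬ (f μ Λ₂.≈ ν)) (List.map f νs)
    fresh μ∈ []         []         = []
    fresh μ∈ (ν∈ ∷ νs∈) (≉ ∷ ≉s) =
      (λ fμ≈fν → ≉ (f-injective (≡.trans (proj₂ μ∈) (≡.sym (proj₂ ν∈))) fμ≈fν)) ∷ fresh μ∈ νs∈ ≉s

    pairs : ∀ {μs} → All (λ μ → _∈Λ[_,_] Λ₁ μ m₁ v₁) μs → AllPairs (λ μ ν → ¬ (μ Λ₁.≈ ν)) μs →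
            AllPairs (λ μ ν → ¬ (μ Λ₂.≈ ν)) (List.map f μs)
    pairs []         []         = []
    pairs (μ∈ ∷ μs∈) (≉s ∷ μs!) = fresh μ∈ μs∈ ≉s ∷ pairs μs∈ μs!

    covers : ∀ {μ ν μs} → ν Λ₂.≈ f μ → Any (μ Λ₁.≈_) μs → Any (ν Λ₂.≈_) (List.map f μs)
    covers ν≈fμ (here μ≈)  = here (E₂.trans ν≈fμ (f-cong μ≈))
    covers ν≈fμ (there μ∈) = there (covers ν≈fμ μ∈)

-- Cuntz-Krieger families on a disjoint union of graphs

module Families {ℝ : RealField} {k n : ℕ} {Λ′ Λ : RankGraph k} (copies : Copies Λ′ Λ n)
                {c ℓ : Level} (A : CStar.CStarAlgebra ℝ c ℓ) where
  open CuntzKrieger ℝ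
  open Copies copies
  open CStarAlgebra A hiding (zero)
  open Matrices starRing using (0⋆≈0)
  private
    module Λ′ = RankGraph Λ′
    module Λ = RankGraph Λ
    module E′ = IsEquivalence Λ′.isEquivalence
    module E = IsEquivalence Λ.isEquivalence

  listSum : ∀ {M : Set} → (M → Carrier) → List M → Carrier
  listSum f μs = foldr _+_ 0# (List.map f μs)

  listSum-cong : ∀ {M : Set} {f g : M → Carrier} {μs} → All (λ μ → f μ ≈ g μ) μs → listSum f μs ≈ listSum g μs
  listSum-cong []       = refl
  listSum-cong (e ∷ es) = +-cong e (listSum-cong es)

  listSum-zero : ∀ {M : Set} {f : M → Carrier} {μs} → All (λ μ → f μ ≈ 0#) μs → listSum f μs ≈ 0#
  listSum-zero []       = refl
  listSum-zero (e ∷ es) = trans (+-cong e (listSum-zero es)) (+-identityˡ 0#)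

  listSum-map : ∀ {M N : Set} (f : N → Carrier) (h : M → N) μs → listSum f (List.map h μs) ≈ listSum (f ∘ h) μs
  listSum-map f h μs = reflexive (≡.cong (foldr _+_ 0#) (≡.sym (List.map-∘ μs)))

  module _ (F : Family Λ′ A) (i : Fin n) where
    private
      module F = Family F

      vertex≈ : ∀ v → F.gen (copy i (Λ.ident v)) ≈ F.vertex (copyᵒ i v)
      vertex≈ v = F.gen-cong (copy-ident i v)

    restriction : Family Λ A
    restriction = record
      { gen               = λ μ → F.gen (copy i μ)
      ; gen-cong          = λ e → F.gen-cong (copy-cong i e)
      ; partialIsometry   = λ μ → F.partialIsometry (copy i μ)
      ; vertex-idempotent = λ v → trans (*-cong (vertex≈ v) (vertex≈ v))
          (trans (F.vertex-idempotent _) (sym (vertex≈ v)))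
      ; vertex-⋆          = λ v → trans (⋆-cong (vertex≈ v)) (trans (F.vertex-⋆ _) (sym (vertex≈ v)))
      ; vertex-orthogonal = λ u v u≢v → trans (*-cong (vertex≈ u) (vertex≈ v)) (F.vertex-orthogonal _ _
          λ e → u≢v (≡.trans (≡.sym (baseᵒ-copyᵒ i u)) (≡.trans (≡.cong baseᵒ e) (baseᵒ-copyᵒ i v))))
      ; gen-compose       = λ μ ν e → trans
          (F.gen-cong (copy-compose i μ ν e (composable μ ν e))) (F.gen-compose _ _ _)
      ; gen⋆gen           = λ μ → trans (F.gen⋆gen (copy i μ))
          (trans (reflexive (≡.cong F.vertex (s-copy i μ))) (sym (vertex≈ _)))
      -- The sum relation holds in every degree, so the exchange of coordinates only changes the
      -- degree in which it is applied.
      ; vertex-sum        = λ m v μs enum → trans (vertex≈ v) (trans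
          (F.vertex-sum (σ m) (copyᵒ i v) (List.map (copy i) μs) (enumerates m v enum))
          (listSum-map (λ μ → F.gen μ * F.gen μ ⋆) (copy i) μs))
      }
      where
      composable : ∀ μ ν → Λ.s μ ≡ Λ.r ν → Λ′.s (copy i μ) ≡ Λ′.r (copy i ν)
      composable μ ν e = ≡.trans (s-copy i μ) (≡.trans (≡.cong (copyᵒ i) e) (≡.sym (r-copy i ν)))

      enumerates : ∀ m v {μs} → Enumerates Λ m v μs → Enumerates Λ′ (σ m) (copyᵒ i v) (List.map (copy i) μs)
      enumerates m v = enumerates-map {Λ₁ = Λ} {Λ′} (copy i)
        (λ {μ} (d≡ , r≡) → ≡.trans (d-copy i μ) (≡.cong σ d≡) , ≡.trans (r-copy i μ) (≡.cong (copyᵒ i) r≡))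
        (λ {μ} {ν} _ e → E.trans (E.sym (base-copy i μ)) (E.trans (base-cong e) (base-copy i ν)))
        (copy-cong i)
        (λ {ν} (d≡ , r≡) → base ν
          , (≡.trans (d-base ν) (≡.trans (≡.cong σ d≡) (σ-involutive m))
            , ≡.trans (r-base ν) (≡.trans (≡.cong baseᵒ r≡) (baseᵒ-copyᵒ i v)))
          , E′.sym (≡.subst (λ j → copy j (base ν) Λ′.≈ ν)
              (≡.trans (≡.cong part r≡) (part-copyᵒ i v)) (copy-base ν)))

  module _ (F : Family Λ A) (i : Fin n) where
    private
      module F = Family F

    -- Extension by zero from the part `i`. The decision is an argument, so that the relations can
    -- be checked by matching on it while the morphism stays arbitrary.
    only : {j : Fin n} → Dec (j ≡ i) → Carrier → Carrier
    only (yes _) x = x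
    only (no _)  _ = 0#

    only-cong : ∀ {j j′ x y} → j ≡ j′ → (p : Dec (j ≡ i)) (q : Dec (j′ ≡ i)) → x ≈ y → only p x ≈ only q y
    only-cong e      (yes _) (yes _) x≈y = x≈y
    only-cong ≡.refl (yes p) (no ¬p) _   = contradiction p ¬p
    only-cong ≡.refl (no ¬p) (yes p) _   = contradiction p ¬p
    only-cong e      (no _)  (no _)  _   = refl

    extension-gen : Λ′.Mor → Carrier
    extension-gen μ = only (part (Λ′.r μ) ≟ i) (F.gen (base μ))

    private
      vertex≈ : ∀ v → extension-gen (Λ′.ident v) ≈ only (part v ≟ i) (F.vertex (baseᵒ v))
      vertex≈ v = only-cong (≡.cong part (Λ′.r-ident v)) (part (Λ′.r (Λ′.ident v)) ≟ i) (part v ≟ i) (F.gen-cong (base-ident v))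

      only-partialIsometry : ∀ {j} (p : Dec (j ≡ i)) μ →
        only p (F.gen μ) * (only p (F.gen μ) ⋆ * only p (F.gen μ)) ≈ only p (F.gen μ)
      only-partialIsometry (yes _) μ = F.partialIsometry μ
      only-partialIsometry (no _)  μ = zeroˡ _

      only-idempotent : ∀ {j} (p : Dec (j ≡ i)) v → only p (F.vertex v) * only p (F.vertex v) ≈ only p (F.vertex v)
      only-idempotent (yes _) v = F.vertex-idempotent v
      only-idempotent (no _)  v = zeroˡ _

      only-⋆ : ∀ {j} (p : Dec (j ≡ i)) v → only p (F.vertex v) ⋆ ≈ only p (F.vertex v)
      only-⋆ (yes _) v = F.vertex-⋆ v
      only-⋆ (no _)  v = 0⋆≈0

      only-orthogonal : ∀ {j j′} (p : Dec (j ≡ i)) (q : Dec (j′ ≡ i)) u v → (j ≡ j′ → u ≢ v) →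
        only p (F.vertex u) * only q (F.vertex v) ≈ 0#
      only-orthogonal (yes p) (yes q) u v u≢v = F.vertex-orthogonal u v (u≢v (≡.trans p (≡.sym q)))
      only-orthogonal (yes _) (no _)  u v _   = zeroʳ _
      only-orthogonal (no _)  _       u v _   = zeroˡ _

      only-* : ∀ {j j′ x y} → j ≡ j′ → (p : Dec (j ≡ i)) (q : Dec (j′ ≡ i)) → only p (x * y) ≈ only p x * only q y
      only-* e      (yes _) (yes _) = refl
      only-* ≡.refl (yes p) (no ¬p) = contradiction p ¬p
      only-* e      (no _)  _       = sym (zeroˡ _)

      only-⋆* : ∀ {j} (p : Dec (j ≡ i)) μ → only p (F.gen μ) ⋆ * only p (F.gen μ) ≈ only p (F.vertex (Λ.s μ))
      only-⋆* (yes _) μ = F.gen⋆gen μ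
      only-⋆* (no _)  μ = zeroʳ _

      enumerates : ∀ m v {μs} → Enumerates Λ′ m v μs → Enumerates Λ (σ m) (baseᵒ v) (List.map base μs)
      enumerates m v = enumerates-map {Λ₁ = Λ′} {Λ} base
        (λ {μ} (d≡ , r≡) → ≡.trans (d-base μ) (≡.cong σ d≡) , ≡.trans (r-base μ) (≡.cong baseᵒ r≡))
        base-injective base-cong
        (λ {ν} (d≡ , r≡) → copy (part v) ν
          , (≡.trans (d-copy _ ν) (≡.trans (≡.cong σ d≡) (σ-involutive m))
            , ≡.trans (r-copy _ ν) (≡.trans (≡.cong (copyᵒ (part v)) r≡) (copyᵒ-baseᵒ v)))
          , E.sym (base-copy _ ν))

      only-sum : ∀ m v μs → Enumerates Λ′ m v μs → (p : Dec (part v ≡ i)) →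
        only p (F.vertex (baseᵒ v)) ≈ listSum (λ μ → extension-gen μ * extension-gen μ ⋆) μs
      only-sum m v μs enum (yes p) = trans
        (F.vertex-sum (σ m) (baseᵒ v) (List.map base μs) (enumerates m v enum))
        (trans (listSum-map (λ μ → F.gen μ * F.gen μ ⋆) base μs)
          (listSum-cong (All.map (λ {μ} (_ , r≡) →
            let e = only-cong {x = F.gen (base μ)} (≡.trans (≡.sym p) (≡.cong part (≡.sym r≡)))
                      (yes ≡.refl) (part (Λ′.r μ) ≟ i) refl
            in *-cong e (⋆-cong e)) (Enumerates.sound enum))))
      only-sum m v μs enum (no ¬p) = sym (listSum-zero (All.map (λ {μ} (_ , r≡) →
        trans (*-congʳ (sym (only-cong {x = F.gen (base μ)} (≡.cong part (≡.sym r≡)) (no ¬p) (part (Λ′.r μ) ≟ i) refl))) (zeroˡ _))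
        (Enumerates.sound enum)))

    -- Annihilating all parts except `i` is compatible with the relations because the range and the
    -- source of a morphism lie in the same part, hence so do the factors of a composite and all
    -- terms of a sum over the morphisms with a given range.
    extension : Family Λ′ A
    extension = record
      { gen               = extension-gen
      ; gen-cong          = λ {μ} {ν} e → only-cong (≡.cong part (Λ′.r-cong e))
          (part (Λ′.r μ) ≟ i) (part (Λ′.r ν) ≟ i) (F.gen-cong (base-cong e))
      ; partialIsometry   = λ μ → only-partialIsometry (part (Λ′.r μ) ≟ i) (base μ)
      ; vertex-idempotent = λ v → trans (*-cong (vertex≈ v) (vertex≈ v))
          (trans (only-idempotent (part v ≟ i) (baseᵒ v)) (sym (vertex≈ v)))
      ; vertex-⋆          = λ v → trans (⋆-cong (vertex≈ v)) (trans (only-⋆ (part v ≟ i) (baseᵒ v)) (sym (vertex≈ v)))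
      ; vertex-orthogonal = λ u v u≢v → trans (*-cong (vertex≈ u) (vertex≈ v))
          (only-orthogonal (part u ≟ i) (part v ≟ i) (baseᵒ u) (baseᵒ v) λ p b → u≢v
            (≡.trans (≡.sym (copyᵒ-baseᵒ u)) (≡.trans (≡.cong₂ copyᵒ p b) (copyᵒ-baseᵒ v))))
      ; gen-compose       = λ μ ν e → trans
          (only-cong (≡.cong part (Λ′.r-compose μ ν e)) (part (Λ′.r (Λ′.compose μ ν e)) ≟ i) (part (Λ′.r μ) ≟ i)
            (trans (F.gen-cong (base-compose μ ν e)) (F.gen-compose _ _ _)))
          (only-* (≡.trans (≡.sym (part-s μ)) (≡.cong part e)) (part (Λ′.r μ) ≟ i) (part (Λ′.r ν) ≟ i))
      ; gen⋆gen           = λ μ → trans (only-⋆* (part (Λ′.r μ) ≟ i) (base μ))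
          (trans (only-cong (≡.sym (part-s μ)) (part (Λ′.r μ) ≟ i) (part (Λ′.s μ) ≟ i) (reflexive (≡.cong F.vertex (s-base μ))))
                 (sym (vertex≈ (Λ′.s μ))))
      ; vertex-sum        = λ m v μs enum → trans (vertex≈ v) (only-sum m v μs enum (part v ≟ i))
      }

-- The algebra of a disjoint union as a direct sum

module GraphDecomposition {ℝ : RealField} {k n : ℕ} {Λ′ Λ : RankGraph k} (copies : Copies Λ′ Λ n)
  (finite : Finite (RankGraph.Obj Λ)) {c ℓ : Level} {A B : CStar.CStarAlgebra ℝ c ℓ}
  (graphA : CuntzKrieger.IsGraphAlgebra ℝ Λ′ A) (graphB : CuntzKrieger.IsGraphAlgebra ℝ Λ B) where
  open CuntzKrieger ℝ
  open Copies copies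
  open StarHoms ℝ
  private
    module A = CStarAlgebra A
    module B = CStarAlgebra B
    module Λ′ = RankGraph Λ′
    module Λ = RankGraph Λ
    module graphA = IsGraphAlgebra graphA
    module graphB = IsGraphAlgebra graphB
    module FA = Family graphA.family
    module FB = Family graphB.family
    module MA = Matrices A.starRing
    module InA = Families {ℝ = ℝ} copies A
    module InB = Families {ℝ = ℝ} copies B
    module unitB = Unital.Unit (GraphUnit.unit finite graphB)

  proj : Fin n → StarHom A B
  proj i = graphA.extend B (InB.extension graphB.family i)

  incl : Fin n → StarHom B A
  incl i = graphB.extend A (InA.restriction graphA.family i)

  private
    projʰ : Fin n → StarRingHom A.starRing B.starRing
    projʰ i = StarHom.starRingHom (proj i)

    inclʰ : Fin n → StarRingHom B.starRing A.starRing
    inclʰ i = StarHom.starRingHom (incl i)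

  proj-gen : ∀ i μ → ⟦ projʰ i ⟧ (FA.gen μ) B.≈ InB.extension-gen graphB.family i μ
  proj-gen i = graphA.extend-gen B (InB.extension graphB.family i)

  incl-gen : ∀ i μ → ⟦ inclʰ i ⟧ (FB.gen μ) A.≈ FA.gen (copy i μ)
  incl-gen i = graphB.extend-gen A (InA.restriction graphA.family i)

  incl-vertex : ∀ i v → ⟦ inclʰ i ⟧ (FB.vertex v) A.≈ FA.vertex (copyᵒ i v)
  incl-vertex i v = A.trans (incl-gen i (Λ.ident v)) (FA.gen-cong (copy-ident i v))

  extension-gen-≡ : ∀ i μ → part (Λ′.r μ) ≡ i → InB.extension-gen graphB.family i μ B.≈ FB.gen (base μ)
  extension-gen-≡ i μ e with part (Λ′.r μ) ≟ i
  ... | yes _ = B.refl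
  ... | no ¬e = contradiction e ¬e

  extension-gen-≢ : ∀ i μ → part (Λ′.r μ) ≢ i → InB.extension-gen graphB.family i μ B.≈ B.0#
  extension-gen-≢ i μ ¬e with part (Λ′.r μ) ≟ i
  ... | yes e = contradiction e ¬e
  ... | no _  = B.refl

  part-r-copy : ∀ i μ → part (Λ′.r (copy i μ)) ≡ i
  part-r-copy i μ = ≡.trans (≡.cong part (r-copy i μ)) (part-copyᵒ i (Λ.r μ))

  proj-incl : ∀ i x → ⟦ projʰ i ⟧ (⟦ inclʰ i ⟧ x) B.≈ x
  proj-incl i = graphB.extend-unique B (compose B A B (proj i) (incl i)) (idˢ B) λ μ →
    B.trans (⟦⟧-cong (projʰ i) (incl-gen i μ)) (B.trans (proj-gen i (copy i μ))
      (B.trans (extension-gen-≡ i (copy i μ) (part-r-copy i μ)) (FB.gen-cong (base-copy i μ))))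

  proj-incl-≢ : ∀ i j → i ≢ j → ∀ x → ⟦ projʰ i ⟧ (⟦ inclʰ j ⟧ x) B.≈ B.0#
  proj-incl-≢ i j i≢j = graphB.extend-unique B (compose B A B (proj i) (incl j)) (zeroˢ B B) λ μ →
    B.trans (⟦⟧-cong (projʰ i) (incl-gen j μ)) (B.trans (proj-gen i (copy j μ))
      (extension-gen-≢ i (copy j μ) λ e → i≢j (≡.trans (≡.sym e) (part-r-copy j μ))))

  -- The images of the unit are inserted between the two factors. Their product is a double sum of
  -- products of vertex projections from different parts, each of which vanishes.
  incl⊥ : PairwiseOrthogonal inclʰ
  incl⊥ i j i≢j x y = begin
    ⟦ inclʰ i ⟧ x A.* ⟦ inclʰ j ⟧ y
      ≈⟨ A.*-cong (split (inclʰ i) (unitB.identityʳ x)) (split (inclʰ j) (unitB.identityˡ y)) ⟩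
    (⟦ inclʰ i ⟧ x A.* ⟦ inclʰ i ⟧ unitB.e) A.* (⟦ inclʰ j ⟧ unitB.e A.* ⟦ inclʰ j ⟧ y)
      ≈⟨ A.trans (A.*-assoc _ _ _) (A.*-congˡ (A.sym (A.*-assoc _ _ _))) ⟩
    ⟦ inclʰ i ⟧ x A.* ((⟦ inclʰ i ⟧ unitB.e A.* ⟦ inclʰ j ⟧ unitB.e) A.* ⟦ inclʰ j ⟧ y)
      ≈⟨ A.*-congˡ (A.trans (A.*-congʳ units) (A.zeroˡ _)) ⟩
    ⟦ inclʰ i ⟧ x A.* A.0#
      ≈⟨ A.zeroʳ _ ⟩
    A.0# ∎
    where
    open SetoidReasoning A.setoid

    split : ∀ φ {x y z} → x B.* y B.≈ z → ⟦ φ ⟧ z A.≈ ⟦ φ ⟧ x A.* ⟦ φ ⟧ y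
    split φ e = A.trans (⟦⟧-cong φ (B.sym e)) (*-homo φ _ _)

    vertices⊥ : ∀ v w → ⟦ inclʰ i ⟧ (FB.vertex v) A.* ⟦ inclʰ j ⟧ (FB.vertex w) A.≈ A.0#
    vertices⊥ v w = A.trans (A.*-cong (incl-vertex i v) (incl-vertex j w)) (FA.vertex-orthogonal _ _ λ e →
      i≢j (≡.trans (≡.sym (part-copyᵒ i v)) (≡.trans (≡.cong part e) (part-copyᵒ j w))))

    at : Fin (length (Finite.elements finite)) → Λ.Obj
    at = lookup (Finite.elements finite)

    units : ⟦ inclʰ i ⟧ unitB.e A.* ⟦ inclʰ j ⟧ unitB.e A.≈ A.0#
    units = begin
      ⟦ inclʰ i ⟧ unitB.e A.* ⟦ inclʰ j ⟧ unitB.e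
        ≈⟨ A.*-cong (sum-homo (inclʰ i) (FB.vertex ∘ at)) (sum-homo (inclʰ j) (FB.vertex ∘ at)) ⟩
      MA.sum (λ a → ⟦ inclʰ i ⟧ (FB.vertex (at a))) A.* MA.sum (λ b → ⟦ inclʰ j ⟧ (FB.vertex (at b)))
        ≈⟨ MA.sum-* _ (λ a → ⟦ inclʰ i ⟧ (FB.vertex (at a))) ⟩
      MA.sum (λ a → ⟦ inclʰ i ⟧ (FB.vertex (at a)) A.* MA.sum (λ b → ⟦ inclʰ j ⟧ (FB.vertex (at b))))
        ≈⟨ MA.sum-zero (λ a → A.trans (MA.*-sum _ (λ b → ⟦ inclʰ j ⟧ (FB.vertex (at b))))
             (MA.sum-zero λ b → vertices⊥ (at a) (at b))) ⟩
      A.0# ∎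

  private
    ·-sum : ∀ z {m} (f : Fin m → A.Carrier) → MA.sum (λ i → z A.· f i) A.≈ z A.· MA.sum f
    ·-sum z {ℕ.zero}  f = A.sym (Unital.·-zeroʳ ℝ A z)
    ·-sum z {ℕ.suc m} f = A.trans (A.+-congˡ (·-sum z (f ∘ suc))) (A.sym (A.·-distribˡ z _ _))

    reassemble : StarHom A A
    reassemble = record
      { starRingHom = glue inclʰ incl⊥ ∘ʰ tuple projʰ
      ; ·-homo      = λ z x → A.trans
          (MA.sum-cong-≋ λ i → StarHom.·-homo (compose A B A (incl i) (proj i)) z x)
          (·-sum z (λ i → ⟦ inclʰ i ⟧ (⟦ projʰ i ⟧ x)))
      ; bounded     = BoundedMaps.bounded-sum ℝ A A (λ i → StarHom.bounded (compose A B A (incl i) (proj i)))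
      }

  sum-incl-proj : ∀ x → MA.sum (λ i → ⟦ inclʰ i ⟧ (⟦ projʰ i ⟧ x)) A.≈ x
  sum-incl-proj = graphA.extend-unique A reassemble (idˢ A) λ μ → begin
    MA.sum (λ i → ⟦ inclʰ i ⟧ (⟦ projʰ i ⟧ (FA.gen μ)))
      ≈⟨ sum-single A.+-commutativeMonoid (λ i → ⟦ inclʰ i ⟧ (⟦ projʰ i ⟧ (FA.gen μ))) (part (Λ′.r μ))
           (λ j j≢ → A.trans (⟦⟧-cong (inclʰ j) (B.trans (proj-gen j μ) (extension-gen-≢ j μ (j≢ ∘ ≡.sym))))
                             (0-homo (inclʰ j))) ⟩
    ⟦ inclʰ (part (Λ′.r μ)) ⟧ (⟦ projʰ (part (Λ′.r μ)) ⟧ (FA.gen μ))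
      ≈⟨ ⟦⟧-cong (inclʰ _) (B.trans (proj-gen _ μ) (extension-gen-≡ _ μ ≡.refl)) ⟩
    ⟦ inclʰ (part (Λ′.r μ)) ⟧ (FB.gen (base μ))
      ≈⟨ incl-gen _ (base μ) ⟩
    FA.gen (copy (part (Λ′.r μ)) (base μ))
      ≈⟨ FA.gen-cong (copy-base μ) ⟩
    FA.gen μ ∎
    where
    open SetoidReasoning A.setoid

  decomposition : Decomposition A B n
  decomposition = record
    { proj          = proj
    ; incl          = incl
    ; incl⊥         = incl⊥
    ; proj-incl     = proj-incl
    ; proj-incl-≢   = proj-incl-≢
    ; sum-incl-proj = sum-incl-proj
    }

open import Data.Nat.Base using (_≤_; _<_; _+_; _∸_; _/_; _%_; NonZero; >-nonZero)
open import Data.Nat.DivMod using (m<n⇒m%n≡m; m*[n/m]≡n)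
open import Data.Nat.Divisibility using (_∣_)

-- Pointed 2t-gons

-- The exchange comes from the conventions: steps that change the white vertex are the first
-- direction `M₁` for tiles, but the second direction `M-V` for polygons.
swap : Vec ℕ 2 → Vec ℕ 2
swap (m ∷ n ∷ []) = n ∷ m ∷ []

swap-involutive : ∀ m → swap (swap m) ≡ m
swap-involutive (m ∷ n ∷ []) = ≡.refl

-- N₁′ consists of copies of N₂, and N₂′ of copies of N₁.
module GridCopies {S S′ : Set} (fin : Finite S) (fin′ : Finite S′)
  {N₁ N₂ : Matrix S} (admissible : Admissible fin N₁ N₂)
  {N₁′ N₂′ : Matrix S′} (admissible′ : Admissible fin′ N₁′ N₂′)
  {n : ℕ} (copyᵒ : Fin n → S → S′) (part : S′ → Fin n) (baseᵒ : S′ → S)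
  (part-copyᵒ : ∀ i a → part (copyᵒ i a) ≡ i) (baseᵒ-copyᵒ : ∀ i a → baseᵒ (copyᵒ i a) ≡ a)
  (copyᵒ-baseᵒ : ∀ a → copyᵒ (part a) (baseᵒ a) ≡ a)
  (copy-N₁ : ∀ i {a b} → N₁ a b ≡ 1 → N₂′ (copyᵒ i a) (copyᵒ i b) ≡ 1)
  (copy-N₂ : ∀ i {a b} → N₂ a b ≡ 1 → N₁′ (copyᵒ i a) (copyᵒ i b) ≡ 1)
  (base-N₁′ : ∀ {a b} → N₁′ a b ≡ 1 → part a ≡ part b × N₂ (baseᵒ a) (baseᵒ b) ≡ 1)
  (base-N₂′ : ∀ {a b} → N₂′ a b ≡ 1 → part a ≡ part b × N₁ (baseᵒ a) (baseᵒ b) ≡ 1)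
  where
  private
    module G = GridGraph fin admissible
    module G′ = GridGraph fin′ admissible′
  open Grids using (grid; module IsGrid)
  open IsGrid

  copy : Fin n → G.Morphism → G′.Morphism
  copy i (G.morphism {w} {h} {f} g) = G′.morphism {h} {w} {λ p q → copyᵒ i (f q p)} (grid
    (λ p q p< q≤ → copy-N₂ i (step₂ g q p q≤ p<))
    (λ p q p≤ q< → copy-N₁ i (step₁ g q p q< p≤)))

  base : G′.Morphism → G.Morphism
  base (G′.morphism {w} {h} {f} g) = G.morphism {h} {w} {λ p q → baseᵒ (f q p)} (grid
    (λ p q p< q≤ → proj₂ (base-N₂′ (step₂ g q p q≤ p<)))
    (λ p q p≤ q< → proj₂ (base-N₁′ (step₁ g q p q< p≤))))

  -- Steps preserve the part, and every position is reached from the corner by steps. Hence one copy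
  -- accommodates a whole grid, as `copy-base` requires.
  part-constant : ∀ φ p q → p ≤ G′.Morphism.width φ → q ≤ G′.Morphism.height φ →
                  part (G′.Morphism.at φ p q) ≡ part (G′.range φ)
  part-constant φ ℕ.zero    ℕ.zero    _  _  = ≡.refl
  part-constant φ (ℕ.suc p) q         p< q≤ = ≡.trans
    (≡.sym (proj₁ (base-N₁′ (step₁ (G′.Morphism.isGrid φ) p q p< q≤)))) (part-constant φ p q (ℕ.<⇒≤ p<) q≤)
  part-constant φ ℕ.zero    (ℕ.suc q) p≤ q< = ≡.trans
    (≡.sym (proj₁ (base-N₂′ (step₂ (G′.Morphism.isGrid φ) 0 q p≤ q<)))) (part-constant φ 0 q p≤ (ℕ.<⇒≤ q<))

  gridCopies : Copies G′.gridGraph G.gridGraph n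
  gridCopies = record
    { σ            = swap
    ; σ-involutive = swap-involutive
    ; copy         = copy
    ; copyᵒ        = copyᵒ
    ; base         = base
    ; baseᵒ        = baseᵒ
    ; part         = part
    ; copy-cong    = λ { i (G.equal w h e) → G′.equal h w λ p q p≤ q≤ → ≡.cong (copyᵒ i) (e q p q≤ p≤) }
    ; base-cong    = λ { (G′.equal w h e) → G.equal h w λ p q p≤ q≤ → ≡.cong baseᵒ (e q p q≤ p≤) }
    ; base-copy    = λ i μ → G.equal ≡.refl ≡.refl λ p q _ _ → baseᵒ-copyᵒ i _
    ; copy-base    = λ μ → G′.equal ≡.refl ≡.refl λ p q p≤ q≤ → ≡.trans
        (≡.cong (λ i → copyᵒ i _) (≡.sym (part-constant μ p q p≤ q≤))) (copyᵒ-baseᵒ _)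
    ; part-copyᵒ   = part-copyᵒ
    ; baseᵒ-copyᵒ  = baseᵒ-copyᵒ
    ; copyᵒ-baseᵒ  = copyᵒ-baseᵒ
    ; r-copy       = λ _ _ → ≡.refl
    ; s-copy       = λ _ _ → ≡.refl
    ; d-copy       = λ _ _ → ≡.refl
    ; copy-ident   = λ _ _ → G′.equal ≡.refl ≡.refl λ _ _ _ _ → ≡.refl
    -- A composite is determined by its restrictions to the two blocks, and the transposed copy of
    -- the composite has the required ones.
    ; copy-compose = λ i μ ν e e′ → G′.≈-sym (G′.equal ≡.refl ≡.refl
        (G′.compose-unique (copy i μ) (copy i ν) e′ (G′.Morphism.isGrid (copy i (G.compose μ ν e)))
          (λ p q p≤ q≤ → ≡.cong (copyᵒ i) (≡.sym (G.compose-first μ ν e q p q≤ p≤)))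
          (λ p q _ _ → ≡.cong (copyᵒ i) (≡.sym (G.compose-second μ ν e q p)))))
    }

-- The steps of the pointed 2t-gons preserve the class of r modulo h = t / 2,
-- and act on the four values of (r , b) in each class as the steps of the
-- pointed tiles do on {0, 1, 2, 3}.
module PolygonCopies (α β t : ℕ) .{{_ : NonZero t}} (2∣t : 2 ∣ t) where
  open Polygons α β t
  private
    module T = Tiles α β
    module IT = ProductLike {α} {β} (finiteFin 4)
    module IP = ProductLike {α} {β} (finiteFin t ×-finite finiteBool)

    h = t / 2

    h+h≡t : h + h ≡ t
    h+h≡t = ≡.trans (≡.cong (h +_) (≡.sym (ℕ.+-identityʳ h))) (m*[n/m]≡n 2∣t)

    t∸h≡h : t ∸ h ≡ h
    t∸h≡h = ≡.trans (≡.cong (_∸ h) (≡.sym h+h≡t)) (ℕ.m+n∸m≡n h h)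

  -- `c` is a class modulo `h`, and the Boolean chooses between its representatives c and c + h
  -- below `t`.
  place : Fin h → Bool → Fin t
  place c false = idx (toℕ c)
  place c true  = shift (idx (toℕ c)) h

  half-turn : Bool → ℕ
  half-turn false = 0
  half-turn true  = h

  -- Reduction modulo `t` changes nothing, as c + h < h + h = t.
  toℕ-place : ∀ c u → toℕ (place c u) ≡ toℕ c + half-turn u
  toℕ-place c false = ≡.trans (toℕ-idx (toℕ c)) (≡.trans (m<n⇒m%n≡m
    (ℕ.≤-trans (toℕ<n c) (ℕ.≤-trans (ℕ.m≤m+n h h) (ℕ.≤-reflexive h+h≡t)))) (≡.sym (ℕ.+-identityʳ _)))
  toℕ-place c true  = ≡.trans (toℕ-idx _) (≡.trans
    (≡.cong (λ m → (m + h) % t) (≡.trans (toℕ-place c false) (ℕ.+-identityʳ _)))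
    (m<n⇒m%n≡m (ℕ.≤-trans (ℕ.+-monoˡ-< h (toℕ<n c)) (ℕ.≤-reflexive h+h≡t))))

  upper : ∀ (r : Fin t) → ¬ (toℕ r < h) → toℕ r ∸ h < h
  upper r r≮h = ℕ.+-cancelʳ-< h _ _ (ℕ.≤-trans
    (ℕ.≤-reflexive (≡.cong ℕ.suc (ℕ.m∸n+n≡m (ℕ.≮⇒≥ r≮h)))) (ℕ.≤-trans (toℕ<n r) (ℕ.≤-reflexive (≡.sym h+h≡t))))

  half : Fin t → Fin h × Bool
  half r with toℕ r <? h
  ... | yes r<h = fromℕ< r<h , false
  ... | no r≮h  = fromℕ< (upper r r≮h) , true

  place-half : ∀ r → place (proj₁ (half r)) (proj₂ (half r)) ≡ r
  place-half r with toℕ r <? h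
  ... | yes r<h = toℕ-injective (≡.trans (toℕ-place (fromℕ< r<h) false)
    (≡.trans (ℕ.+-identityʳ _) (toℕ-fromℕ< r<h)))
  ... | no r≮h  = toℕ-injective (≡.trans (toℕ-place (fromℕ< (upper r r≮h)) true)
    (≡.trans (≡.cong (_+ h) (toℕ-fromℕ< (upper r r≮h))) (ℕ.m∸n+n≡m (ℕ.≮⇒≥ r≮h))))

  place-injective : ∀ c u c′ u′ → place c u ≡ place c′ u′ → (c , u) ≡ (c′ , u′)
  place-injective c u c′ u′ e = cases u u′
    (≡.trans (≡.sym (toℕ-place c u)) (≡.trans (≡.cong toℕ e) (toℕ-place c′ u′)))
    where
    too-large : ∀ {c c′ : Fin h} → ¬ (toℕ c + 0 ≡ toℕ c′ + h)
    too-large {c} {c′} e = ℕ.<⇒≱ (toℕ<n c) (ℕ.≤-trans (ℕ.m≤n+m h (toℕ c′))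
      (ℕ.≤-reflexive (≡.trans (≡.sym e) (ℕ.+-identityʳ _))))

    cases : ∀ u u′ → toℕ c + half-turn u ≡ toℕ c′ + half-turn u′ → (c , u) ≡ (c′ , u′)
    cases false false e = ≡.cong (_, false) (toℕ-injective (ℕ.+-cancelʳ-≡ 0 _ _ e))
    cases true  true  e = ≡.cong (_, true) (toℕ-injective (ℕ.+-cancelʳ-≡ h _ _ e))
    cases false true  e = contradiction e (too-large {c} {c′})
    cases true  false e = contradiction (≡.sym e) (too-large {c′} {c})

  half-place : ∀ c u → half (place c u) ≡ (c , u)
  half-place c u = place-injective _ _ c u (place-half (place c u))

  -- The first bit tells whether the superscript is c + h rather than c, the second whether there is
  -- a bar. For `t` = 2 this matches the leading letters of the four kinds of tiles.
  bits : Fin 4 → Bool × Bool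
  bits 0F = false , false
  bits 1F = false , true
  bits 2F = true  , false
  bits 3F = true  , true

  unbits : Bool × Bool → Fin 4
  unbits (false , false) = 0F
  unbits (false , true)  = 1F
  unbits (true  , false) = 2F
  unbits (true  , true)  = 3F

  unbits-bits : ∀ l → unbits (bits l) ≡ l
  unbits-bits 0F = ≡.refl
  unbits-bits 1F = ≡.refl
  unbits-bits 2F = ≡.refl
  unbits-bits 3F = ≡.refl

  bits-unbits : ∀ u → bits (unbits u) ≡ u
  bits-unbits (false , false) = ≡.refl
  bits-unbits (false , true)  = ≡.refl
  bits-unbits (true  , false) = ≡.refl
  bits-unbits (true  , true)  = ≡.refl

  copyᴷ : Fin h → Fin 4 → Fin t × Bool
  copyᴷ c l = place c (proj₁ (bits l)) , proj₂ (bits l)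

  partᴷ : Fin t × Bool → Fin h
  partᴷ (r , b) = proj₁ (half r)

  baseᴷ : Fin t × Bool → Fin 4
  baseᴷ (r , b) = unbits (proj₂ (half r) , b)

  part-copyᴷ : ∀ c l → partᴷ (copyᴷ c l) ≡ c
  part-copyᴷ c l = ≡.cong proj₁ (half-place c (proj₁ (bits l)))

  base-copyᴷ : ∀ c l → baseᴷ (copyᴷ c l) ≡ l
  base-copyᴷ c l = ≡.trans
    (≡.cong (λ x → unbits (proj₂ x , proj₂ (bits l))) (half-place c (proj₁ (bits l)))) (unbits-bits l)

  copy-baseᴷ : ∀ k → copyᴷ (partᴷ k) (baseᴷ k) ≡ k
  copy-baseᴷ (r , b) = ≡.trans
    (≡.cong (λ u → place (proj₁ (half r)) (proj₁ u) , proj₂ u) (bits-unbits (proj₂ (half r) , b)))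
    (≡.cong (_, b) (place-half r))

  shift-0 : ∀ r → shift r 0 ≡ r
  shift-0 r = ≡.trans (≡.cong idx (ℕ.+-identityʳ (toℕ r))) (idx-toℕ r)

  shift-t : ∀ r → shift r t ≡ r
  shift-t r = ≡.trans (idx-cong (+-t (toℕ r))) (idx-toℕ r)

  shift-h-h : ∀ r → shift (shift r h) h ≡ r
  shift-h-h r = ≡.trans (shift-shift r h h) (≡.trans (≡.cong (shift r) h+h≡t) (shift-t r))

  -- Both sides flip the bar bit alone, as the shifts by 0 and by `t` in `turn 0` are trivial.
  turn₀-copyᴷ : ∀ c l → copyᴷ c (T.σ₁ l) ≡ turn 0 (copyᴷ c l)
  turn₀-copyᴷ c 0F = ≡.cong (_, true) (≡.sym (shift-0 _))
  turn₀-copyᴷ c 1F = ≡.cong (_, false) (≡.sym (shift-t _))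
  turn₀-copyᴷ c 2F = ≡.cong (_, true) (≡.sym (shift-0 _))
  turn₀-copyᴷ c 3F = ≡.cong (_, false) (≡.sym (shift-t _))

  -- Both sides flip both bits: as `t` is even, t - h = h, and either shift in `turn h` exchanges c
  -- and c + h.
  turnₕ-copyᴷ : ∀ c l → copyᴷ c (T.σ₂ l) ≡ turn h (copyᴷ c l)
  turnₕ-copyᴷ c 0F = ≡.refl
  turnₕ-copyᴷ c 1F = ≡.cong (λ m → shift (idx (toℕ c)) m , false) (≡.sym t∸h≡h)
  turnₕ-copyᴷ c 2F = ≡.cong (_, true) (≡.sym (shift-h-h _))
  turnₕ-copyᴷ c 3F = ≡.cong (_, false) (≡.sym (≡.trans (≡.cong (shift _) t∸h≡h) (shift-h-h _)))

  module Equivariant (τ : Fin 4 → Fin 4) (τ′ : Fin t × Bool → Fin t × Bool)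
                     (τ′-copyᴷ : ∀ c l → copyᴷ c (τ l) ≡ τ′ (copyᴷ c l)) where

    -- Every `k` lies in some copy, so that `τ′` is completely described by `τ`.
    τ′-copy-base : ∀ k → τ′ k ≡ copyᴷ (partᴷ k) (τ (baseᴷ k))
    τ′-copy-base k = ≡.trans (≡.cong τ′ (≡.sym (copy-baseᴷ k))) (≡.sym (τ′-copyᴷ _ _))

    part-τ′ : ∀ k → partᴷ k ≡ partᴷ (τ′ k)
    part-τ′ k = ≡.sym (≡.trans (≡.cong partᴷ (τ′-copy-base k)) (part-copyᴷ _ (τ (baseᴷ k))))

    base-τ′ : ∀ k → baseᴷ (τ′ k) ≡ τ (baseᴷ k)
    base-τ′ k = ≡.trans (≡.cong baseᴷ (τ′-copy-base k)) (base-copyᴷ _ _)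

  private
    module Turn₀ = Equivariant T.σ₁ (turn 0) turn₀-copyᴷ
    module Turnₕ = Equivariant T.σ₂ (turn h) turnₕ-copyᴷ

  copyᵒ : Fin h → T.Tile → Polygon
  copyᵒ c (i , j , l) = i , j , copyᴷ c l

  partᵒ : Polygon → Fin h
  partᵒ (i , j , k) = partᴷ k

  baseᵒ : Polygon → T.Tile
  baseᵒ (i , j , k) = i , j , baseᴷ k

  copy-M₁ : ∀ c {a b} → T.M₁ a b ≡ 1 → M-V (copyᵒ c a) (copyᵒ c b) ≡ 1
  copy-M₁ c {a@(_ , _ , l)} {b} e with i≢ , j≡ , l≡ ← proj₁ (T.M₁-decides a b) e =
    proj₂ (V-decides (copyᵒ c a) (copyᵒ c b)) (i≢ , j≡ , ≡.trans (≡.cong (copyᴷ c) l≡) (turn₀-copyᴷ c l))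

  copy-M₂ : ∀ c {a b} → T.M₂ a b ≡ 1 → M-U (copyᵒ c a) (copyᵒ c b) ≡ 1
  copy-M₂ c {a@(_ , _ , l)} {b} e with i≡ , j≢ , l≡ ← proj₁ (T.M₂-decides a b) e =
    proj₂ (U-decides (copyᵒ c a) (copyᵒ c b)) (i≡ , j≢ , ≡.trans (≡.cong (copyᴷ c) l≡) (turnₕ-copyᴷ c l))

  base-M-U : ∀ {a b} → M-U a b ≡ 1 → partᵒ a ≡ partᵒ b × T.M₂ (baseᵒ a) (baseᵒ b) ≡ 1
  base-M-U {a@(_ , _ , k)} {b} e with i≡ , j≢ , k≡ ← proj₁ (U-decides a b) e =
      ≡.trans (Turnₕ.part-τ′ k) (≡.cong partᴷ (≡.sym k≡))
    , proj₂ (T.M₂-decides (baseᵒ a) (baseᵒ b)) (i≡ , j≢ , ≡.trans (≡.cong baseᴷ k≡) (Turnₕ.base-τ′ k))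

  base-M-V : ∀ {a b} → M-V a b ≡ 1 → partᵒ a ≡ partᵒ b × T.M₁ (baseᵒ a) (baseᵒ b) ≡ 1
  base-M-V {a@(_ , _ , k)} {b} e with i≢ , j≡ , k≡ ← proj₁ (V-decides a b) e =
      ≡.trans (Turn₀.part-τ′ k) (≡.cong partᴷ (≡.sym k≡))
    , proj₂ (T.M₁-decides (baseᵒ a) (baseᵒ b)) (i≢ , j≡ , ≡.trans (≡.cong baseᴷ k≡) (Turn₀.base-τ′ k))

  polygonCopies : Copies (polygonGraph 2∣t) T.tileGraph h
  polygonCopies = GridCopies.gridCopies IT.finiteIndex IP.finiteIndex T.admissible (admissible 2∣t)
    copyᵒ partᵒ baseᵒ
    (λ c (_ , _ , l) → part-copyᴷ c l)
    (λ c (i , j , l) → ≡.cong (λ l → i , j , l) (base-copyᴷ c l))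
    (λ (i , j , k) → ≡.cong (λ k → i , j , k) (copy-baseᴷ k))
    copy-M₁ copy-M₂ base-M-U base-M-V

theorem7p4 : ∀ {c ℓ} (ℝ : RealField) → let open CuntzKrieger ℝ in
    (α β t : ℕ) → 2 ≤ α → 2 ≤ β → (2≤t : 2 ≤ t) (2∣t : 2 ∣ t) →
    (A B : CStarAlgebra c ℓ) → IsGraphAlgebra (Λₜ α β t 2≤t 2∣t) A → IsGraphAlgebra (Λ α β) B →
    (ε : Fin 2) → K ε A ≅ᴳ K ε B ^ᴳ (t / 2)
theorem7p4 ℝ α β t 2≤α 2≤β 2≤t 2∣t A B graphA graphB = λ where
    zero       → K₀-decompose ℝ A B (GraphUnit.unit finiteₜ graphA) (GraphUnit.unit finite graphB) decomposition
    (suc zero) → DecomposeK₁.K₁-decompose decomposition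
  where
  finite : Finite (RankGraph.Obj (Λ α β))
  finite = ProductLike.finiteIndex (finiteFin 4)

  finiteₜ : Finite (RankGraph.Obj (Λₜ α β t 2≤t 2∣t))
  finiteₜ = ProductLike.finiteIndex (finiteFin t ×-finite finiteBool)

  copies : Copies (Λₜ α β t 2≤t 2∣t) (Λ α β) (t / 2)
  copies = PolygonCopies.polygonCopies α β t {{>-nonZero (ℕ.<⇒≤ 2≤t)}} 2∣t

  decomposition : Decomposition A B (t / 2)
  decomposition = GraphDecomposition.decomposition copies finite graphA graphB
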